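{- Let $n, m \geq 1$ be integers and let $p \leq n-1$ be a natural number. Then $$ \mathbf{R}(M_{\langle n,n,m\rangle}) \;\geq\; \frac{2p+1}{p+1}\, n m + n^2 - \left(1 + 2p\binom{2p}{p-1}\right) n . $$
   Context: All vector spaces and matrices are over the complex numbers $\mathbb{C}$. For positive integers $n,m,l$, $M_{\langle n,m,l\rangle}: \mathrm{Mat}_{n\times m}(\mathbb{C})\times \mathrm{Mat}_{m\times l}(\mathbb{C})\to \mathrm{Mat}_{n\times l}(\mathbb{C})$ denotes the bilinear map $(X,Y)\mapsto XY$ (matrix multiplication); thus $M_{\langle n,n,m\rangle}$ is the multiplication of an $n\times n$ matrix by an $n\times m$ matrix. The rank $\mathbf{R}(T)$ of a bilinear map $T: U\times V\to W$ of finite-dimensional complex vector spaces is the smallest integer $r\ge 0$ such that there exist linear forms $u_1,\dots,u_r$ on $U$, linear forms $v_1,\dots,v_r$ on $V$, and vectors $w_1,\dots,w_r\in W$ with $T(x,y)=\sum_{i=1}^r u_i(x)v_i(y)w_i$ for all $x\in U$, $y\in V$. Binomial coefficients $\binom{a}{b}$ with $b<0$ are $0$. -}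

module Defs where

open import Algebra.Bundles using (CommutativeRing)
open import Algebra.Module.Bundles using (LeftModule)
open import Algebra.Module.Morphism.Structures using (module LeftModuleMorphisms)
import Algebra.Construct.Pointwise as Pointwise
import Algebra.Module.Construct.TensorUnit as TensorUnit
import Algebra.Definitions.RawMonoid as RawMonoidDefinitions
import Algebra.Properties.AbelianGroup as AbelianGroupProperties
import Algebra.Properties.CommutativeSemigroup as CommutativeSemigroupProperties
import Algebra.Properties.Ring as RingProperties
import Algebra.Solver.Ring.NaturalCoefficients.Default as SemiringSolver
import Algebra.Properties.Semiring.Sum as SemiringSum
open import Data.Fin.Base using (Fin)
open import Data.Integer.Base using (ℤ; -[1+_]; +_)
open import Data.Nat.Base as ℕ using (ℕ)
import Data.Nat.Properties as ℕ
open import Data.Nat.Combinatorics using (_C_)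
open import Data.Product.Base using (_×_; _,_; ∃; proj₁; proj₂)
open import Data.Rational.Base using (ℚ; 0ℚ; 1ℚ; ½; 1/_; ∣_∣; _+_; _-_; _*_; -_; _<_; _≤_; Positive; NonZero; positive)
import Data.Rational.Properties as ℚ
open import Data.Rational.Solver using (module +-*-Solver)
open import Level using (Level; 0ℓ; _⊔_)
open import Relation.Binary.PropositionalEquality using (_≡_; refl; sym; trans; cong; cong₂; subst)

private
  variable
    c ℓ m₁ ℓ₁ m₂ ℓ₂ m₃ ℓ₃ : Level

-- The real numbers, as the completion of ℚ: Cauchy sequences of
-- rationals, two of them being equal when their difference tends to 0.

IsCauchy : (ℕ → ℚ) → Set
IsCauchy x = ∀ ε → 0ℚ < ε → ∃ λ N → ∀ i j → N ℕ.≤ i → N ℕ.≤ j → ∣ x i - x j ∣ < ε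

record ℝ : Set where
  constructor mkℝ
  field
    seq      : ℕ → ℚ
    isCauchy : IsCauchy seq

open ℝ public

infix 4 _≈ᴿ_

record _≈ᴿ_ (x y : ℝ) : Set where
  constructor mk≈ᴿ
  field
    difference→0 : ∀ ε → 0ℚ < ε → ∃ λ N → ∀ i → N ℕ.≤ i → ∣ seq x i - seq y i ∣ < ε

open _≈ᴿ_ public

private
  open +-*-Solver using (solve; _:+_; _:*_; _:-_; :-_; _:=_)

  halves : ∀ ε → ε * ½ + ε * ½ ≡ ε
  halves ε = trans (sym (ℚ.*-distribˡ-+ ε ½ ½)) (ℚ.*-identityʳ ε)

  half-pos : ∀ {ε} → 0ℚ < ε → 0ℚ < ε * ½
  half-pos {ε} 0<ε = ℚ.positive⁻¹ (ε * ½) {{ℚ.pos*pos⇒pos ε {{positive 0<ε}} ½}}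

  +-halves : ∀ {ε} {p q r} → r ≡ p + q → ∣ p ∣ < ε * ½ → ∣ q ∣ < ε * ½ → ∣ r ∣ < ε
  +-halves {ε} {p} {q} {r} r≡p+q p< q< = begin-strict
    ∣ r ∣          ≡⟨ cong ∣_∣ r≡p+q ⟩
    ∣ p + q ∣      ≤⟨ ℚ.∣p+q∣≤∣p∣+∣q∣ p q ⟩
    ∣ p ∣ + ∣ q ∣  <⟨ ℚ.+-mono-< p< q< ⟩
    ε * ½ + ε * ½  ≡⟨ halves ε ⟩
    ε              ∎
    where open ℚ.≤-Reasoning

  neg-diff : ∀ p q → ∣ - p - - q ∣ ≡ ∣ p - q ∣
  neg-diff p q = trans (cong ∣_∣ (solve 2 (λ p q → :- p :- :- q := :- (p :- q)) refl p q)) (ℚ.∣-p∣≡∣p∣ (p - q))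

  swap-diff : ∀ p q → ∣ p - q ∣ ≡ ∣ q - p ∣
  swap-diff p q = trans (cong ∣_∣ (solve 2 (λ p q → p :- q := :- (q :- p)) refl p q)) (ℚ.∣-p∣≡∣p∣ (q - p))

  self-diff : ∀ {p q} ε → 0ℚ < ε → p ≡ q → ∣ p - q ∣ < ε
  self-diff {p} ε 0<ε refl = subst (λ z → ∣ z ∣ < ε) (sym (ℚ.+-inverseʳ p)) 0<ε

  +-diff : ∀ p q r s → (p + q) - (r + s) ≡ (p - r) + (q - s)
  +-diff = solve 4 (λ p q r s → (p :+ q) :- (r :+ s) := (p :- r) :+ (q :- s)) refl

  -- The tolerance on the factors that yields tolerance ε on a product
  -- of factors bounded by A and B.
  *-tolerance : ∀ A B → 0ℚ < A → 0ℚ < B → ∀ ε → 0ℚ < ε →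
                ∃ λ δ → 0ℚ < δ × (∀ {p q r s} → ∣ p ∣ ≤ A → ∣ s ∣ ≤ B →
                                  ∣ p - r ∣ < δ → ∣ q - s ∣ < δ → ∣ p * q - r * s ∣ < ε)
  *-tolerance A B 0<A 0<B ε 0<ε = δ , ℚ.positive⁻¹ δ , bound
    where
    open ℚ.≤-Reasoning
    instance
      A⁺ : Positive A
      A⁺ = positive 0<A
      B⁺ : Positive B
      B⁺ = positive 0<B
      ε⁺ : Positive ε
      ε⁺ = positive 0<ε
      S⁺ : Positive (A + B)
      S⁺ = ℚ.pos+pos⇒pos A B
      S≢0 : NonZero (A + B)
      S≢0 = ℚ.pos⇒nonZero (A + B)
    S⁻¹ : ℚ
    S⁻¹ = 1/ (A + B)
    instance
      S⁻¹⁺ : Positive S⁻¹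
      S⁻¹⁺ = ℚ.1/pos⇒pos (A + B)
    δ : ℚ
    δ = ε * S⁻¹
    instance
      δ⁺ : Positive δ
      δ⁺ = ℚ.pos*pos⇒pos ε S⁻¹

    split : ∀ p q r s → p * q - r * s ≡ p * (q - s) + (p - r) * s
    split = solve 4 (λ p q r s → p :* q :- r :* s := p :* (q :- s) :+ (p :- r) :* s) refl

    total : A * δ + δ * B ≡ ε
    total = trans
      (solve 4 (λ A B ε i → A :* (ε :* i) :+ (ε :* i) :* B := ε :* (i :* (A :+ B))) refl A B ε S⁻¹)
      (trans (cong (ε *_) (ℚ.*-inverseˡ (A + B))) (ℚ.*-identityʳ ε))

    bound : ∀ {p q r s} → ∣ p ∣ ≤ A → ∣ s ∣ ≤ B →
            ∣ p - r ∣ < δ → ∣ q - s ∣ < δ → ∣ p * q - r * s ∣ < ε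
    bound {p} {q} {r} {s} p≤A s≤B p-r<δ q-s<δ = begin-strict
      ∣ p * q - r * s ∣                      ≡⟨ cong ∣_∣ (split p q r s) ⟩
      ∣ p * (q - s) + (p - r) * s ∣          ≤⟨ ℚ.∣p+q∣≤∣p∣+∣q∣ (p * (q - s)) ((p - r) * s) ⟩
      ∣ p * (q - s) ∣ + ∣ (p - r) * s ∣      ≡⟨ cong₂ _+_ (ℚ.∣p*q∣≡∣p∣*∣q∣ p (q - s)) (ℚ.∣p*q∣≡∣p∣*∣q∣ (p - r) s) ⟩
      ∣ p ∣ * ∣ q - s ∣ + ∣ p - r ∣ * ∣ s ∣  ≤⟨ ℚ.+-mono-≤
        (ℚ.*-monoʳ-≤-nonNeg ∣ q - s ∣ {{ℚ.∣-∣-nonNeg (q - s)}} p≤A)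
        (ℚ.*-monoʳ-≤-nonNeg ∣ s ∣ {{ℚ.∣-∣-nonNeg s}} (ℚ.<⇒≤ p-r<δ)) ⟩
      A * ∣ q - s ∣ + δ * ∣ s ∣              <⟨ ℚ.+-mono-<-≤
        (ℚ.*-monoʳ-<-pos A q-s<δ)
        (ℚ.*-monoˡ-≤-nonNeg δ {{ℚ.pos⇒nonNeg δ}} s≤B) ⟩
      A * δ + δ * B                          ≡⟨ total ⟩
      ε                                      ∎

  eventuallyBounded : ∀ x → ∃ λ A → 0ℚ < A × ∃ λ N → ∀ i → N ℕ.≤ i → ∣ seq x i ∣ ≤ A
  eventuallyBounded x with isCauchy x 1ℚ (ℚ.positive⁻¹ 1ℚ)
  ... | N , close = 1ℚ + ∣ seq x N ∣ , ℚ.positive⁻¹ _ {{ℚ.pos+nonNeg⇒pos 1ℚ ∣ seq x N ∣ {{ℚ.∣-∣-nonNeg (seq x N)}}}} , N , bound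
    where
    open ℚ.≤-Reasoning
    bound : ∀ i → N ℕ.≤ i → ∣ seq x i ∣ ≤ 1ℚ + ∣ seq x N ∣
    bound i N≤i = begin
      ∣ seq x i ∣                        ≡⟨ cong ∣_∣ (solve 2 (λ p q → p := (p :- q) :+ q) refl (seq x i) (seq x N)) ⟩
      ∣ seq x i - seq x N + seq x N ∣    ≤⟨ ℚ.∣p+q∣≤∣p∣+∣q∣ (seq x i - seq x N) (seq x N) ⟩
      ∣ seq x i - seq x N ∣ + ∣ seq x N ∣ ≤⟨ ℚ.+-monoˡ-≤ ∣ seq x N ∣ (ℚ.<⇒≤ (close i N N≤i ℕ.≤-refl)) ⟩
      1ℚ + ∣ seq x N ∣                   ∎

  ⊔ˡ : ∀ {M i} N → M ℕ.⊔ N ℕ.≤ i → M ℕ.≤ i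
  ⊔ˡ {M} N = ℕ.≤-trans (ℕ.m≤m⊔n M N)

  ⊔ʳ : ∀ M {N i} → M ℕ.⊔ N ℕ.≤ i → N ℕ.≤ i
  ⊔ʳ M {N} = ℕ.≤-trans (ℕ.m≤n⊔m M N)

  pointwise : ∀ {x y} → (∀ i → seq x i ≡ seq y i) → x ≈ᴿ y
  pointwise eq = mk≈ᴿ λ ε 0<ε → 0 , λ i _ → self-diff ε 0<ε (eq i)

fromℚ : ℚ → ℝ
fromℚ q = mkℝ (λ _ → q) λ ε 0<ε → 0 , λ _ _ _ _ → self-diff {q} ε 0<ε refl

private
  abstract
    +-isCauchy : ∀ x y → IsCauchy (λ i → seq x i + seq y i)
    +-isCauchy x y ε 0<ε =
      let (M , x-close) = isCauchy x (ε * ½) (half-pos 0<ε)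
          (N , y-close) = isCauchy y (ε * ½) (half-pos 0<ε)
      in M ℕ.⊔ N , λ i j ≤i ≤j →
           +-halves (+-diff (seq x i) (seq y i) (seq x j) (seq y j))
             (x-close i j (⊔ˡ N ≤i) (⊔ˡ N ≤j)) (y-close i j (⊔ʳ M ≤i) (⊔ʳ M ≤j))

    neg-isCauchy : ∀ x → IsCauchy (λ i → - seq x i)
    neg-isCauchy x ε 0<ε = let (N , close) = isCauchy x ε 0<ε in N , λ i j ≤i ≤j →
      subst (_< ε) (sym (neg-diff (seq x i) (seq x j))) (close i j ≤i ≤j)

    *-isCauchy : ∀ x y → IsCauchy (λ i → seq x i * seq y i)
    *-isCauchy x y ε 0<ε =
      let (A , 0<A , K , x≤A) = eventuallyBounded x
          (B , 0<B , L , y≤B) = eventuallyBounded y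
          (δ , 0<δ , bound)   = *-tolerance A B 0<A 0<B ε 0<ε
          (M , x-close)       = isCauchy x δ 0<δ
          (N , y-close)       = isCauchy y δ 0<δ
      in (K ℕ.⊔ L) ℕ.⊔ (M ℕ.⊔ N) , λ i j ≤i ≤j →
           bound (x≤A i (⊔ˡ L (⊔ˡ (M ℕ.⊔ N) ≤i))) (y≤B j (⊔ʳ K (⊔ˡ (M ℕ.⊔ N) ≤j)))
             (x-close i j (⊔ˡ N (⊔ʳ (K ℕ.⊔ L) ≤i)) (⊔ˡ N (⊔ʳ (K ℕ.⊔ L) ≤j)))
             (y-close i j (⊔ʳ M (⊔ʳ (K ℕ.⊔ L) ≤i)) (⊔ʳ M (⊔ʳ (K ℕ.⊔ L) ≤j)))

infixl 6 _+ᴿ_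
infixl 7 _*ᴿ_
infix  8 -ᴿ_

_+ᴿ_ : ℝ → ℝ → ℝ
x +ᴿ y = mkℝ (λ i → seq x i + seq y i) (+-isCauchy x y)

-ᴿ_ : ℝ → ℝ
-ᴿ x = mkℝ (λ i → - seq x i) (neg-isCauchy x)

_*ᴿ_ : ℝ → ℝ → ℝ
x *ᴿ y = mkℝ (λ i → seq x i * seq y i) (*-isCauchy x y)

private
  abstract
    ≈ᴿ-refl : ∀ {x} → x ≈ᴿ x
    ≈ᴿ-refl = pointwise λ _ → refl

    ≈ᴿ-sym : ∀ {x y} → x ≈ᴿ y → y ≈ᴿ x
    ≈ᴿ-sym {x} {y} x≈y = mk≈ᴿ λ ε 0<ε → let (N , close) = difference→0 x≈y ε 0<ε in
      N , λ i ≤i → subst (_< ε) (swap-diff (seq x i) (seq y i)) (close i ≤i)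

    ≈ᴿ-trans : ∀ {x y z} → x ≈ᴿ y → y ≈ᴿ z → x ≈ᴿ z
    ≈ᴿ-trans {x} {y} {z} x≈y y≈z = mk≈ᴿ λ ε 0<ε →
      let (M , xy-close) = difference→0 x≈y (ε * ½) (half-pos 0<ε)
          (N , yz-close) = difference→0 y≈z (ε * ½) (half-pos 0<ε)
      in M ℕ.⊔ N , λ i ≤i → +-halves
           (solve 3 (λ p q r → p :- r := (p :- q) :+ (q :- r)) refl (seq x i) (seq y i) (seq z i))
           (xy-close i (⊔ˡ N ≤i)) (yz-close i (⊔ʳ M ≤i))

    +ᴿ-cong : ∀ {x y u v} → x ≈ᴿ y → u ≈ᴿ v → x +ᴿ u ≈ᴿ y +ᴿ v
    +ᴿ-cong {x} {y} {u} {v} x≈y u≈v = mk≈ᴿ λ ε 0<ε →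
      let (M , xy-close) = difference→0 x≈y (ε * ½) (half-pos 0<ε)
          (N , uv-close) = difference→0 u≈v (ε * ½) (half-pos 0<ε)
      in M ℕ.⊔ N , λ i ≤i → +-halves
           (+-diff (seq x i) (seq u i) (seq y i) (seq v i))
           (xy-close i (⊔ˡ N ≤i)) (uv-close i (⊔ʳ M ≤i))

    -ᴿ-cong : ∀ {x y} → x ≈ᴿ y → -ᴿ x ≈ᴿ -ᴿ y
    -ᴿ-cong {x} {y} x≈y = mk≈ᴿ λ ε 0<ε → let (N , close) = difference→0 x≈y ε 0<ε in
      N , λ i ≤i → subst (_< ε) (sym (neg-diff (seq x i) (seq y i))) (close i ≤i)

    *ᴿ-cong : ∀ {x y u v} → x ≈ᴿ y → u ≈ᴿ v → x *ᴿ u ≈ᴿ y *ᴿ v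
    *ᴿ-cong {x} {y} {u} {v} x≈y u≈v = mk≈ᴿ λ ε 0<ε →
      let (A , 0<A , K , x≤A) = eventuallyBounded x
          (B , 0<B , L , v≤B) = eventuallyBounded v
          (δ , 0<δ , bound)   = *-tolerance A B 0<A 0<B ε 0<ε
          (M , xy-close)      = difference→0 x≈y δ 0<δ
          (N , uv-close)      = difference→0 u≈v δ 0<δ
      in (K ℕ.⊔ L) ℕ.⊔ (M ℕ.⊔ N) , λ i ≤i →
           bound (x≤A i (⊔ˡ L (⊔ˡ (M ℕ.⊔ N) ≤i))) (v≤B i (⊔ʳ K (⊔ˡ (M ℕ.⊔ N) ≤i)))
             (xy-close i (⊔ˡ N (⊔ʳ (K ℕ.⊔ L) ≤i))) (uv-close i (⊔ʳ M (⊔ʳ (K ℕ.⊔ L) ≤i)))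

ℝ-commutativeRing : CommutativeRing 0ℓ 0ℓ
ℝ-commutativeRing = record
  { Carrier = ℝ
  ; _≈_     = _≈ᴿ_
  ; _+_     = _+ᴿ_
  ; _*_     = _*ᴿ_
  ; -_      = -ᴿ_
  ; 0#      = fromℚ 0ℚ
  ; 1#      = fromℚ 1ℚ
  ; isCommutativeRing = record
    { isRing = record
      { +-isAbelianGroup = record
        { isGroup = record
          { isMonoid = record
            { isSemigroup = record
              { isMagma = record
                { isEquivalence = record { refl = ≈ᴿ-refl ; sym = ≈ᴿ-sym ; trans = ≈ᴿ-trans }
                ; ∙-cong        = +ᴿ-cong
                }
              ; assoc = λ x y z → pointwise λ i → ℚ.+-assoc (seq x i) (seq y i) (seq z i)
              }
            ; identity = (λ x → pointwise λ i → ℚ.+-identityˡ (seq x i))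
                       , (λ x → pointwise λ i → ℚ.+-identityʳ (seq x i))
            }
          ; inverse = (λ x → pointwise λ i → ℚ.+-inverseˡ (seq x i))
                    , (λ x → pointwise λ i → ℚ.+-inverseʳ (seq x i))
          ; ⁻¹-cong = -ᴿ-cong
          }
        ; comm = λ x y → pointwise λ i → ℚ.+-comm (seq x i) (seq y i)
        }
      ; *-cong     = *ᴿ-cong
      ; *-assoc    = λ x y z → pointwise λ i → ℚ.*-assoc (seq x i) (seq y i) (seq z i)
      ; *-identity = (λ x → pointwise λ i → ℚ.*-identityˡ (seq x i))
                   , (λ x → pointwise λ i → ℚ.*-identityʳ (seq x i))
      ; distrib    = (λ x y z → pointwise λ i → ℚ.*-distribˡ-+ (seq x i) (seq y i) (seq z i))
                   , (λ x y z → pointwise λ i → ℚ.*-distribʳ-+ (seq x i) (seq y i) (seq z i))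
      }
    ; *-comm = λ x y → pointwise λ i → ℚ.*-comm (seq x i) (seq y i)
    }
  }

record ℂ : Set where
  constructor _+i_
  field
    re im : ℝ

open ℂ public

infix 4 _≈ᶜ_

record _≈ᶜ_ (z w : ℂ) : Set where
  constructor _,_
  field
    re≈ : re z ≈ᴿ re w
    im≈ : im z ≈ᴿ im w

open _≈ᶜ_ public

infixl 6 _+ᶜ_
infixl 7 _*ᶜ_
infix  8 -ᶜ_

_+ᶜ_ : ℂ → ℂ → ℂ
z +ᶜ w = (re z +ᴿ re w) +i (im z +ᴿ im w)

-ᶜ_ : ℂ → ℂ
-ᶜ z = (-ᴿ re z) +i (-ᴿ im z)

_*ᶜ_ : ℂ → ℂ → ℂ
z *ᶜ w = (re z *ᴿ re w +ᴿ -ᴿ (im z *ᴿ im w)) +i (re z *ᴿ im w +ᴿ im z *ᴿ re w)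

0ᶜ : ℂ
0ᶜ = fromℚ 0ℚ +i fromℚ 0ℚ

1ᶜ : ℂ
1ᶜ = fromℚ 1ℚ +i fromℚ 0ℚ

private
  module R = CommutativeRing ℝ-commutativeRing

  -- The solver works over semirings, so - x is expanded as (- 1#) * x.
  module Expand′ (K : CommutativeRing c ℓ) where
    open CommutativeRing K renaming (_+_ to _⊕_; _*_ to _⊗_; -_ to ⊖_; trans to ≈-trans; sym to ≈-sym; refl to ≈-refl)
    open RingProperties ring using (-1*x≈-x)
    module S = SemiringSolver commutativeSemiring

    infixl 6 _⊝_
    _⊝_ : Carrier → Carrier → Carrier
    x ⊝ y = x ⊕ ⊖ y

    ⊝-expand : ∀ {x y} → x ⊝ y ≈ x ⊕ ⊖ 1# ⊗ y
    ⊝-expand {x} {y} = +-congˡ (≈-sym (-1*x≈-x y))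

    re-assoc : ∀ a b c d e f → (a ⊗ c ⊝ b ⊗ d) ⊗ e ⊝ (a ⊗ d ⊕ b ⊗ c) ⊗ f ≈ a ⊗ (c ⊗ e ⊝ d ⊗ f) ⊝ b ⊗ (c ⊗ f ⊕ d ⊗ e)
    re-assoc a b c d e f = ≈-trans (≈-trans (+-congʳ (*-congʳ ⊝-expand)) ⊝-expand) (≈-trans
      (S.solve 7 (λ a b c d e f n →
        (a S.:* c S.:+ n S.:* (b S.:* d)) S.:* e S.:+ n S.:* ((a S.:* d S.:+ b S.:* c) S.:* f) S.:=
        a S.:* (c S.:* e S.:+ n S.:* (d S.:* f)) S.:+ n S.:* (b S.:* (c S.:* f S.:+ d S.:* e)))
        ≈-refl a b c d e f (⊖ 1#))
      (≈-sym (≈-trans (+-congʳ (*-congˡ ⊝-expand)) ⊝-expand)))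

    im-assoc : ∀ a b c d e f → (a ⊗ c ⊝ b ⊗ d) ⊗ f ⊕ (a ⊗ d ⊕ b ⊗ c) ⊗ e ≈ a ⊗ (c ⊗ f ⊕ d ⊗ e) ⊕ b ⊗ (c ⊗ e ⊝ d ⊗ f)
    im-assoc a b c d e f = ≈-trans (+-congʳ (*-congʳ ⊝-expand)) (≈-trans
      (S.solve 7 (λ a b c d e f n →
        (a S.:* c S.:+ n S.:* (b S.:* d)) S.:* f S.:+ (a S.:* d S.:+ b S.:* c) S.:* e S.:=
        a S.:* (c S.:* f S.:+ d S.:* e) S.:+ b S.:* (c S.:* e S.:+ n S.:* (d S.:* f)))
        ≈-refl a b c d e f (⊖ 1#))
      (≈-sym (+-congˡ (*-congˡ ⊝-expand))))

    re-distribʳ : ∀ a b c d e f → (c ⊕ e) ⊗ a ⊝ (d ⊕ f) ⊗ b ≈ (c ⊗ a ⊝ d ⊗ b) ⊕ (e ⊗ a ⊝ f ⊗ b)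
    re-distribʳ a b c d e f = ≈-trans ⊝-expand (≈-trans
      (S.solve 7 (λ a b c d e f n →
        (c S.:+ e) S.:* a S.:+ n S.:* ((d S.:+ f) S.:* b) S.:=
        (c S.:* a S.:+ n S.:* (d S.:* b)) S.:+ (e S.:* a S.:+ n S.:* (f S.:* b)))
        ≈-refl a b c d e f (⊖ 1#))
      (≈-sym (+-cong ⊝-expand ⊝-expand)))

    im-distribʳ : ∀ a b c d e f → (c ⊕ e) ⊗ b ⊕ (d ⊕ f) ⊗ a ≈ (c ⊗ b ⊕ d ⊗ a) ⊕ (e ⊗ b ⊕ f ⊗ a)
    im-distribʳ = S.solve 6 (λ a b c d e f →
        (c S.:+ e) S.:* b S.:+ (d S.:+ f) S.:* a S.:=
        (c S.:* b S.:+ d S.:* a) S.:+ (e S.:* b S.:+ f S.:* a))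
        ≈-refl

  module Expand = Expand′ ℝ-commutativeRing

  *ᶜ-assoc : ∀ x y z → (x *ᶜ y) *ᶜ z ≈ᶜ x *ᶜ (y *ᶜ z)
  *ᶜ-assoc (a +i b) (c +i d) (e +i f) = Expand.re-assoc a b c d e f , Expand.im-assoc a b c d e f

  *ᶜ-comm : ∀ z w → z *ᶜ w ≈ᶜ w *ᶜ z
  *ᶜ-comm (a +i b) (c +i d) =
      R.+-cong (R.*-comm a c) (R.-‿cong (R.*-comm b d))
    , R.trans (R.+-comm _ _) (R.+-cong (R.*-comm b c) (R.*-comm a d))

  *ᶜ-distribʳ : ∀ x y z → (y +ᶜ z) *ᶜ x ≈ᶜ y *ᶜ x +ᶜ z *ᶜ x
  *ᶜ-distribʳ (a +i b) (c +i d) (e +i f) = Expand.re-distribʳ a b c d e f , Expand.im-distribʳ a b c d e f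

  *ᶜ-identityˡ : ∀ z → 1ᶜ *ᶜ z ≈ᶜ z
  *ᶜ-identityˡ (a +i b) =
      pointwise (λ i → trans
        (cong₂ _+_ (ℚ.*-identityˡ (seq a i)) (cong -_ (ℚ.*-zeroˡ (seq b i))))
        (ℚ.+-identityʳ (seq a i)))
    , pointwise (λ i → trans
        (cong₂ _+_ (ℚ.*-identityˡ (seq b i)) (ℚ.*-zeroˡ (seq a i)))
        (ℚ.+-identityʳ (seq b i)))

  ≈ᶜ-trans : ∀ {x y z} → x ≈ᶜ y → y ≈ᶜ z → x ≈ᶜ z
  ≈ᶜ-trans (p , q) (r , s) = R.trans p r , R.trans q s

  +ᶜ-cong : ∀ {x y u v} → x ≈ᶜ y → u ≈ᶜ v → x +ᶜ u ≈ᶜ y +ᶜ v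
  +ᶜ-cong (p , q) (r , s) = R.+-cong p r , R.+-cong q s

ℂ-commutativeRing : CommutativeRing 0ℓ 0ℓ
ℂ-commutativeRing = record
  { Carrier = ℂ
  ; _≈_     = _≈ᶜ_
  ; _+_     = _+ᶜ_
  ; _*_     = _*ᶜ_
  ; -_      = -ᶜ_
  ; 0#      = 0ᶜ
  ; 1#      = 1ᶜ
  ; isCommutativeRing = record
    { isRing = record
      { +-isAbelianGroup = record
        { isGroup = record
          { isMonoid = record
            { isSemigroup = record
              { isMagma = record
                { isEquivalence = record
                  { refl  = R.refl , R.refl
                  ; sym   = λ (p , q) → R.sym p , R.sym q
                  ; trans = ≈ᶜ-trans
                  }
                ; ∙-cong = +ᶜ-cong
                }
              ; assoc = λ x y z → R.+-assoc (re x) (re y) (re z) , R.+-assoc (im x) (im y) (im z)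
              }
            ; identity = (λ x → R.+-identityˡ (re x) , R.+-identityˡ (im x))
                       , (λ x → R.+-identityʳ (re x) , R.+-identityʳ (im x))
            }
          ; inverse = (λ x → R.-‿inverseˡ (re x) , R.-‿inverseˡ (im x))
                    , (λ x → R.-‿inverseʳ (re x) , R.-‿inverseʳ (im x))
          ; ⁻¹-cong = λ (p , q) → R.-‿cong p , R.-‿cong q
          }
        ; comm = λ x y → R.+-comm (re x) (re y) , R.+-comm (im x) (im y)
        }
      ; *-cong     = λ (p , q) (r , s) →
          R.+-cong (R.*-cong p r) (R.-‿cong (R.*-cong q s)) , R.+-cong (R.*-cong p s) (R.*-cong q r)
      ; *-assoc    = *ᶜ-assoc
      ; *-identity = *ᶜ-identityˡ , λ z → ≈ᶜ-trans (*ᶜ-comm z 1ᶜ) (*ᶜ-identityˡ z)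
      ; distrib    = (λ x y z → ≈ᶜ-trans (*ᶜ-comm x (y +ᶜ z))
                        (≈ᶜ-trans (*ᶜ-distribʳ x y z) (+ᶜ-cong (*ᶜ-comm y x) (*ᶜ-comm z x))))
                   , *ᶜ-distribʳ
      }
    ; *-comm = *ᶜ-comm
    }
  }

-- K is a commutative ring here only because inverses play no part in the
-- definitions; it is instantiated with ℂ below.

module Bilinear (K : CommutativeRing c ℓ) where

  private
    module K = CommutativeRing K
    module ∑ = SemiringSum K.semiring

  VectorSpace : (m ℓm : Level) → Set _
  VectorSpace = LeftModule K.ring

  IsLinear : (U : VectorSpace m₁ ℓ₁) (V : VectorSpace m₂ ℓ₂) →
             (LeftModule.Carrierᴹ U → LeftModule.Carrierᴹ V) → Set _
  IsLinear U V = LeftModuleMorphisms.IsLeftModuleHomomorphism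
    (LeftModule.rawLeftModule U) (LeftModule.rawLeftModule V)

  scalars : VectorSpace c ℓ
  scalars = TensorUnit.leftModule

  record LinearForm (U : VectorSpace m₁ ℓ₁) : Set (c ⊔ ℓ ⊔ m₁ ⊔ ℓ₁) where
    field
      ⟦_⟧      : LeftModule.Carrierᴹ U → K.Carrier
      isLinear : IsLinear U scalars ⟦_⟧

  record BilinearMap (U : VectorSpace m₁ ℓ₁) (V : VectorSpace m₂ ℓ₂) (W : VectorSpace m₃ ℓ₃)
         : Set (c ⊔ m₁ ⊔ ℓ₁ ⊔ m₂ ⊔ ℓ₂ ⊔ m₃ ⊔ ℓ₃) where
    private
      module U = LeftModule U
      module V = LeftModule V
      module W = LeftModule W
    field
      ⟦_,_⟧   : U.Carrierᴹ → V.Carrierᴹ → W.Carrierᴹ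
      linearˡ : ∀ y → IsLinear U W (λ x → ⟦ x , y ⟧)
      linearʳ : ∀ x → IsLinear V W (λ y → ⟦ x , y ⟧)

  module _ {U : VectorSpace m₁ ℓ₁} {V : VectorSpace m₂ ℓ₂} {W : VectorSpace m₃ ℓ₃} where

    private
      module U = LeftModule U
      module V = LeftModule V
      module W = LeftModule W

    record Decomposition (T : BilinearMap U V W) (r : ℕ)
           : Set (c ⊔ ℓ ⊔ m₁ ⊔ ℓ₁ ⊔ m₂ ⊔ ℓ₂ ⊔ m₃ ⊔ ℓ₃) where
      open BilinearMap T
      open LinearForm renaming (⟦_⟧ to _⟨_⟩)
      open RawMonoidDefinitions W.+ᴹ-rawMonoid using (sum)
      field
        u          : Fin r → LinearForm U
        v          : Fin r → LinearForm V
        w          : Fin r → W.Carrierᴹ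
        decomposes : ∀ x y →
          ⟦ x , y ⟧ W.≈ᴹ sum (λ i → (u i ⟨ x ⟩ K.* v i ⟨ y ⟩) W.*ₗ w i)

    -- R(T) = r: a relation, because the least length of a decomposition is
    -- not computable from T.
    HasRank : BilinearMap U V W → ℕ → Set _
    HasRank T r = Decomposition T r × (∀ s → Decomposition T s → r ℕ.≤ s)

  infix 8 _^ᴹ_

  _^ᴹ_ : VectorSpace m₁ ℓ₁ → ℕ → VectorSpace m₁ ℓ₁
  V ^ᴹ n = record
    { Carrierᴹ = Fin n → V.Carrierᴹ
    ; _≈ᴹ_ = λ x y → ∀ i → x i V.≈ᴹ y i
    ; _+ᴹ_ = λ x y i → x i V.+ᴹ y i
    ; _*ₗ_ = λ a x i → a V.*ₗ x i
    ; 0ᴹ   = λ _ → V.0ᴹ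
    ; -ᴹ_  = λ x i → V.-ᴹ x i
    ; isLeftModule = record
      { isLeftSemimodule = record
        { +ᴹ-isCommutativeMonoid = Pointwise.isCommutativeMonoid (Fin n) V.+ᴹ-isCommutativeMonoid
        ; isPreleftSemimodule = record
          { *ₗ-cong      = λ a≈b x≈y i → V.*ₗ-cong a≈b (x≈y i)
          ; *ₗ-zeroˡ     = λ x i → V.*ₗ-zeroˡ (x i)
          ; *ₗ-distribʳ  = λ x a b i → V.*ₗ-distribʳ (x i) a b
          ; *ₗ-identityˡ = λ x i → V.*ₗ-identityˡ (x i)
          ; *ₗ-assoc     = λ a b x i → V.*ₗ-assoc a b (x i)
          ; *ₗ-zeroʳ     = λ a i → V.*ₗ-zeroʳ a
          ; *ₗ-distribˡ  = λ a x y i → V.*ₗ-distribˡ a (x i) (y i)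
          }
        }
      ; -ᴹ‿cong    = λ x≈y i → V.-ᴹ‿cong (x≈y i)
      ; -ᴹ‿inverse = (λ x i → V.-ᴹ‿inverseˡ (x i)) , (λ x i → V.-ᴹ‿inverseʳ (x i))
      }
    }
    where module V = LeftModule V

  Mat : ℕ → ℕ → VectorSpace c ℓ
  Mat n m = (scalars ^ᴹ m) ^ᴹ n

  private
    module _ (U : VectorSpace m₁ ℓ₁) (V : VectorSpace m₂ ℓ₂) where
      module U = LeftModule U
      module V = LeftModule V
      open AbelianGroupProperties V.+ᴹ-abelianGroup using (inverseˡ-unique)

      mkLinear : (f : U.Carrierᴹ → V.Carrierᴹ) →
                 (∀ {x y} → x U.≈ᴹ y → f x V.≈ᴹ f y) →
                 (∀ x y → f (x U.+ᴹ y) V.≈ᴹ f x V.+ᴹ f y) →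
                 (∀ a x → f (a U.*ₗ x) V.≈ᴹ a V.*ₗ f x) →
                 IsLinear U V f
      mkLinear f f-cong f-+ f-* = record
        { +ᴹ-isGroupHomomorphism = record
          { isMonoidHomomorphism = record
            { isMagmaHomomorphism = record
              { isRelHomomorphism = record { cong = f-cong }
              ; homo              = f-+
              }
            ; ε-homo = f-0
            }
          ; ⁻¹-homo = f-neg
          }
        ; *ₗ-homo = f-*
        }
        where
        f-0 : f U.0ᴹ V.≈ᴹ V.0ᴹ
        f-0 = V.≈ᴹ-trans (f-cong (U.≈ᴹ-sym (U.*ₗ-zeroˡ U.0ᴹ)))
                (V.≈ᴹ-trans (f-* K.0# U.0ᴹ) (V.*ₗ-zeroˡ (f U.0ᴹ)))

        f-neg : ∀ x → f (U.-ᴹ x) V.≈ᴹ V.-ᴹ f x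
        f-neg x = inverseˡ-unique (f (U.-ᴹ x)) (f x)
          (V.≈ᴹ-trans (V.≈ᴹ-sym (f-+ (U.-ᴹ x) x)) (V.≈ᴹ-trans (f-cong (U.-ᴹ‿inverseˡ x)) f-0))

  M⟨_,_,_⟩ : (n m l : ℕ) → BilinearMap (Mat n m) (Mat m l) (Mat n l)
  M⟨ n , m , l ⟩ = record
    { ⟦_,_⟧   = _·_
    ; linearˡ = λ Y → mkLinear (Mat n m) (Mat n l) (_· Y)
        (λ X≈X′ i k → ∑.sum-cong-≋ (λ j → K.*-congʳ (X≈X′ i j)))
        (λ X X′ i k → K.trans
          (∑.sum-cong-≋ (λ j → K.distribʳ (Y j k) (X i j) (X′ i j)))
          (∑.∑-distrib-+ (λ j → X i j K.* Y j k) (λ j → X′ i j K.* Y j k)))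
        (λ a X i k → K.trans
          (∑.sum-cong-≋ (λ j → K.*-assoc a (X i j) (Y j k)))
          (K.sym (∑.*-distribˡ-sum a (λ j → X i j K.* Y j k))))
    ; linearʳ = λ X → mkLinear (Mat m l) (Mat n l) (X ·_)
        (λ Y≈Y′ i k → ∑.sum-cong-≋ (λ j → K.*-congˡ (Y≈Y′ j k)))
        (λ Y Y′ i k → K.trans
          (∑.sum-cong-≋ (λ j → K.distribˡ (X i j) (Y j k) (Y′ j k)))
          (∑.∑-distrib-+ (λ j → X i j K.* Y j k) (λ j → X i j K.* Y′ j k)))
        (λ a Y i k → K.trans
          (∑.sum-cong-≋ (λ j → x∙yz≈y∙xz (X i j) a (Y j k)))
          (K.sym (∑.*-distribˡ-sum a (λ j → X i j K.* Y j k))))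
    }
    where
    open CommutativeSemigroupProperties K.*-commutativeSemigroup using (x∙yz≈y∙xz)
    _·_ : LeftModule.Carrierᴹ (Mat n m) → LeftModule.Carrierᴹ (Mat m l) → LeftModule.Carrierᴹ (Mat n l)
    (X · Y) i k = ∑.sum (λ j → X i j K.* Y j k)

open Bilinear ℂ-commutativeRing public

binomial : ℕ → ℤ → ℕ
binomial a (+ b)      = a C b
binomial a (-[1+ _ ]) = 0

{-# OPTIONS --safe #-}
module Submission where

-- The factor (2p+1)/(p+1) is C(2p+1, p) / C(2p, p): the flattening starts from the p-subsets of
-- 2p+1 indices, and wedging with one fixed vector has rank at most C(2p, p) there. An n × n matrix
-- acts on the m columns of its right factor separately, so the flattening is m copies of one square
-- map on C(2p+1, p) n coordinates. The determinant is that of a single copy; hence its degree, and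
-- the number of forms on X that must be kept, does not grow with m, and the loss is only linear in
-- n. A form of the basis whose dual vector is dropped vanishes on all 2p+1 matrices at once, so its
-- term disappears from every component of the flattening.

-- The Koszul flattening of matrix multiplication, restricted to a space of
-- 2p+1 matrices X₀, …, X₂ₚ, has rank at most C(2p, p) on a rank one tensor, so if
-- it is injective for these matrices then every decomposition has at least
-- (2p+1)/(p+1) nm terms not vanishing on all the Xₖ.  Starting from one
-- injective choice, expand the Xₖ in the basis dual to n² of the linear forms
-- on X.  The determinant of the flattening is a polynomial of degree
-- C(2p+1, p) n, so it stays nonzero after all but that many basis elements
-- are dropped; this kills n² - C(2p+1, p) n terms of the decomposition.
--
-- An injective choice exists when p+1 divides n: in each diagonal block of
-- size p+1 let Xₖ = v vᵀ with v the moment vector of the point k.  Otherwise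
-- t = n mod (p+1) rows and columns are first removed by substitution, each
-- of the two steps eliminating tm terms.  What is lost is at most 2tn, and for
-- p ≥ 2 this fits in the difference between C(2p+1, p) and
-- 1 + 2p C(2p, p-1).  For p = 1 there is no such slack, and 1, X₁, X₂ with an
-- invertible commutator are used for every n ≥ 2.
--
-- Equality of complex numbers is replaced by its double negation.  The
-- conclusion is decidable, so classical reasoning is available throughout.

open import Defs
open import Algebra.Bundles using (CommutativeRing; RawRing)
open import Algebra.Module.Bundles using (LeftModule)
open import Algebra.Module.Morphism.Structures using (module LeftModuleMorphisms)
open import Algebra.Solver.Ring.AlmostCommutativeRing using (fromCommutativeRing; _-Raw-AlmostCommutative⟶_)
import Algebra.Definitions.RawMonoid as RawMonoidDefinitions
import Algebra.Properties.AbelianGroup as AbelianGroupProperties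
import Algebra.Properties.Ring as RingProperties
import Algebra.Properties.Semiring.Exp as Exp
import Algebra.Properties.Semiring.Mult as Mult
import Algebra.Properties.Semiring.Sum as Sum
import Algebra.Solver.CommutativeMonoid as CommutativeMonoidSolver
import Algebra.Solver.Ring as RingSolver
open import Data.Bool.Base using (Bool; true; false; _∧_; not; if_then_else_)
open import Data.Fin.Base using (Fin; zero; suc; toℕ; fromℕ; fromℕ<; inject₁; combine; remQuot)
import Data.Fin.Properties as Fin
open import Data.Fin.Relation.Unary.Top using (view; ‵fromℕ; ‵inject₁)
open import Data.Integer.Base as ℤ using (ℤ; +_; -[1+_]; _⊖_; _◃_)
import Data.Integer.Properties as ℤ
import Data.Maybe.Base as Maybe
open import Data.Nat.Base as ℕ using (ℕ; zero; suc; _∸_)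
import Data.Nat.DivMod as ℕ
open import Data.Nat.Combinatorics using (_C_; nCk+nC[k+1]≡[n+1]C[k+1]; nCk≡nC[n∸k]; nC1≡n)
import Data.Nat.Properties as ℕ
open import Data.Nat.Tactic.RingSolver using (solve-∀)
open import Data.Product.Base using (_×_; _,_; ∃; proj₁; proj₂; swap; curry)
open import Data.Product.Function.NonDependent.Propositional using (_×-↔_)
open import Data.Rational.Base using (ℚ; 0ℚ; 1ℚ; ½; 1/_; ∣_∣)
import Data.Rational.Base as ℚ
import Data.Rational.Properties as ℚ
open import Data.Rational.Solver using (module +-*-Solver)
import Data.Rational.Unnormalised.Base as ℚᵘ
import Data.Rational.Unnormalised.Properties as ℚᵘ
import Data.Sign.Base as Sign
open import Data.Sum.Base using (_⊎_; inj₁; inj₂)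
open import Data.Sum.Function.Propositional using (_⊎-↔_)
open import Function.Base using (_∘_; id)
open import Function.Bundles using (_↔_; Inverse; mk↔ₛ′)
open import Function.Construct.Composition using (_↔-∘_)
open import Function.Construct.Identity using (↔-id)
open import Function.Construct.Symmetry using (↔-sym)
open import Level using (0ℓ; _⊔_) renaming (suc to lsuc)
open import Relation.Binary.PropositionalEquality as ≡ using (_≡_)
open import Relation.Nullary using (¬_; yes; no; contradiction)
open import Relation.Nullary.Decidable using (dec⇒maybe; decidable-stable; ¬¬-excluded-middle)
open import Relation.Nullary.Negation using (negated-stable)

-- Ring solver with integer coefficients.

-- The solver cancels terms only if equality of coefficients is decidable,
-- hence the coefficients in ℤ.
module IntegerCoefficients {c ℓ} (K : CommutativeRing c ℓ) where

  open CommutativeRing K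
  open Mult semiring using (×-homo-+; ×1-homo-*) renaming (_×_ to _·_)
  open RingProperties ring using (-‿distribˡ-*; -‿distribʳ-*; -0#≈0#; -‿involutive)
  open AbelianGroupProperties +-abelianGroup using (⁻¹-∙-comm)
  open import Relation.Binary.Reasoning.Setoid setoid

  fromℤ : ℤ → Carrier
  fromℤ (+ n)    = n · 1#
  fromℤ -[1+ n ] = - (suc n · 1#)

  fromℤ-neg : ∀ n → fromℤ (Sign.- ◃ n) ≈ - (n · 1#)
  fromℤ-neg zero    = sym -0#≈0#
  fromℤ-neg (suc n) = refl

  fromℤ-⊖ : ∀ m n → fromℤ (m ⊖ n) ≈ m · 1# - n · 1#
  fromℤ-⊖ zero    zero    = sym (-‿inverseʳ 0#)
  fromℤ-⊖ (suc m) zero    = sym (trans (+-congˡ -0#≈0#) (+-identityʳ _))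
  fromℤ-⊖ zero    (suc n) = sym (+-identityˡ _)
  fromℤ-⊖ (suc m) (suc n) = begin
    fromℤ (suc m ⊖ suc n)                       ≡⟨ ≡.cong fromℤ (ℤ.[1+m]⊖[1+n]≡m⊖n m n) ⟩
    fromℤ (m ⊖ n)                               ≈⟨ fromℤ-⊖ m n ⟩
    m · 1# - n · 1#                             ≈⟨ +-identityˡ _ ⟨
    0# + (m · 1# - n · 1#)                      ≈⟨ +-congʳ (-‿inverseʳ 1#) ⟨
    (1# - 1#) + (m · 1# - n · 1#)               ≈⟨ S.solve 4 (λ a b c d → ((a S.⊕ b) S.⊕ (c S.⊕ d)) S.⊜ ((a S.⊕ c) S.⊕ (b S.⊕ d))) refl 1# (- 1#) (m · 1#) (- (n · 1#)) ⟩
    (1# + m · 1#) + (- 1# - n · 1#)             ≈⟨ +-congˡ (⁻¹-∙-comm 1# (n · 1#)) ⟩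
    (1# + m · 1#) - (1# + n · 1#)               ∎
    where module S = CommutativeMonoidSolver +-commutativeMonoid

  fromℤ-+ : ∀ i j → fromℤ (i ℤ.+ j) ≈ fromℤ i + fromℤ j
  fromℤ-+ (+ m)    (+ n)    = ×-homo-+ 1# m n
  fromℤ-+ (+ m)    -[1+ n ] = fromℤ-⊖ m (suc n)
  fromℤ-+ -[1+ m ] (+ n)    = trans (fromℤ-⊖ n (suc m)) (+-comm _ _)
  fromℤ-+ -[1+ m ] -[1+ n ] = begin
    - (suc (suc (m ℕ.+ n)) · 1#)        ≡⟨ ≡.cong (λ k → - (suc k · 1#)) (ℕ.+-suc m n) ⟨
    - ((suc m ℕ.+ suc n) · 1#)          ≈⟨ -‿cong (×-homo-+ 1# (suc m) (suc n)) ⟩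
    - (suc m · 1# + suc n · 1#)         ≈⟨ ⁻¹-∙-comm _ _ ⟨
    - (suc m · 1#) - (suc n · 1#)       ∎

  fromℤ-* : ∀ i j → fromℤ (i ℤ.* j) ≈ fromℤ i * fromℤ j
  fromℤ-* (+ m)    (+ n)    = trans (reflexive (≡.cong fromℤ (ℤ.+◃n≡+n (m ℕ.* n)))) (×1-homo-* m n)
  fromℤ-* (+ m)    -[1+ n ] = trans (fromℤ-neg (m ℕ.* suc n)) (trans (-‿cong (×1-homo-* m (suc n))) (-‿distribʳ-* _ _))
  fromℤ-* -[1+ m ] (+ n)    = trans (fromℤ-neg (suc m ℕ.* n)) (trans (-‿cong (×1-homo-* (suc m) n)) (-‿distribˡ-* _ _))
  fromℤ-* -[1+ m ] -[1+ n ] = begin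
    (suc m ℕ.* suc n) · 1#                ≈⟨ ×1-homo-* (suc m) (suc n) ⟩
    (suc m · 1#) * (suc n · 1#)           ≈⟨ -‿involutive _ ⟨
    - - ((suc m · 1#) * (suc n · 1#))     ≈⟨ -‿cong (-‿distribʳ-* _ _) ⟩
    - ((suc m · 1#) * - (suc n · 1#))     ≈⟨ -‿distribˡ-* _ _ ⟩
    - (suc m · 1#) * - (suc n · 1#)       ∎

  fromℤ-‿- : ∀ i → fromℤ (ℤ.- i) ≈ - fromℤ i
  fromℤ-‿- (+ zero)  = sym -0#≈0#
  fromℤ-‿- (+ suc n) = refl
  fromℤ-‿- -[1+ n ]  = sym (-‿involutive _)

  ℤ-rawRing : RawRing _ _
  ℤ-rawRing = record { _≈_ = _≡_ ; _+_ = ℤ._+_ ; _*_ = ℤ._*_ ; -_ = ℤ.-_ ; 0# = + 0 ; 1# = + 1 }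

  morphism : ℤ-rawRing -Raw-AlmostCommutative⟶ fromCommutativeRing K
  morphism = record
    { ⟦_⟧    = fromℤ
    ; +-homo = fromℤ-+
    ; *-homo = fromℤ-*
    ; -‿homo = fromℤ-‿-
    ; 0-homo = refl
    ; 1-homo = +-identityʳ 1#
    }

  open RingSolver ℤ-rawRing (fromCommutativeRing K) morphism
    (λ i j → Maybe.map (reflexive ∘ ≡.cong fromℤ) (dec⇒maybe (i ℤ.≟ j))) public

-- The double negation monad and fields for classical reasoning.

return : ∀ {a} {A : Set a} → A → ¬ ¬ A
return x k = k x

_>>=_ : ∀ {a b} {A : Set a} {B : Set b} → ¬ ¬ A → (A → ¬ ¬ B) → ¬ ¬ B
(m >>= f) k = m λ x → f x k

¬¬-finite : ∀ {a n} {P : Fin n → Set a} → (∀ i → ¬ ¬ P i) → ¬ ¬ (∀ i → P i)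
¬¬-finite {n = zero}  h = return λ ()
¬¬-finite {n = suc n} h = do
  p₀ ← h zero
  ps ← ¬¬-finite (h ∘ suc)
  return λ { zero → p₀ ; (suc i) → ps i }

count : ∀ {n} → (Fin n → Bool) → ℕ
count {zero}  s = 0
count {suc n} s = (if s zero then 1 else 0) ℕ.+ count (s ∘ suc)

-- Inverses exist only under double negation, since a number that is merely not zero yields no
-- computable bound away from zero. `char0` serves twice: traces of identities determine dimensions,
-- and the natural numbers supply distinct nodes.
record ClassicalField c ℓ : Set (lsuc (c ⊔ ℓ)) where
  field
    commutativeRing : CommutativeRing c ℓ
  open CommutativeRing commutativeRing public hiding (zero)
  open Mult semiring public using () renaming (_×_ to infixl 8 _·_)
  field
    stable  : ∀ {x y} → ¬ ¬ (x ≈ y) → x ≈ y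
    inverse : ∀ x → ¬ (x ≈ 0#) → ¬ ¬ ∃ λ y → x * y ≈ 1#
    char0   : ∀ n → ¬ (suc n · 1# ≈ 0#)

-- Linear forms, dual systems and dimension.

module LinearAlgebra {c ℓ} (F : ClassicalField c ℓ) where

  open ClassicalField F public
  open IntegerCoefficients commutativeRing public using (solve; _:+_; _:*_; _:-_; :-_; _:=_)
  open Sum semiring public using (sum; sum-cong-≋; ∑-distrib-+; ∑-comm; *-distribˡ-sum; *-distribʳ-sum; sum-replicate-zero)
  open import Relation.Binary.Reasoning.Setoid setoid public

  by-cases : ∀ {p} (P : Set p) {x y} → (P → x ≈ y) → (¬ P → x ≈ y) → x ≈ y
  by-cases P t f = stable λ k → ¬¬-excluded-middle λ { (yes p) → k (t p) ; (no ¬p) → k (f ¬p) }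

  cancel : ∀ {x y} → ¬ (x ≈ 0#) → x * y ≈ 0# → y ≈ 0#
  cancel {x} {y} x≉0 xy≈0 = stable λ k → inverse x x≉0 λ (z , xz≈1) → k (begin
    y            ≈⟨ *-identityˡ y ⟨
    1# * y       ≈⟨ *-congʳ xz≈1 ⟨
    (x * z) * y  ≈⟨ solve 3 (λ x y z → (x :* z) :* y := z :* (x :* y)) refl x y z ⟩
    z * (x * y)  ≈⟨ *-congˡ xy≈0 ⟩
    z * 0#       ≈⟨ zeroʳ z ⟩
    0#           ∎)

  minus-zero : ∀ {x y} → y ≈ 0# → x - y ≈ x
  minus-zero {x} {y} y≈0 = begin
    x - y        ≈⟨ +-congˡ (-‿cong y≈0) ⟩
    x - 0#       ≈⟨ +-congʳ (+-identityʳ x) ⟨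
    x + 0# - 0#  ≈⟨ solve 2 (λ x z → x :+ z :- z := x) refl x 0# ⟩
    x            ∎

  x-y≈0⇒x≈y : ∀ {x y} → x - y ≈ 0# → x ≈ y
  x-y≈0⇒x≈y {x} {y} h = begin
    x          ≈⟨ solve 2 (λ x y → x := (x :- y) :+ y) refl x y ⟩
    x - y + y  ≈⟨ +-congʳ h ⟩
    0# + y     ≈⟨ +-identityˡ y ⟩
    y          ∎

  ∑-zero : ∀ {n} {f : Fin n → Carrier} → (∀ i → f i ≈ 0#) → sum f ≈ 0#
  ∑-zero {n} f≈0 = trans (sum-cong-≋ f≈0) (sum-replicate-zero n)

  Δ : ∀ {n} → Fin n → Fin n → Carrier
  Δ zero    zero    = 1#
  Δ zero    (suc j) = 0#
  Δ (suc i) zero    = 0#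
  Δ (suc i) (suc j) = Δ i j

  Δ-sym : ∀ {n} (i j : Fin n) → Δ i j ≡ Δ j i
  Δ-sym zero    zero    = ≡.refl
  Δ-sym zero    (suc j) = ≡.refl
  Δ-sym (suc i) zero    = ≡.refl
  Δ-sym (suc i) (suc j) = Δ-sym i j

  Δ-refl : ∀ {n} (i : Fin n) → Δ i i ≡ 1#
  Δ-refl zero    = ≡.refl
  Δ-refl (suc i) = Δ-refl i

  Δ-≢ : ∀ {n} {i j : Fin n} → ¬ (i ≡ j) → Δ i j ≡ 0#
  Δ-≢ {i = zero}  {zero}  i≢j = contradiction ≡.refl i≢j
  Δ-≢ {i = zero}  {suc j} i≢j = ≡.refl
  Δ-≢ {i = suc i} {zero}  i≢j = ≡.refl
  Δ-≢ {i = suc i} {suc j} i≢j = Δ-≢ (i≢j ∘ ≡.cong suc)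

  ∑-Δˡ : ∀ {n} (i : Fin n) (x : Fin n → Carrier) → sum (λ j → Δ i j * x j) ≈ x i
  ∑-Δˡ zero    x = trans (+-cong (*-identityˡ _) (∑-zero λ j → zeroˡ (x (suc j)))) (+-identityʳ _)
  ∑-Δˡ (suc i) x = trans (+-cong (zeroˡ _) (∑-Δˡ i (x ∘ suc))) (+-identityˡ _)

  ∑-Δʳ : ∀ {n} (i : Fin n) (x : Fin n → Carrier) → sum (λ j → x j * Δ j i) ≈ x i
  ∑-Δʳ i x = trans (sum-cong-≋ λ j → trans (*-comm _ _) (*-congʳ (reflexive (Δ-sym j i)))) (∑-Δˡ i x)

  record Form (I : Set) : Set (c ⊔ ℓ) where
    field
      app    : (I → Carrier) → Carrier
      cong   : ∀ {x y} → (∀ i → x i ≈ y i) → app x ≈ app y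
      linear : ∀ x k y → app (λ i → x i + k * y i) ≈ app x + k * app y

    zero-homo : ∀ {x} → (∀ i → x i ≈ 0#) → app x ≈ 0#
    zero-homo {x} x≈0 = begin
      app x                        ≈⟨ cong (λ i → trans (x≈0 i) (sym (trans (+-congʳ (x≈0 i)) (trans (+-identityˡ _) (trans (*-congˡ (x≈0 i)) (zeroʳ _)))))) ⟩
      app (λ i → x i + - 1# * x i) ≈⟨ linear x (- 1#) x ⟩
      app x + - 1# * app x         ≈⟨ +-congʳ (*-identityˡ _) ⟨
      1# * app x + - 1# * app x    ≈⟨ solve 2 (λ u y → u :* y :+ (:- u) :* y := y :- y) refl 1# (app x) ⟩
      app x - app x                ≈⟨ -‿inverseʳ (app x) ⟩
      0#                           ∎

    ∑-homo : ∀ {n} (k : Fin n → Carrier) (y : Fin n → I → Carrier) →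
             app (λ i → sum λ j → k j * y j i) ≈ sum λ j → k j * app (y j)
    ∑-homo {zero}  k y = zero-homo λ _ → refl
    ∑-homo {suc n} k y = begin
      app (λ i → k zero * y zero i + sum λ j → k (suc j) * y (suc j) i)    ≈⟨ cong (λ _ → +-comm _ _) ⟩
      app (λ i → (sum λ j → k (suc j) * y (suc j) i) + k zero * y zero i)  ≈⟨ linear _ (k zero) (y zero) ⟩
      app (λ i → sum λ j → k (suc j) * y (suc j) i) + k zero * app (y zero) ≈⟨ +-congʳ (∑-homo (k ∘ suc) (y ∘ suc)) ⟩
      (sum λ j → k (suc j) * app (y (suc j))) + k zero * app (y zero)      ≈⟨ +-comm _ _ ⟩
      k zero * app (y zero) + (sum λ j → k (suc j) * app (y (suc j)))      ∎

    -‿homo : ∀ x k y → app (λ i → x i - k * y i) ≈ app x - k * app y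
    -‿homo x k y = begin
      app (λ i → x i - k * y i)      ≈⟨ cong (λ i → solve 3 (λ x k y → x :- k :* y := x :+ (:- k) :* y) refl (x i) k (y i)) ⟩
      app (λ i → x i + (- k) * y i)  ≈⟨ linear x (- k) y ⟩
      app x + (- k) * app y          ≈⟨ solve 3 (λ x k y → x :+ (:- k) :* y := x :- k :* y) refl (app x) k (app y) ⟩
      app x - k * app y              ∎

    residual-homo : ∀ {n} x (k : Fin n → Carrier) (y : Fin n → I → Carrier) →
                    app (λ i → x i - sum λ j → k j * y j i) ≈ app x - sum λ j → k j * app (y j)
    residual-homo x k y = begin
      app (λ i → x i - sum λ j → k j * y j i)       ≈⟨ cong (λ i → +-congˡ (-‿cong (*-identityˡ _))) ⟨
      app (λ i → x i - 1# * sum λ j → k j * y j i)  ≈⟨ -‿homo x 1# _ ⟩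
      app x - 1# * app (λ i → sum λ j → k j * y j i) ≈⟨ +-congˡ (-‿cong (trans (*-identityˡ _) (∑-homo k y))) ⟩
      app x - sum (λ j → k j * app (y j))           ∎

  open Form public using (app)

  residual : ∀ {I r} → (Fin r → Form I) → (Fin r → I → Carrier) → (I → Carrier) → I → Carrier
  residual f e x i = x i - sum λ j → app (f j) x * e j i

  -- Gaussian elimination without matrices: the selected forms are a basis of the span of all `f j`,
  -- and `e` holds their dual vectors, extended by zero so that sums can run over every index.
  -- `exhaustive` encodes that the unselected forms depend on the selected ones.
  record DualSystem {I r} (f : Fin r → Form I) : Set (c ⊔ ℓ) where
    field
      selected   : Fin r → Bool
      e          : Fin r → I → Carrier
      unselected : ∀ j → selected j ≡ false → ∀ i → e j i ≈ 0#
      dual       : ∀ i j → selected i ≡ true → app (f i) (e j) ≈ Δ i j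
      exhaustive : ∀ i x → app (f i) (residual f e x) ≈ 0#

  -- The first form is independent of the others exactly when it is nonzero on some residual. On
  -- that residual all the others vanish, so after rescaling it becomes the new dual vector, and
  -- subtracting multiples of it from the older ones does not disturb their duality.
  dualSystem : ∀ {I r} (f : Fin r → Form I) → ¬ ¬ DualSystem f
  dualSystem {r = zero} f = return record
    { selected = λ () ; e = λ () ; unselected = λ () ; dual = λ () ; exhaustive = λ () }
  dualSystem {I} {suc r} f = do
    D ← dualSystem (f ∘ suc)
    yes (x , f₀x≉0) ← ¬¬-excluded-middle {A = ∃ λ x → ¬ (app (f zero) (residual (f ∘ suc) (DualSystem.e D) x) ≈ 0#)}
      where no all → return (skip D λ x → stable λ k → all (x , k))
    (k , f₀xk≈1) ← inverse _ f₀x≉0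
    return (extend D x k f₀xk≈1)
    where
    skip : (D : DualSystem (f ∘ suc)) → (∀ x → app (f zero) (residual (f ∘ suc) (DualSystem.e D) x) ≈ 0#) → DualSystem f
    skip D vanishes = record
      { selected   = λ { zero → false ; (suc j) → selected j }
      ; e          = e⁺
      ; unselected = λ { zero _ i → refl ; (suc j) → unselected j }
      ; dual       = λ { (suc i) zero _ → Form.zero-homo (f (suc i)) (λ _ → refl) ; (suc i) (suc j) → dual i j }
      ; exhaustive = λ { zero x → trans (Form.cong (f zero) (residual≈ x)) (vanishes x)
                       ; (suc i) x → trans (Form.cong (f (suc i)) (residual≈ x)) (exhaustive i x) }
      }
      where
      open DualSystem D
      e⁺ : Fin (suc r) → I → Carrier
      e⁺ zero    i = 0#
      e⁺ (suc j) i = e j i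
      residual≈ : ∀ x i → residual f e⁺ x i ≈ residual (f ∘ suc) e x i
      residual≈ x i = +-congˡ (-‿cong (trans (+-congʳ (zeroʳ _)) (+-identityˡ _)))
    extend : (D : DualSystem (f ∘ suc)) → ∀ x k → app (f zero) (residual (f ∘ suc) (DualSystem.e D) x) * k ≈ 1# → DualSystem f
    extend D x k xk≈1 = record
      { selected   = λ { zero → true ; (suc j) → selected j }
      ; e          = e⁺
      ; unselected = λ { (suc j) ¬j i → begin
          e j i - app (f zero) (e j) * e₀ i  ≈⟨ +-cong (unselected j ¬j i) (-‿cong (trans (*-congʳ (Form.zero-homo (f zero) (unselected j ¬j))) (zeroˡ _))) ⟩
          0# - 0#                            ≈⟨ -‿inverseʳ 0# ⟩
          0#                                 ∎ }
      ; dual       = λ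
        { zero zero _ → f₀e₀
        ; zero (suc j) _ → begin
            app (f zero) (e⁺ (suc j))                                   ≈⟨ Form.-‿homo (f zero) _ _ _ ⟩
            app (f zero) (e j) - app (f zero) (e j) * app (f zero) e₀   ≈⟨ +-congˡ (-‿cong (trans (*-congˡ f₀e₀) (*-identityʳ _))) ⟩
            app (f zero) (e j) - app (f zero) (e j)                     ≈⟨ -‿inverseʳ _ ⟩
            0#                                                          ∎
        ; (suc i) zero _ → fe₀ i
        ; (suc i) (suc j) i∈ → trans (f-e⁺ i (e j)) (dual i j i∈)
        }
      ; exhaustive = λ
        { zero y → begin
            app (f zero) (residual f e⁺ y)                                                    ≈⟨ Form.cong (f zero) (residual≈ y) ⟩
            app (f zero) (λ i → ρ y i - app (f zero) (ρ y) * e₀ i)                            ≈⟨ Form.-‿homo (f zero) _ _ _ ⟩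
            app (f zero) (ρ y) - app (f zero) (ρ y) * app (f zero) e₀                         ≈⟨ +-congˡ (-‿cong (trans (*-congˡ f₀e₀) (*-identityʳ _))) ⟩
            app (f zero) (ρ y) - app (f zero) (ρ y)                                           ≈⟨ -‿inverseʳ _ ⟩
            0#                                                                                ∎
        ; (suc i) y → trans (Form.cong (f (suc i)) (residual≈ y)) (trans (f-e⁺ i (ρ y)) (exhaustive i y))
        }
      }
      where
      open DualSystem D
      ρ = residual (f ∘ suc) e
      e₀ : I → Carrier
      e₀ i = 0# + k * ρ x i
      e⁺ : Fin (suc r) → I → Carrier
      e⁺ zero    = e₀
      e⁺ (suc j) i = e j i - app (f zero) (e j) * e₀ i
      app-e₀ : ∀ φ → app φ e₀ ≈ k * app φ (ρ x)
      app-e₀ φ = trans (Form.linear φ (λ _ → 0#) k (ρ x)) (trans (+-congʳ (Form.zero-homo φ λ _ → refl)) (+-identityˡ _))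
      f₀e₀ : app (f zero) e₀ ≈ 1#
      f₀e₀ = trans (app-e₀ (f zero)) (trans (*-comm _ _) xk≈1)
      fe₀ : ∀ i → app (f (suc i)) e₀ ≈ 0#
      fe₀ i = trans (app-e₀ (f (suc i))) (trans (*-congˡ (exhaustive i x)) (zeroʳ _))
      f-e⁺ : ∀ i y {s} → app (f (suc i)) (λ k → y k - s * e₀ k) ≈ app (f (suc i)) y
      f-e⁺ i y = trans (Form.-‿homo (f (suc i)) _ _ _) (minus-zero (trans (*-congˡ (fe₀ i)) (zeroʳ _)))
      residual≈ : ∀ y i → residual f e⁺ y i ≈ ρ y i - app (f zero) (ρ y) * e₀ i
      residual≈ y i = begin
        y i - (s * t + sum (λ j → g j * (e j i - h j * t)))
          ≈⟨ +-congˡ (-‿cong (+-congˡ (begin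
               sum (λ j → g j * (e j i - h j * t))
                 ≈⟨ sum-cong-≋ (λ j → solve 4 (λ g e h t → g :* (e :- h :* t) := g :* e :+ (g :* h) :* (:- t)) refl (g j) (e j i) (h j) t) ⟩
               sum (λ j → g j * e j i + (g j * h j) * - t)
                 ≈⟨ ∑-distrib-+ (λ j → g j * e j i) _ ⟩
               sum (λ j → g j * e j i) + sum (λ j → (g j * h j) * - t)
                 ≈⟨ +-congˡ (*-distribʳ-sum (- t) (λ j → g j * h j)) ⟨
               sum (λ j → g j * e j i) + sum (λ j → g j * h j) * - t ∎))) ⟩
        y i - (s * t + (sum (λ j → g j * e j i) + sum (λ j → g j * h j) * - t))
          ≈⟨ solve 5 (λ y s t p q → y :- (s :* t :+ (p :+ q :* (:- t))) := (y :- p) :- (s :- q) :* t) refl (y i) s t _ _ ⟩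
        ρ y i - (s - sum (λ j → g j * h j)) * t
          ≈⟨ +-congˡ (-‿cong (*-congʳ (Form.residual-homo (f zero) y g e))) ⟨
        ρ y i - app (f zero) (ρ y) * e₀ i ∎
        where
        s = app (f zero) y
        t = e₀ i
        g h : Fin r → Carrier
        g j = app (f (suc j)) y
        h j = app (f zero) (e j)

  Separating : ∀ {I J : Set} → (J → Form I) → Set (c ⊔ ℓ)
  Separating f = ∀ x → (∀ j → app (f j) x ≈ 0#) → ∀ i → x i ≈ 0#

  module _ {I r} {f : Fin r → Form I} (D : DualSystem f) where
    open DualSystem D

    expansion : Separating f → ∀ x i → x i ≈ sum λ j → app (f j) x * e j i
    expansion sep x i = x-y≈0⇒x≈y (sep (residual f e x) (λ j → exhaustive j x) i)

  count-sum : ∀ {n} (s : Fin n → Bool) → sum (λ j → if s j then 1# else 0#) ≈ count s · 1#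
  count-sum {zero}  s = refl
  count-sum {suc n} s with s zero
  ... | true  = +-congˡ (count-sum (s ∘ suc))
  ... | false = trans (+-identityˡ _) (count-sum (s ∘ suc))

  ·-injective : ∀ m n → m · 1# ≈ n · 1# → m ≡ n
  ·-injective zero    zero    _ = ≡.refl
  ·-injective zero    (suc n) h = contradiction (sym h) (char0 n)
  ·-injective (suc m) zero    h = contradiction h (char0 m)
  ·-injective (suc m) (suc n) h = ≡.cong suc (·-injective m n (begin
    m · 1#               ≈⟨ solve 2 (λ u x → x := (u :+ x) :- u) refl 1# (m · 1#) ⟩
    (1# + m · 1#) - 1#   ≈⟨ +-congʳ h ⟩
    (1# + n · 1#) - 1#   ≈⟨ solve 2 (λ u x → (u :+ x) :- u := x) refl 1# (n · 1#) ⟩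
    n · 1#               ∎))

  unit : ∀ {I : Set} {N} → I ↔ Fin N → Fin N → I → Carrier
  unit I↔ l i = Δ l (Inverse.to I↔ i)

  unit-expansion : ∀ {I N} (I↔ : I ↔ Fin N) (φ : Form I) x →
                   app φ x ≈ sum λ l → x (Inverse.from I↔ l) * app φ (unit I↔ l)
  unit-expansion I↔ φ x = trans (Form.cong φ (λ i → begin
      x i                                                 ≡⟨ ≡.cong x (Inverse.strictlyInverseʳ I↔ i) ⟨
      x (Inverse.from I↔ (Inverse.to I↔ i))               ≈⟨ ∑-Δʳ (Inverse.to I↔ i) (x ∘ Inverse.from I↔) ⟨
      sum (λ l → x (Inverse.from I↔ l) * unit I↔ l i)     ∎))
    (Form.∑-homo φ (x ∘ Inverse.from I↔) (unit I↔))

  -- Both sides are the trace of the identity.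
  count-selected : ∀ {I N r} {f : Fin r → Form I} (D : DualSystem f) → Separating f → I ↔ Fin N →
                   count (DualSystem.selected D) ≡ N
  count-selected {I} {N} {r} {f} D sep I↔ = ·-injective _ _ (begin
    count selected · 1#                                            ≈⟨ count-sum selected ⟨
    sum (λ j → if selected j then 1# else 0#)                      ≈⟨ sum-cong-≋ diagonal ⟨
    sum (λ j → app (f j) (e j))                                    ≈⟨ sum-cong-≋ (λ j → unit-expansion I↔ (f j) (e j)) ⟩
    sum (λ j → sum λ l → e j (from l) * app (f j) (unit I↔ l))     ≈⟨ ∑-comm (λ j l → e j (from l) * app (f j) (unit I↔ l)) ⟩
    sum (λ l → sum λ j → e j (from l) * app (f j) (unit I↔ l))     ≈⟨ sum-cong-≋ (λ l → sum-cong-≋ λ j → *-comm (e j (from l)) _) ⟩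
    sum (λ l → sum λ j → app (f j) (unit I↔ l) * e j (from l))     ≈⟨ sum-cong-≋ (λ l → expansion D sep (unit I↔ l) (from l)) ⟨
    sum (λ l → unit I↔ l (from l))                                 ≈⟨ sum-cong-≋ (λ l → reflexive (≡.trans (≡.cong (Δ l) (Inverse.strictlyInverseˡ I↔ l)) (Δ-refl l))) ⟩
    sum {N} (λ _ → 1#)                                             ≈⟨ Sum.sum-replicate semiring N ⟩
    N · 1#                                                         ∎)
    where
    open DualSystem D
    open Inverse I↔ using (from)
    diagonal : ∀ j → app (f j) (e j) ≈ (if selected j then 1# else 0#)
    diagonal j with selected j in eq
    ... | true  = trans (dual j j eq) (reflexive (Δ-refl j))
    ... | false = Form.zero-homo (f j) (unselected j eq)

  count≤ : ∀ {n} (s : Fin n → Bool) → count s ℕ.≤ n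
  count≤ {zero}  s = ℕ.z≤n
  count≤ {suc n} s with s zero
  ... | true  = ℕ.s≤s (count≤ (s ∘ suc))
  ... | false = ℕ.m≤n⇒m≤1+n (count≤ (s ∘ suc))

  -- By the trace count exactly N of the M forms are selected. Deciding N ≤ M first leaves a
  -- contradiction as the goal, where the double negation around the dual system does no harm.
  dimension : ∀ {I J N M} (f : J → Form I) → Separating f → I ↔ Fin N → J ↔ Fin M → N ℕ.≤ M
  dimension {N = N} {M} f sep I↔ J↔ with N ℕ.≤? M
  ... | yes N≤M = N≤M
  ... | no  N≰M = contradiction (λ D → N≰M (≡.subst (ℕ._≤ M) (count-selected D sep′ I↔) (count≤ (DualSystem.selected D))))
                   (dualSystem (f ∘ Inverse.from J↔))
    where
    sep′ : Separating (f ∘ Inverse.from J↔)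
    sep′ x f≈0 = sep x λ j → ≡.subst (λ j → app (f j) x ≈ 0#) (Inverse.strictlyInverseʳ J↔ j) (f≈0 (Inverse.to J↔ j))

-- Subsets of fixed size and the exterior product.

-- The q-element subsets of `Fin n` as characteristic words. They index the basis of the q-th
-- exterior power, and their two last constructors are Pascal's rule.
data Sub : ℕ → ℕ → Set where
  nil  : Sub 0 0
  skip : ∀ {n q} → Sub n q → Sub (suc n) q
  take : ∀ {n q} → Sub n q → Sub (suc n) (suc q)

data _∉_ : ∀ {n q} → Fin n → Sub n q → Set where
  here  : ∀ {n q} {s : Sub n q} → zero ∉ skip s
  skip  : ∀ {n q k} {s : Sub n q} → k ∉ s → suc k ∉ skip s
  take  : ∀ {n q k} {s : Sub n q} → k ∉ s → suc k ∉ take s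

module Exterior {c ℓ} (F : ClassicalField c ℓ) where

  open LinearAlgebra F public

  -- δ f t = Σ ± f k (t ∖ k) over k ∈ t: the exterior product with u for
  -- f k s = u k * ω s, and the Koszul map for f k s = X k (ω s).
  δ : ∀ {n q} → (Fin n → Sub n q → Carrier) → Sub n (suc q) → Carrier
  δ             f (skip t) = δ (λ k s → f (suc k) (skip s)) t
  -- No elements remain in `t`, so the alternating sum ends here.
  δ {q = zero}  f (take t) = f zero (skip t)
  δ {q = suc q} f (take t) = f zero (skip t) - δ (λ k s → f (suc k) (take s)) t

  -- Each k is paired only with the set from which k was removed, so values at members never enter.
  δ-cong-∉ : ∀ {n q} {f g : Fin n → Sub n q → Carrier} → (∀ {k s} → k ∉ s → f k s ≈ g k s) → ∀ t → δ f t ≈ δ g t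
  δ-cong-∉             f≈g (skip t) = δ-cong-∉ (λ k∉s → f≈g (skip k∉s)) t
  δ-cong-∉ {q = zero}  f≈g (take t) = f≈g here
  δ-cong-∉ {q = suc q} f≈g (take t) = +-cong (f≈g here) (-‿cong (δ-cong-∉ (λ k∉s → f≈g (take k∉s)) t))

  δ-cong : ∀ {n q} {f g : Fin n → Sub n q → Carrier} → (∀ k s → f k s ≈ g k s) → ∀ t → δ f t ≈ δ g t
  δ-cong f≈g = δ-cong-∉ λ {k} {s} _ → f≈g k s

  δ-+ : ∀ {n q} (f g : Fin n → Sub n q → Carrier) t → δ (λ k s → f k s + g k s) t ≈ δ f t + δ g t
  δ-+             f g (skip t) = δ-+ _ _ t
  δ-+ {q = zero}  f g (take t) = refl
  δ-+ {q = suc q} f g (take t) = trans (+-congˡ (-‿cong (δ-+ _ _ t)))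
    (solve 4 (λ a b c d → a :+ b :- (c :+ d) := (a :- c) :+ (b :- d)) refl _ _ _ _)

  δ-* : ∀ {n q} a (f : Fin n → Sub n q → Carrier) t → δ (λ k s → a * f k s) t ≈ a * δ f t
  δ-*             a f (skip t) = δ-* a _ t
  δ-* {q = zero}  a f (take t) = refl
  δ-* {q = suc q} a f (take t) = trans (+-congˡ (-‿cong (δ-* a _ t)))
    (solve 3 (λ a b c → a :* b :- a :* c := a :* (b :- c)) refl _ _ _)

  δ-linear : ∀ {n q} a (f g : Fin n → Sub n q → Carrier) t → δ (λ k s → f k s + a * g k s) t ≈ δ f t + a * δ g t
  δ-linear a f g t = trans (δ-+ f _ t) (+-congˡ (δ-* a g t))

  δ-zero : ∀ {n q} {f : Fin n → Sub n q → Carrier} → (∀ {k s} → k ∉ s → f k s ≈ 0#) → ∀ t → δ f t ≈ 0#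
  δ-zero f≈0 t = trans (δ-cong-∉ (λ k∉s → trans (f≈0 k∉s) (sym (zeroˡ 0#))) t) (trans (δ-* 0# (λ _ _ → 0#) t) (zeroˡ _))

  δ-∑ : ∀ {n q r} (f : Fin r → Fin n → Sub n q → Carrier) t → δ (λ k s → sum λ i → f i k s) t ≈ sum λ i → δ (f i) t
  δ-∑ {r = zero}  f t = δ-zero (λ _ → refl) t
  δ-∑ {r = suc r} f t = trans (δ-+ (f zero) _ t) (+-congˡ (δ-∑ (f ∘ suc) t))

  wedge : ∀ {n q} → (Fin n → Carrier) → (Sub n q → Carrier) → Sub n (suc q) → Carrier
  wedge u ω = δ λ k s → u k * ω s

  wedge-cong : ∀ {n q} {u v : Fin n → Carrier} {ω η : Sub n q → Carrier} →
               (∀ k → u k ≈ v k) → (∀ s → ω s ≈ η s) → ∀ t → wedge u ω t ≈ wedge v η t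
  wedge-cong u≈v ω≈η = δ-cong λ k s → *-cong (u≈v k) (ω≈η s)

  wedge-linearʳ : ∀ {n q} (u : Fin n → Carrier) a (ω η : Sub n q → Carrier) t →
                  wedge u (λ s → ω s + a * η s) t ≈ wedge u ω t + a * wedge u η t
  wedge-linearʳ u a ω η t = trans
    (δ-cong (λ k s → solve 4 (λ u w a v → u :* (w :+ a :* v) := u :* w :+ a :* (u :* v)) refl _ _ _ _) t)
    (δ-linear a _ _ t)

  wedge-subʳ : ∀ {n q} (u : Fin n → Carrier) a (ω η : Sub n q → Carrier) t →
               wedge u (λ s → a * ω s - η s) t ≈ a * wedge u ω t - wedge u η t
  wedge-subʳ u a ω η t = trans
    -- The unit is passed as a variable `o`, so that subtraction becomes addition of a multiple by
    -- `- 1#`; the surplus bracket vanishes because `o` stands for `1#`.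
    (δ-cong (λ k s → solve 5 (λ u w a v o → u :* (a :* w :- v) := (a :* (u :* w)) :+ (:- o) :* (u :* v) :+ ((o :* (u :* v)) :- u :* v)) refl _ _ _ _ 1#) t)
    (trans (δ-cong (λ k s → trans (+-congˡ (trans (+-congʳ (*-identityˡ _)) (-‿inverseʳ _))) (+-identityʳ _)) t)
    (trans (δ-linear (- 1#) _ _ t) (trans (+-congʳ (δ-* a _ t))
      (trans (solve 3 (λ x o y → x :+ (:- o) :* y := x :- o :* y) refl _ _ _) (+-congˡ (-‿cong (*-identityˡ _)))))))

  -- Expansion along index zero: the two mixed terms trade places with opposite sign, and the term
  -- avoiding `u zero` and `v zero` is the induction hypothesis.
  wedge-anticomm : ∀ {n q} (u v : Fin n → Carrier) (ω : Sub n q → Carrier) t →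
                   wedge u (wedge v ω) t ≈ - wedge v (wedge u ω) t
  wedge-anticomm             u v ω (skip t) = wedge-anticomm (u ∘ suc) (v ∘ suc) (ω ∘ skip) t
  wedge-anticomm {q = zero}  u v ω (take t) = begin
    u₀ * wedge v′ ω′ t - wedge u′ (λ s → v₀ * ω′ s) t   ≈⟨ +-congˡ (-‿cong (scale u′ v₀)) ⟩
    u₀ * wedge v′ ω′ t - v₀ * wedge u′ ω′ t             ≈⟨ solve 4 (λ a x b y → a :* x :- b :* y := :- (b :* y :- a :* x)) refl _ _ _ _ ⟩
    - (v₀ * wedge u′ ω′ t - u₀ * wedge v′ ω′ t)         ≈⟨ -‿cong (+-congˡ (-‿cong (scale v′ u₀))) ⟨
    - (v₀ * wedge u′ ω′ t - wedge v′ (λ s → u₀ * ω′ s) t) ∎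
    where
    u₀ = u zero
    v₀ = v zero
    u′ = u ∘ suc
    v′ = v ∘ suc
    ω′ = ω ∘ skip
    scale : ∀ w a → wedge w (λ s → a * ω′ s) t ≈ a * wedge w ω′ t
    scale w a = trans (δ-cong (λ k s → solve 3 (λ w a o → w :* (a :* o) := a :* (w :* o)) refl _ _ _) t) (δ-* a _ t)
  wedge-anticomm {q = suc q} u v ω (take t) = begin
    u₀ * wedge v′ ω′ t - wedge u′ (λ s → v₀ * ω′ s - wedge v′ ω″ s) t      ≈⟨ +-congˡ (-‿cong (wedge-subʳ u′ v₀ ω′ _ t)) ⟩
    u₀ * wedge v′ ω′ t - (v₀ * wedge u′ ω′ t - wedge u′ (wedge v′ ω″) t)   ≈⟨ +-congˡ (-‿cong (+-congˡ (-‿cong (wedge-anticomm u′ v′ ω″ t)))) ⟩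
    u₀ * wedge v′ ω′ t - (v₀ * wedge u′ ω′ t - - wedge v′ (wedge u′ ω″) t)
      ≈⟨ solve 5 (λ a x b y z → a :* x :- (b :* y :- (:- z)) := :- (b :* y :- (a :* x :- z))) refl _ _ _ _ _ ⟩
    - (v₀ * wedge u′ ω′ t - (u₀ * wedge v′ ω′ t - wedge v′ (wedge u′ ω″) t)) ≈⟨ -‿cong (+-congˡ (-‿cong (wedge-subʳ v′ u₀ ω′ _ t))) ⟨
    - (v₀ * wedge u′ ω′ t - wedge v′ (λ s → u₀ * ω′ s - wedge u′ ω″ s) t)  ∎
    where
    u₀ = u zero
    v₀ = v zero
    u′ = u ∘ suc
    v′ = v ∘ suc
    ω′ = ω ∘ skip
    ω″ = ω ∘ take

  -- Proved by the same expansion instead of halving anticommutativity: the two mixed terms now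
  -- coincide and cancel.
  wedge-square : ∀ {n q} (u : Fin n → Carrier) (ω : Sub n q → Carrier) t → wedge u (wedge u ω) t ≈ 0#
  wedge-square             u ω (skip t) = wedge-square (u ∘ suc) (ω ∘ skip) t
  wedge-square {q = zero}  u ω (take t) = trans (+-congˡ (-‿cong (trans
    (δ-cong (λ k s → solve 3 (λ w a o → w :* (a :* o) := a :* (w :* o)) refl _ _ _) t) (δ-* _ _ t)))) (-‿inverseʳ _)
  wedge-square {q = suc q} u ω (take t) = begin
    u₀ * wedge u′ ω′ t - wedge u′ (λ s → u₀ * ω′ s - wedge u′ ω″ s) t      ≈⟨ +-congˡ (-‿cong (wedge-subʳ u′ u₀ ω′ _ t)) ⟩
    u₀ * wedge u′ ω′ t - (u₀ * wedge u′ ω′ t - wedge u′ (wedge u′ ω″) t)   ≈⟨ solve 2 (λ a b → a :- (a :- b) := b) refl _ _ ⟩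
    wedge u′ (wedge u′ ω″) t                                               ≈⟨ wedge-square u′ ω″ t ⟩
    0#                                                                     ∎
    where
    u₀ = u zero
    u′ = u ∘ suc
    ω′ = ω ∘ skip
    ω″ = ω ∘ take

  wedgeForm : ∀ {n q} → (Fin n → Carrier) → Sub n (suc q) → Form (Sub n q)
  wedgeForm u t = record
    { app    = λ ω → wedge u ω t
    ; cong   = λ ω≈η → wedge-cong (λ _ → refl) ω≈η t
    ; linear = λ ω a η → wedge-linearʳ u a ω η t
    }

  pullback : ∀ {I J : Set} → (J → I) → Form J → Form I
  pullback g φ = record
    { app    = λ x → app φ (x ∘ g)
    ; cong   = λ x≈y → Form.cong φ (x≈y ∘ g)
    ; linear = λ x k y → Form.linear φ (x ∘ g) k (y ∘ g)
    }

  zeroForm : ∀ {I} → Form I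
  zeroForm = record { app = λ _ → 0# ; cong = λ _ → refl ; linear = λ _ _ _ → sym (trans (+-identityˡ _) (zeroʳ _)) }

  Detects : ∀ {n q} → (Fin (suc n) → Carrier) → (Sub n q → Form (Sub (suc n) q)) → Set (c ⊔ ℓ)
  Detects {n} {q} u g = ∀ ω → (∀ s → app (g s) ω ≈ 0#) → ∀ t → wedge u ω t ≈ 0#

  -- The wedge with u has rank at most n C q, the number of detectors.  If
  -- u zero ≉ 0, the components of wedge u ω containing zero determine the
  -- others, because wedge u (wedge u ω) ≈ 0.
  detectors : ∀ {n} q (u : Fin (suc n) → Carrier) → ¬ ¬ ∃ λ (g : Sub n q → Form (Sub (suc n) q)) → Detects u g
  detectors {n} q u = do
    yes u₀≈0 ← ¬¬-excluded-middle {A = u zero ≈ 0#}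
      where no u₀≉0 → return (wedgeForm u ∘ take , pivot u₀≉0)
    shift q u₀≈0
    where
    pivot : ¬ (u zero ≈ 0#) → Detects u (wedgeForm u ∘ take)
    pivot u₀≉0 ω h (take t) = h t
    pivot u₀≉0 ω h (skip t) = cancel u₀≉0 (begin
      u zero * wedge u ω (skip t)                                                     ≈⟨ minus-zero (δ-zero (λ {_} {s} _ → trans (*-congˡ (h s)) (zeroʳ _)) t) ⟨
      u zero * wedge u ω (skip t) - wedge (u ∘ suc) (wedge u ω ∘ take) t              ≈⟨ wedge-square u ω (take t) ⟩
      0# ∎)
    -- With `u zero` zero, the wedge does not mix sets containing zero with sets avoiding it.
    -- Detectors for the two tails are put side by side, and their numbers add up by Pascal's rule.
    shift : ∀ {n} q {u : Fin (suc n) → Carrier} → u zero ≈ 0# → ¬ ¬ ∃ λ (g : Sub n q → Form (Sub (suc n) q)) → Detects u g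
    shift {zero}  zero    u₀≈0 = return ((λ _ → zeroForm) , λ { ω _ (take t) → trans (*-congʳ u₀≈0) (zeroˡ _) })
    shift {zero}  (suc q) u₀≈0 = return ((λ _ → zeroForm) , λ { ω _ (take ()) ; ω _ (skip ()) })
    shift {suc n} zero {u} u₀≈0 = do
      g , g-detects ← detectors zero (u ∘ suc)
      return ( (λ { (skip s) → pullback skip (g s) })
             , λ { ω h (skip t) → g-detects (ω ∘ skip) (λ s → h (skip s)) t
                 ; ω h (take t) → trans (*-congʳ u₀≈0) (zeroˡ _) })
    shift {suc n} (suc q) {u} u₀≈0 = do
      g , g-detects ← detectors (suc q) (u ∘ suc)
      g′ , g′-detects ← detectors q (u ∘ suc)
      return ( (λ { (skip s) → pullback skip (g s) ; (take s) → pullback take (g′ s) })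
             , λ { ω h (skip t) → g-detects (ω ∘ skip) (λ s → h (skip s)) t
                 ; ω h (take t) → trans (minus-zero (g′-detects (ω ∘ take) (λ s → h (take s)) t)) (trans (*-congʳ u₀≈0) (zeroˡ _)) })

-- Polynomial maps by finite differences, and determinants.

module Polynomial {c ℓ} (F : ClassicalField c ℓ) where

  open Exterior F public

  Nonzero : ∀ {J : Set} → (J → Carrier) → Set ℓ
  Nonzero ω = ¬ (∀ j → ω j ≈ 0#)

  ¬nonzero : ∀ {J : Set} {ω : J → Carrier} → ¬ Nonzero ω → ∀ j → ω j ≈ 0#
  ¬nonzero ¬nz j = stable λ k → ¬nz λ ω≈0 → k (ω≈0 j)

  infixl 6 _⊞_
  _⊞_ : ∀ {V : Set} → (V → Carrier) → (V → Carrier) → V → Carrier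
  (x ⊞ h) v = x v + h v

  Congruent : ∀ {V J : Set} → ((V → Carrier) → J → Carrier) → Set _
  Congruent g = ∀ {x y} → (∀ v → x v ≈ y v) → ∀ j → g x j ≈ g y j

  difference : ∀ {V J : Set} → ((V → Carrier) → J → Carrier) → (V → Carrier) → (V → Carrier) → J → Carrier
  difference g h x j = g (x ⊞ h) j - g x j

  difference-cong : ∀ {V J : Set} {g : (V → Carrier) → J → Carrier} → Congruent g → ∀ h → Congruent (difference g h)
  difference-cong g-cong h x≈y j = +-cong (g-cong (λ v → +-congʳ (x≈y v)) j) (-‿cong (g-cong x≈y j))

  -- Fréchet's description of polynomial maps: all d-fold differences vanish, in any directions. It
  -- needs no monomials and no bases, and dropping a summand from the argument is itself a
  -- difference.
  Degree< : ∀ {V J : Set} → ℕ → ((V → Carrier) → J → Carrier) → Set _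
  Degree< zero    g = Level.Lift c (∀ x j → g x j ≈ 0#)
  Degree< (suc d) g = ∀ h → Degree< d (difference g h)

  module _ {V J : Set} where

    private
      Map = (V → Carrier) → J → Carrier

    degree-cong : ∀ d {f g : Map} → (∀ x j → f x j ≈ g x j) → Degree< d f → Degree< d g
    degree-cong zero    f≈g (Level.lift f≈0) = Level.lift λ x j → trans (sym (f≈g x j)) (f≈0 x j)
    degree-cong (suc d) f≈g df h = degree-cong d (λ x j → +-cong (f≈g _ j) (-‿cong (f≈g x j))) (df h)

    degree-zero : ∀ d {g : Map} → (∀ x j → g x j ≈ 0#) → Degree< d g
    degree-zero zero    g≈0 = Level.lift g≈0
    degree-zero (suc d) g≈0 h = degree-zero d λ x j → trans (minus-zero (g≈0 x j)) (g≈0 (x ⊞ h) j)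

    degree-+ : ∀ d {f g : Map} → Degree< d f → Degree< d g → Degree< d (λ x j → f x j + g x j)
    degree-+ zero    (Level.lift f≈0) (Level.lift g≈0) = Level.lift λ x j → trans (+-cong (f≈0 x j) (g≈0 x j)) (+-identityˡ 0#)
    degree-+ (suc d) df dg h = degree-cong d
      (λ x j → solve 4 (λ a b c d → (a :- b) :+ (c :- d) := (a :+ c) :- (b :+ d)) refl _ _ _ _)
      (degree-+ d (df h) (dg h))

    degree-shift : ∀ d {g : Map} → Congruent g → ∀ h → Degree< d g → Degree< d (λ x → g (x ⊞ h))
    degree-shift zero    g-cong h (Level.lift g≈0) = Level.lift λ x → g≈0 (x ⊞ h)
    degree-shift (suc d) g-cong h dg k = degree-cong d
      (λ x j → +-congʳ (g-cong (λ v → solve 3 (λ x h k → x :+ h :+ k := x :+ k :+ h) refl (x v) (h v) (k v)) j))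
      (degree-shift d (difference-cong g-cong k) h (dg k))

    -- Either h zero can be dropped, or the difference along h zero, which has
    -- smaller degree, is nonzero at the remaining sum.
    selection : ∀ d {r} {g : Map} → Congruent g → Degree< (suc d) g → ∀ (x : V → Carrier) (h : Fin r → V → Carrier) →
                Nonzero (g (λ v → x v + sum λ i → h i v)) →
                ¬ ¬ ∃ λ (S : Fin r → Bool) → count S ℕ.≤ d × Nonzero (g (λ v → x v + sum λ i → if S i then h i v else 0#))
    selection d {zero}      g-cong dg x h nz = return ((λ ()) , ℕ.z≤n , nz)
    selection d {suc r} {g} g-cong dg x h nz = do
      no tail≈0 ← ¬¬-excluded-middle {A = Nonzero (g (λ v → x v + sum λ i → h (suc i) v))}
        where yes nz′ → do
                S , S≤d , nzS ← selection d g-cong dg x (h ∘ suc) nz′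
                return (omit S , S≤d , nzS ∘ drop S)
      extend d dg (¬nonzero tail≈0)
      where
      omit include : (Fin r → Bool) → Fin (suc r) → Bool
      omit S zero    = false
      omit S (suc i) = S i
      include S zero    = true
      include S (suc i) = S i
      partial : (Fin r → Bool) → V → Carrier
      partial S v = x v + sum λ i → if S i then h (suc i) v else 0#
      drop : ∀ S → (∀ j → g (λ v → x v + sum λ i → if omit S i then h i v else 0#) j ≈ 0#) → ∀ j → g (partial S) j ≈ 0#
      drop S g≈0 j = trans (g-cong (λ v → +-congˡ (sym (+-identityˡ _))) j) (g≈0 j)
      extend : ∀ d → Degree< (suc d) g → (∀ j → g (λ v → x v + sum λ i → h (suc i) v) j ≈ 0#) →
               ¬ ¬ ∃ λ (S : Fin (suc r) → Bool) → count S ℕ.≤ d × Nonzero (g (λ v → x v + sum λ i → if S i then h i v else 0#))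
      extend d dg tail≈0 = extend′ d (dg (h zero))
        where
        Δ≉0 : Nonzero (difference g (h zero) (λ v → x v + sum λ i → h (suc i) v))
        Δ≉0 Δ≈0 = nz λ j → begin
          g (λ v → x v + (h zero v + sum λ i → h (suc i) v)) j
            ≈⟨ g-cong (λ v → solve 3 (λ x a b → x :+ (a :+ b) := x :+ b :+ a) refl (x v) (h zero v) _) j ⟩
          g ((λ v → x v + sum λ i → h (suc i) v) ⊞ h zero) j  ≈⟨ x-y≈0⇒x≈y (Δ≈0 j) ⟩
          g (λ v → x v + sum λ i → h (suc i) v) j             ≈⟨ tail≈0 j ⟩
          0#                                                  ∎
        extend′ : ∀ d → Degree< d (difference g (h zero)) →
                  ¬ ¬ ∃ λ (S : Fin (suc r) → Bool) → count S ℕ.≤ d × Nonzero (g (λ v → x v + sum λ i → if S i then h i v else 0#))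
        -- Here the map is constant, so it cannot vanish without `h zero` and be nonzero with it.
        extend′ zero    (Level.lift Δg≈0) = contradiction (Δg≈0 _) Δ≉0
        extend′ (suc d) dΔ = do
          S , S≤d , nzS ← selection d (difference-cong g-cong (h zero)) dΔ x (h ∘ suc) Δ≉0
          no partial≈0 ← ¬¬-excluded-middle {A = Nonzero (g (partial S))}
            where yes nz′ → return (omit S , ℕ.m≤n⇒m≤1+n S≤d , nz′ ∘ drop S)
          return (include S , ℕ.s≤s S≤d , λ g≈0 → nzS λ j → begin
            g (partial S ⊞ h zero) j - g (partial S) j  ≈⟨ minus-zero (¬nonzero partial≈0 j) ⟩
            g (partial S ⊞ h zero) j                    ≈⟨ g-cong (λ v → solve 3 (λ x a b → x :+ b :+ a := x :+ (a :+ b)) refl (x v) (h zero v) _) j ⟩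
            g (λ v → x v + (h zero v + sum λ i → if S i then h (suc i) v else 0#)) j ≈⟨ g≈0 j ⟩
            0# ∎)

  degree-map : ∀ {V J J′ : Set} d {g : (V → Carrier) → J → Carrier} (f : J′ → Form J) →
               Degree< d g → Degree< d (λ x j → app (f j) (g x))
  degree-map zero    f (Level.lift g≈0) = Level.lift λ x j → Form.zero-homo (f j) (g≈0 x)
  degree-map (suc d) f dg h = degree-cong d
    (λ x j → trans (Form.cong (f j) (λ i → +-congˡ (-‿cong (sym (*-identityˡ _))))) (trans (Form.-‿homo (f j) _ 1# _) (+-congˡ (-‿cong (*-identityˡ _)))))
    (degree-map d f (dg h))

  record LinearMap (V J : Set) : Set (c ⊔ ℓ) where
    field
      ⟦_⟧  : (V → Carrier) → J → Carrier
      cong : Congruent ⟦_⟧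
      additive : ∀ x h j → ⟦ x ⊞ h ⟧ j ≈ ⟦ x ⟧ j + ⟦ h ⟧ j
  open LinearMap public using (⟦_⟧)

  -- The product rule for differences: the difference of L ∧ g along h at x is L x ∧ (difference of
  -- g) + L h ∧ g (x + h). The first term falls to the induction, and in the second L h is constant,
  -- so the wedge with it is a linear map applied to a shift of g.
  degree-wedge : ∀ {V n q} d (L : LinearMap V (Fin n)) {g : (V → Carrier) → Sub n q → Carrier} → Congruent g →
                 Degree< d g → Degree< (suc d) (λ x → wedge (⟦ L ⟧ x) (g x))
  degree-wedge zero    L g-cong (Level.lift g≈0) = degree-zero 1 λ x → δ-zero λ {_} {s} _ → trans (*-congˡ (g≈0 x s)) (zeroʳ _)
  degree-wedge (suc d) L {g} g-cong dg h = degree-cong (suc d) leibniz (degree-+ (suc d)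
    (degree-wedge d L (difference-cong g-cong h) (dg h))
    (degree-map (suc d) (wedgeForm (⟦ L ⟧ h)) (degree-shift (suc d) g-cong h dg)))
    where
    leibniz : ∀ x t → wedge (⟦ L ⟧ x) (difference g h x) t + wedge (⟦ L ⟧ h) (g (x ⊞ h)) t
                    ≈ wedge (⟦ L ⟧ (x ⊞ h)) (g (x ⊞ h)) t - wedge (⟦ L ⟧ x) (g x) t
    leibniz x t = begin
      wedge (⟦ L ⟧ x) (difference g h x) t + wedge (⟦ L ⟧ h) (g (x ⊞ h)) t
        ≈⟨ δ-+ _ _ t ⟨
      δ (λ k s → ⟦ L ⟧ x k * (g (x ⊞ h) s - g x s) + ⟦ L ⟧ h k * g (x ⊞ h) s) t
        ≈⟨ δ-cong (λ k s → trans (solve 5 (λ a b p q u → a :* (p :- q) :+ b :* p := (a :+ b) :* p :+ (:- u) :* (a :* q) :+ (u :* (a :* q) :- a :* q)) refl _ _ _ _ 1#)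
             (trans (+-congˡ (trans (+-congʳ (*-identityˡ _)) (-‿inverseʳ _))) (trans (+-identityʳ _)
             (+-congʳ (*-congʳ (sym (LinearMap.additive L x h k))))))) t ⟩
      δ (λ k s → ⟦ L ⟧ (x ⊞ h) k * g (x ⊞ h) s + (- 1#) * (⟦ L ⟧ x k * g x s)) t
        ≈⟨ δ-linear _ _ _ t ⟩
      wedge (⟦ L ⟧ (x ⊞ h)) (g (x ⊞ h)) t + (- 1#) * wedge (⟦ L ⟧ x) (g x) t
        ≈⟨ solve 3 (λ a u b → a :+ (:- u) :* b := a :- u :* b) refl _ _ _ ⟩
      wedge (⟦ L ⟧ (x ⊞ h)) (g (x ⊞ h)) t - 1# * wedge (⟦ L ⟧ x) (g x) t
        ≈⟨ +-congˡ (-‿cong (*-identityˡ _)) ⟩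
      wedge (⟦ L ⟧ (x ⊞ h)) (g (x ⊞ h)) t - wedge (⟦ L ⟧ x) (g x) t ∎

  -- The coordinates are the r × r minors of the matrix with rows `v i`; for r = n the only one is
  -- the determinant.
  wedges : ∀ {r n} → (Fin r → Fin n → Carrier) → Sub n r → Carrier
  wedges {zero}  v _ = 1#
  wedges {suc r} v   = wedge (v zero) (wedges (v ∘ suc))

  wedges-cong : ∀ {r n} {v w : Fin r → Fin n → Carrier} → (∀ i k → v i k ≈ w i k) → ∀ t → wedges v t ≈ wedges w t
  wedges-cong {zero}  v≈w t = refl
  wedges-cong {suc r} v≈w t = wedge-cong (v≈w zero) (wedges-cong (v≈w ∘ suc)) t

  wedges-absorb : ∀ {r n} (v : Fin r → Fin n → Carrier) i t → wedge (v i) (wedges v) t ≈ 0#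
  wedges-absorb {suc r} v zero    t = wedge-square (v zero) _ t
  wedges-absorb {suc r} v (suc i) t = begin
    wedge (v (suc i)) (wedge (v zero) (wedges (v ∘ suc))) t    ≈⟨ wedge-anticomm _ _ _ t ⟩
    - wedge (v zero) (wedge (v (suc i)) (wedges (v ∘ suc))) t  ≈⟨ -‿cong (δ-zero (λ {_} {s} _ → trans (*-congˡ (wedges-absorb (v ∘ suc) i s)) (zeroʳ _)) t) ⟩
    - 0#                                                       ≈⟨ +-identityˡ _ ⟨
    0# - 0#                                                    ≈⟨ -‿inverseʳ 0# ⟩
    0#                                                         ∎

  wedge-∑ : ∀ {r n q} (x : Fin r → Carrier) (v : Fin r → Fin n → Carrier) (ω : Sub n q → Carrier) t →
            wedge (λ l → sum λ i → x i * v i l) ω t ≈ sum λ i → x i * wedge (v i) ω t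
  wedge-∑ x v ω t = begin
    wedge (λ l → sum λ i → x i * v i l) ω t           ≈⟨ δ-cong (λ k s → trans (*-distribʳ-sum (ω s) (λ i → x i * v i k)) (sum-cong-≋ λ i → *-assoc (x i) (v i k) (ω s))) t ⟩
    δ (λ k s → sum λ i → x i * (v i k * ω s)) t       ≈⟨ δ-∑ (λ i k s → x i * (v i k * ω s)) t ⟩
    (sum λ i → δ (λ k s → x i * (v i k * ω s)) t)     ≈⟨ sum-cong-≋ (λ i → δ-* (x i) _ t) ⟩
    (sum λ i → x i * wedge (v i) ω t)                 ∎

  -- Wedging a vanishing combination with all vectors but the first leaves `x zero` times the whole
  -- product, because repeated factors are absorbed. Hence `x zero` is 0; the product of the
  -- remaining vectors is again nonzero, and the induction continues.
  wedges-independent : ∀ {r n} (v : Fin r → Fin n → Carrier) → Nonzero (wedges v) →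
                       ∀ (x : Fin r → Carrier) → (∀ l → (sum λ i → x i * v i l) ≈ 0#) → ∀ i → x i ≈ 0#
  wedges-independent {zero}  v nz x Σ≈0 ()
  wedges-independent {suc r} v nz x Σ≈0 = λ { zero → x₀≈0 ; (suc i) → wedges-independent (v ∘ suc)
      (λ w≈0 → nz (δ-zero λ {_} {s} _ → trans (*-congˡ (w≈0 s)) (zeroʳ _))) (x ∘ suc)
      (λ l → trans (sym (trans (+-congʳ (trans (*-congʳ x₀≈0) (zeroˡ _))) (+-identityˡ _))) (Σ≈0 l)) i }
    where
    x₀w≈0 : ∀ t → x zero * wedges v t ≈ 0#
    x₀w≈0 t = begin
      x zero * wedges v t
        ≈⟨ +-identityʳ _ ⟨
      x zero * wedges v t + 0#
        ≈⟨ +-congˡ (∑-zero (λ i → trans (*-congˡ (wedges-absorb (v ∘ suc) i t)) (zeroʳ _))) ⟨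
      (sum λ i → x i * wedge (v i) (wedges (v ∘ suc)) t)
        ≈⟨ wedge-∑ x v _ t ⟨
      wedge (λ l → sum λ i → x i * v i l) (wedges (v ∘ suc)) t
        ≈⟨ δ-zero (λ {k} _ → trans (*-congʳ (Σ≈0 k)) (zeroˡ _)) t ⟩
      0# ∎
    x₀≈0 : x zero ≈ 0#
    x₀≈0 = by-cases (x zero ≈ 0#) id λ x₀≉0 → contradiction (λ t → cancel x₀≉0 (x₀w≈0 t)) nz

  wedges-skip : ∀ {r n} (v : Fin r → Fin (suc n) → Carrier) s → wedges v (skip s) ≈ wedges (λ i → v i ∘ suc) s
  wedges-skip {zero}  v s = refl
  wedges-skip {suc r} v s = wedge-cong (λ _ → refl) (wedges-skip (v ∘ suc)) s

  1≉0 : ¬ (1# ≈ 0#)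
  1≉0 h = char0 0 (trans (+-identityʳ 1#) h)

  full : ∀ n → Sub n n
  full zero    = nil
  full (suc n) = take (full n)

  wedges-Δ : ∀ n → wedges (Δ {n}) (full n) ≈ 1#
  wedges-Δ zero          = refl
  wedges-Δ (suc zero)    = *-identityˡ 1#
  wedges-Δ (suc (suc n)) = begin
    1# * wedges (λ i → Δ (suc i)) (skip (full (suc n))) - wedge (λ _ → 0#) _ (full (suc n))
      ≈⟨ minus-zero (δ-zero (λ _ → zeroˡ _) (full (suc n))) ⟩
    1# * wedges (λ i → Δ (suc i)) (skip (full (suc n)))   ≈⟨ *-identityˡ _ ⟩
    wedges (λ i → Δ (suc i)) (skip (full (suc n)))        ≈⟨ wedges-skip (λ i → Δ (suc i)) (full (suc n)) ⟩
    wedges (Δ {suc n}) (full (suc n))                     ≈⟨ wedges-Δ (suc n) ⟩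
    1#                                                    ∎

  wedges-map-cong : ∀ {V r n} (L : Fin r → LinearMap V (Fin n)) → Congruent (λ x → wedges (λ i → ⟦ L i ⟧ x))
  wedges-map-cong L x≈y = wedges-cong λ i → LinearMap.cong (L i) x≈y

  degree-wedges : ∀ {V r n} (L : Fin r → LinearMap V (Fin n)) → Degree< (suc r) (λ x → wedges (λ i → ⟦ L i ⟧ x))
  degree-wedges {r = zero}  L h = Level.lift λ x j → -‿inverseʳ 1#
  degree-wedges {r = suc r} L   = degree-wedge (suc r) (L zero) (wedges-map-cong (L ∘ suc)) (degree-wedges (L ∘ suc))

-- The Koszul map and two families of matrices on which it is injective.

module Koszul {c ℓ} (F : ClassicalField c ℓ) where

  open Polynomial F public
  open Exp semiring using (_^_)

  koszul : ∀ {r q n} → (Fin r → Fin n → Fin n → Carrier) → (Sub r q → Fin n → Carrier) → Sub r (suc q) → Fin n → Carrier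
  koszul X ω t i = δ (λ k s → sum λ j → X k i j * ω s j) t

  Injective : ∀ p {n} → (Fin (suc (2 ℕ.* p)) → Fin n → Fin n → Carrier) → Set _
  Injective p {n} X = ∀ (ω : Sub (suc (2 ℕ.* p)) p → Fin n → Carrier) →
                      (∀ t i → koszul X ω t i ≈ 0#) → ∀ s j → ω s j ≈ 0#

  matrix : ∀ {n} → (Fin n → Form (Fin n)) → Fin n → Fin n → Carrier
  matrix φ i j = app (φ i) (Δ j)

  matrix-apply : ∀ {n} (φ : Fin n → Form (Fin n)) i x → (sum λ j → matrix φ i j * x j) ≈ app (φ i) x
  matrix-apply {n} φ i x = sym (trans (unit-expansion (↔-id (Fin n)) (φ i) x) (sum-cong-≋ λ j → *-comm (x j) _))

  koszul-matrix : ∀ {r q n} (φ : Fin r → Fin n → Form (Fin n)) (ω : Sub r q → Fin n → Carrier) t i →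
                  koszul (matrix ∘ φ) ω t i ≈ δ (λ k s → app (φ k i) (ω s)) t
  koszul-matrix φ ω t i = δ-cong (λ k s → matrix-apply (φ k) i (ω s)) t

  Distinct : ∀ {n} → (Fin n → Carrier) → Set ℓ
  Distinct x = ∀ {k l} → x k ≈ x l → k ≡ l

  tail-distinct : ∀ {n} {x : Fin (suc n) → Carrier} → Distinct x → Distinct (x ∘ suc)
  tail-distinct x-distinct eq = Fin.suc-injective (x-distinct eq)

  difference≉0 : ∀ {n} {x : Fin n → Carrier} → Distinct x → ∀ {k l} → ¬ (k ≡ l) → ¬ (x k - x l ≈ 0#)
  difference≉0 x-distinct k≢l eq = k≢l (x-distinct (x-y≈0⇒x≈y eq))

  mutual

    -- For each fixed `t` this is a Vandermonde system: q+1 moments, distinct nodes, and, up to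
    -- sign, one unknown for each of the q+1 elements of `t`. Treating all `t` together lets the
    -- induction follow the subsets, with no determinant.
    vandermonde : ∀ {n q} {x : Fin n → Carrier} → Distinct x → (f : Fin n → Sub n q → Carrier) →
                  (∀ i → i ℕ.≤ q → ∀ t → δ (λ k s → x k ^ i * f k s) t ≈ 0#) →
                  ∀ {k s} → k ∉ s → f k s ≈ 0#
    vandermonde d f h (skip k∉s) = vandermonde (tail-distinct d) (λ k s → f (suc k) (skip s)) (λ i i≤q t → h i i≤q (skip t)) k∉s
    vandermonde d f h (take k∉s) = vandermonde-take d f h k∉s
    vandermonde {q = zero}      d f h (here {s = s}) = trans (sym (*-identityˡ _)) (h 0 ℕ.z≤n (take s))
    vandermonde {q = suc q} {x} d f h (here {s = s}) = begin
      f zero (skip s)             ≈⟨ *-identityˡ _ ⟨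
      1# * f zero (skip s)        ≈⟨ minus-zero (δ-zero (λ k∉s → trans (*-identityˡ _) (vandermonde-take d f h k∉s)) s) ⟨
      1# * f zero (skip s) - δ (λ k s → 1# * f (suc k) (take s)) s ≈⟨ h 0 ℕ.z≤n (take s) ⟩
      0#                          ∎

    -- Multiplication of f k s by x k - x zero removes x zero and lowers the number of moments by one.
    vandermonde-take : ∀ {n q} {x : Fin (suc n) → Carrier} → Distinct x → (f : Fin (suc n) → Sub (suc n) (suc q) → Carrier) →
                       (∀ i → i ℕ.≤ suc q → ∀ t → δ (λ k s → x k ^ i * f k s) t ≈ 0#) →
                       ∀ {k s} → k ∉ s → f (suc k) (take s) ≈ 0#
    vandermonde-take {n} {q} {x} d f h k∉s = cancel (difference≉0 d λ ()) (vandermonde (tail-distinct d) g moments k∉s)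
      where
      g : Fin n → Sub n q → Carrier
      g k s = (x (suc k) - x zero) * f (suc k) (take s)
      moments : ∀ i → i ℕ.≤ q → ∀ t → δ (λ k s → x (suc k) ^ i * g k s) t ≈ 0#
      moments i i≤q t = begin
        δ (λ k s → x (suc k) ^ i * g k s) t
          ≈⟨ δ-cong (λ k s → solve 4 (λ a b e y → e :* ((a :- b) :* y) := (a :* e) :* y :+ (:- b) :* (e :* y)) refl (x (suc k)) (x zero) (x (suc k) ^ i) _) t ⟩
        δ (λ k s → x (suc k) ^ suc i * f (suc k) (take s) + (- x zero) * (x (suc k) ^ i * f (suc k) (take s))) t
          ≈⟨ δ-linear _ _ _ t ⟩
        δ (λ k s → x (suc k) ^ suc i * f (suc k) (take s)) t + (- x zero) * δ (λ k s → x (suc k) ^ i * f (suc k) (take s)) t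
          ≈⟨ +-cong (sym (x-y≈0⇒x≈y (h (suc i) (ℕ.s≤s i≤q) (take t)))) (*-congˡ (sym (x-y≈0⇒x≈y (h i (ℕ.m≤n⇒m≤1+n i≤q) (take t))))) ⟩
        x zero ^ suc i * f zero (skip t) + (- x zero) * (x zero ^ i * f zero (skip t))
          ≈⟨ solve 3 (λ b e y → (b :* e) :* y :+ (:- b) :* (e :* y) := y :- y) refl (x zero) _ _ ⟩
        f zero (skip t) - f zero (skip t)
          ≈⟨ -‿inverseʳ _ ⟩
        0# ∎

  eval : ∀ {d} → (Fin d → Carrier) → Carrier → Carrier
  eval {zero}  c x = 0#
  eval {suc d} c x = c zero + x * eval (c ∘ suc) x

  eval-cong : ∀ {d} {b c : Fin d → Carrier} → (∀ i → b i ≈ c i) → ∀ x → eval b x ≈ eval c x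
  eval-cong {zero}  b≈c x = refl
  eval-cong {suc d} b≈c x = +-cong (b≈c zero) (*-congˡ (eval-cong (b≈c ∘ suc) x))

  eval-linear : ∀ {d} (b : Fin d → Carrier) k c x → eval (λ i → b i + k * c i) x ≈ eval b x + k * eval c x
  eval-linear {zero}  b k c x = sym (trans (+-identityˡ _) (zeroʳ _))
  eval-linear {suc d} b k c x = trans (+-congˡ (*-congˡ (eval-linear (b ∘ suc) k (c ∘ suc) x)))
    (solve 6 (λ b k c x p q → b :+ k :* c :+ x :* (p :+ k :* q) := b :+ x :* p :+ k :* (c :+ x :* q)) refl _ _ _ _ _ _)

  -- Synthetic division by x - x₀. Polynomials are coefficient vectors here, so the last component
  -- is required to return from a zero remainder and a zero quotient to zero coefficients.
  divide : ∀ {d} (c : Fin (suc d) → Carrier) x₀ → ∃ λ (g : Fin d → Carrier) →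
           (∀ x → eval c x ≈ eval c x₀ + (x - x₀) * eval g x) ×
           (eval c x₀ ≈ 0# → (∀ i → g i ≈ 0#) → ∀ i → c i ≈ 0#)
  divide {zero} c x₀ = (λ ())
    , (λ x → solve 4 (λ a x y z → a :+ x :* z := a :+ y :* z :+ (x :- y) :* z) refl (c zero) x x₀ 0#)
    , λ { c≈0 _ zero → trans (sym (trans (+-congˡ (zeroʳ _)) (+-identityʳ _))) c≈0 }
  divide {suc d} c x₀ with divide (c ∘ suc) x₀
  ... | g , g-quotient , g-zero = g⁺
    , (λ x → trans (+-congˡ (*-congˡ (g-quotient x)))
        (solve 5 (λ a x y e g → a :+ x :* (e :+ (x :- y) :* g) := a :+ y :* e :+ (x :- y) :* (e :+ x :* g)) refl (c zero) x x₀ _ _))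
    , λ { c≈0 g⁺≈0 zero    → trans (sym (trans (+-congˡ (trans (*-congˡ (g⁺≈0 zero)) (zeroʳ _))) (+-identityʳ _))) c≈0
        ; c≈0 g⁺≈0 (suc i) → g-zero (g⁺≈0 zero) (g⁺≈0 ∘ suc) i }
    where
    g⁺ : Fin (suc d) → Carrier
    g⁺ zero    = eval (c ∘ suc) x₀
    g⁺ (suc i) = g i

  -- The points outside `s` number n - q = d, as many as the coefficients, and each of them divides
  -- out one linear factor.
  roots : ∀ {n q d} {x : Fin n → Carrier} → Distinct x → n ≡ q ℕ.+ d → (s : Sub n q) (c : Fin d → Carrier) →
          (∀ {k} → k ∉ s → eval c (x k) ≈ 0#) → ∀ i → c i ≈ 0#
  roots {d = suc d} x-distinct () nil c h i
  roots x-distinct eq (take s) c h i = roots (tail-distinct x-distinct) (ℕ.suc-injective eq) s c (λ k∉s → h (take k∉s)) i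
  roots {n = suc n} {q} {suc d} {x} x-distinct eq (skip s) c h i with divide c (x zero)
  ... | g , quotient , c-zero = c-zero (h here) (roots (tail-distinct x-distinct) (ℕ.suc-injective (≡.trans eq (ℕ.+-suc q d))) s g
    (λ {k} k∉s → cancel (difference≉0 x-distinct λ ()) (trans (sym (+-identityˡ _))
      (trans (+-congʳ (sym (h here))) (trans (sym (quotient (x (suc k)))) (h (skip k∉s))))))) i

  evalForm : ∀ {d} → Carrier → Form (Fin d)
  evalForm x = record { app = λ c → eval c x ; cong = λ b≈c → eval-cong b≈c x ; linear = λ b k c → eval-linear b k c x }

  scale : ∀ {I} → Carrier → Form I → Form I
  scale a φ = record
    { app    = λ x → a * app φ x
    ; cong   = λ x≈y → *-congˡ (Form.cong φ x≈y)
    ; linear = λ x k y → trans (*-congˡ (Form.linear φ x k y)) (solve 4 (λ a x k y → a :* (x :+ k :* y) := a :* x :+ k :* (a :* y)) refl _ _ _ _)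
    }

  natural : ∀ {n} → Fin n → Carrier
  natural k = toℕ k · 1#

  natural-distinct : ∀ {n} → Distinct (natural {n})
  natural-distinct eq = Fin.toℕ-injective (·-injective _ _ eq)

  -- In each block, X k = v vᵀ for the moment vector v of the point k.
  blockForm : ∀ {a p r} → Fin r → Fin a × Fin (suc p) → Form (Fin (a ℕ.* suc p))
  blockForm k (β , e) = scale (natural k ^ toℕ e) (pullback (combine β) (evalForm (natural k)))

  momentForm : ∀ {r} a p → Fin r → Fin (a ℕ.* suc p) → Form (Fin (a ℕ.* suc p))
  momentForm a p k i = blockForm k (remQuot {a} (suc p) i)

  -- Within a block, X k (ω s) is P(k) times the moment vector of k, where P has that block of ω s
  -- as coefficients. The p+1 rows of the block are the moments of orders 0 to p, so the Vandermonde
  -- argument gives P(k) = 0 for every k outside s. These are p+1 roots for p+1 coefficients.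
  moments-injective : ∀ a p → Injective p (λ k → matrix (momentForm a p k))
  moments-injective a p ω ω≈0 s j = ≡.subst (λ j → ω s j ≈ 0#) (Fin.combine-remQuot {a} (suc p) j)
    (roots natural-distinct 2p+1 s (ω s ∘ combine β) (vandermonde natural-distinct (λ k s → eval (ω s ∘ combine β) (natural k)) moments) _)
    where
    β : Fin a
    β = proj₁ (remQuot {a} (suc p) j)
    2p+1 : suc (2 ℕ.* p) ≡ p ℕ.+ suc p
    2p+1 = ≡.trans (≡.cong (λ m → suc (p ℕ.+ m)) (ℕ.+-identityʳ p)) (≡.sym (ℕ.+-suc p p))
    moments : ∀ e → e ℕ.≤ p → ∀ t → δ (λ k s → natural k ^ e * eval (ω s ∘ combine β) (natural k)) t ≈ 0#
    moments e e≤p t = trans (δ-cong (λ k s → reflexive (≡.sym (app-moment k s))) t)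
      (trans (sym (koszul-matrix (momentForm a p) ω t i)) (ω≈0 t i))
      where
      i : Fin (a ℕ.* suc p)
      i = combine β (fromℕ< (ℕ.s≤s e≤p))
      app-moment : ∀ k s → app (momentForm a p k i) (ω s) ≡ natural k ^ e * eval (ω s ∘ combine β) (natural k)
      app-moment k s = ≡.trans
        (≡.cong (λ z → app (blockForm k z) (ω s)) (Fin.remQuot-combine β (fromℕ< (ℕ.s≤s e≤p))))
        (≡.cong (λ e → natural k ^ e * eval (ω s ∘ combine β) (natural k)) (Fin.toℕ-fromℕ< (ℕ.s≤s e≤p)))

  coordinate : ∀ {I} → I → Form I
  coordinate i = record { app = λ x → x i ; cong = λ x≈y → x≈y i ; linear = λ _ _ _ → refl }

  rotate : ∀ {n} → Fin n → Fin n
  rotate {suc n} zero    = fromℕ n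
  rotate {suc n} (suc i) = inject₁ i

  rotate-surjective : ∀ {n} (j : Fin n) → ∃ λ i → rotate i ≡ j
  rotate-surjective {suc n} j with view j
  ... | ‵fromℕ     = zero , ≡.refl
  ... | ‵inject₁ i = suc i , ≡.refl

  rotate-moves : ∀ {n} (i : Fin (suc (suc n))) → ¬ (i ≡ rotate i)
  rotate-moves zero    ()
  rotate-moves (suc i) eq = ℕ.1+n≢n (≡.trans (≡.cong toℕ eq) (Fin.toℕ-inject₁ i))

  -- The commutator of a diagonal matrix with distinct entries and a fixed-point free permutation matrix is invertible.
  commutatorForm : ∀ {n} → Fin 3 → Fin n → Form (Fin n)
  commutatorForm zero             i = coordinate i
  commutatorForm (suc zero)       i = scale (natural i) (coordinate i)
  commutatorForm (suc (suc zero)) i = coordinate (rotate i)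

  -- Since X₀ is the identity, the equations on {0,1} and {0,2} express ω₁ and ω₂ through ω₀. The
  -- equation on {1,2} then says that the commutator of X₁ and X₂ annihilates ω₀.
  commutator-injective : ∀ n → Injective 1 (λ k → matrix (commutatorForm {suc (suc n)} k))
  commutator-injective n ω ω≈0 = λ
    { (take (skip (skip nil))) j → ω₀≈0 j
    ; (skip (take (skip nil))) j → trans (e01 j) (trans (*-congˡ (ω₀≈0 j)) (zeroʳ _))
    ; (skip (skip (take nil))) j → trans (e02 j) (ω₀≈0 (rotate j))
    }
    where
    ω₀ = ω (take (skip (skip nil)))
    ω₁ = ω (skip (take (skip nil)))
    ω₂ = ω (skip (skip (take nil)))
    minor : ∀ t i → δ (λ k s → app (commutatorForm k i) (ω s)) t ≈ 0#
    minor t i = trans (sym (koszul-matrix commutatorForm ω t i)) (ω≈0 t i)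
    e01 : ∀ i → ω₁ i ≈ natural i * ω₀ i
    e01 i = x-y≈0⇒x≈y (minor (take (take (skip nil))) i)
    e02 : ∀ i → ω₂ i ≈ ω₀ (rotate i)
    e02 i = x-y≈0⇒x≈y (minor (take (skip (take nil))) i)
    e12 : ∀ i → natural i * ω₂ i ≈ ω₁ (rotate i)
    e12 i = x-y≈0⇒x≈y (minor (skip (take (take nil))) i)
    rotated : ∀ i → ω₀ (rotate i) ≈ 0#
    rotated i = cancel (difference≉0 natural-distinct (rotate-moves i)) (begin
      (natural i - natural (rotate i)) * ω₀ (rotate i)               ≈⟨ solve 3 (λ a b y → (a :- b) :* y := a :* y :- b :* y) refl _ _ _ ⟩
      natural i * ω₀ (rotate i) - natural (rotate i) * ω₀ (rotate i) ≈⟨ +-cong (*-congˡ (e02 i)) (-‿cong (e01 (rotate i))) ⟨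
      natural i * ω₂ i - ω₁ (rotate i)                               ≈⟨ +-congʳ (e12 i) ⟩
      ω₁ (rotate i) - ω₁ (rotate i)                                  ≈⟨ -‿inverseʳ _ ⟩
      0#                                                             ∎)
    ω₀≈0 : ∀ j → ω₀ j ≈ 0#
    ω₀≈0 j with rotate-surjective j
    ... | i , ≡.refl = rotated i

-- Counting subsets and terms.

abstract

  Sub↔ : ∀ n q → Sub n q ↔ Fin (n C q)
  Sub↔ zero    zero    = mk↔ₛ′ (λ _ → zero) (λ _ → nil) (λ { zero → ≡.refl }) (λ { nil → ≡.refl })
  Sub↔ zero    (suc q) = mk↔ₛ′ (λ ()) (λ ()) (λ ()) (λ ())
  Sub↔ (suc n) zero    = mk↔ₛ′ (λ _ → zero) (λ _ → empty (suc n)) (λ { zero → ≡.refl }) unique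
    where
    empty : ∀ n → Sub n 0
    empty zero    = nil
    empty (suc n) = skip (empty n)
    unique : ∀ {n} (s : Sub n 0) → empty n ≡ s
    unique nil      = ≡.refl
    unique (skip s) = ≡.cong skip (unique s)
  Sub↔ (suc n) (suc q) = ≡.subst (λ N → Sub (suc n) (suc q) ↔ Fin N) (nCk+nC[k+1]≡[n+1]C[k+1] n q)
    (↔-sym Fin.+↔⊎ ↔-∘ ((Sub↔ n q ⊎-↔ Sub↔ n (suc q)) ↔-∘ split))
    where
    split : Sub (suc n) (suc q) ↔ (Sub n q ⊎ Sub n (suc q))
    split = mk↔ₛ′ (λ { (take s) → inj₁ s ; (skip s) → inj₂ s }) (λ { (inj₁ s) → take s ; (inj₂ s) → skip s })
      (λ { (inj₁ s) → ≡.refl ; (inj₂ s) → ≡.refl }) (λ { (take s) → ≡.refl ; (skip s) → ≡.refl })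

  ×↔ : ∀ {A B : Set} {M N} → A ↔ Fin M → B ↔ Fin N → (A × B) ↔ Fin (M ℕ.* N)
  ×↔ A↔ B↔ = ↔-sym Fin.*↔× ↔-∘ (A↔ ×-↔ B↔)

count-∖ : ∀ {n} (D S : Fin n → Bool) → count D ℕ.≤ count (λ i → D i ∧ not (S i)) ℕ.+ count S
count-∖ {zero}  D S = ℕ.z≤n
count-∖ {suc n} D S with D zero | S zero
... | false | false = count-∖ (D ∘ suc) (S ∘ suc)
... | false | true  = ℕ.≤-trans (ℕ.m≤n⇒m≤1+n (count-∖ (D ∘ suc) (S ∘ suc))) (ℕ.≤-reflexive (≡.sym (ℕ.+-suc _ _)))
... | true  | false = ℕ.s≤s (count-∖ (D ∘ suc) (S ∘ suc))
... | true  | true  = ℕ.≤-trans (ℕ.s≤s (count-∖ (D ∘ suc) (S ∘ suc))) (ℕ.≤-reflexive (≡.sym (ℕ.+-suc _ _)))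

-- Of N selected forms at most M are kept, so at least N - M of the r terms are dead and k remain.
-- Everything is written additively to avoid truncated subtraction.
surplus : ∀ {n k r N M} (D S : Fin n → Bool) → count (λ i → D i ∧ not (S i)) ℕ.+ k ≡ r →
          count D ≡ N → count S ℕ.≤ M → k ℕ.+ N ℕ.≤ r ℕ.+ M
surplus {k = k} {M = M} D S ≡.refl ≡.refl S≤M = begin
  k ℕ.+ count D                ≤⟨ ℕ.+-monoʳ-≤ k (count-∖ D S) ⟩
  k ℕ.+ (D∖S ℕ.+ count S)      ≡⟨ ℕ.+-assoc k D∖S (count S) ⟨
  k ℕ.+ D∖S ℕ.+ count S        ≡⟨ ≡.cong (ℕ._+ count S) (ℕ.+-comm k D∖S) ⟩
  D∖S ℕ.+ k ℕ.+ count S        ≤⟨ ℕ.+-monoʳ-≤ (D∖S ℕ.+ k) S≤M ⟩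
  D∖S ℕ.+ k ℕ.+ M              ∎
  where
  open ℕ.≤-Reasoning
  D∖S = count (λ i → D i ∧ not (S i))

-- Decompositions of the trilinear form, substitution and the flattening bound.

module Trilinear {c ℓ} (F : ClassicalField c ℓ) where

  open Koszul F public

  record Pruning {r} (dead : Fin r → Bool) : Set (c ⊔ ℓ) where
    field
      size  : ℕ
      total : count dead ℕ.+ size ≡ r
      live  : Fin size → Fin r
      prune : ∀ g → (∀ i → dead i ≡ true → g i ≈ 0#) → sum g ≈ sum (g ∘ live)

  pruning : ∀ {r} (dead : Fin r → Bool) → Pruning dead
  pruning {zero}  dead = record { size = 0 ; total = ≡.refl ; live = λ () ; prune = λ g _ → refl }
  pruning {suc r} dead with dead zero in eq | pruning (dead ∘ suc)
  ... | true  | P = record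
    { size  = size
    ; total = ≡.trans (≡.cong (λ b → (if b then 1 else 0) ℕ.+ count (dead ∘ suc) ℕ.+ size) eq) (≡.cong suc total)
    ; live  = suc ∘ live
    ; prune = λ g g≈0 → trans (+-congʳ (g≈0 zero eq)) (trans (+-identityˡ _) (prune (g ∘ suc) (g≈0 ∘ suc)))
    } where open Pruning P
  ... | false | P = record
    { size  = suc size
    ; total = ≡.trans (≡.cong (λ b → (if b then 1 else 0) ℕ.+ count (dead ∘ suc) ℕ.+ suc size) eq) (≡.trans (ℕ.+-suc _ size) (≡.cong suc total))
    ; live  = λ { zero → zero ; (suc i) → suc (live i) }
    ; prune = λ g g≈0 → +-congˡ (prune (g ∘ suc) (g≈0 ∘ suc))
    } where open Pruning P

  precompose : ∀ {I J : Set} → Form J → (J → Form I) → Form I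
  precompose φ L = record
    { app    = λ x → app φ (λ j → app (L j) x)
    ; cong   = λ x≈y → Form.cong φ (λ j → Form.cong (L j) x≈y)
    ; linear = λ x k y → trans (Form.cong φ (λ j → Form.linear (L j) x k y)) (Form.linear φ _ k _)
    }

  residualForm : ∀ {I r} → Form I → (Fin r → Form I) → (Fin r → Carrier) → Form I
  residualForm φ ψ e = record
    { app    = λ x → app φ x - sum λ j → app (ψ j) x * e j
    ; cong   = λ x≈y → +-cong (Form.cong φ x≈y) (-‿cong (sum-cong-≋ λ j → *-congʳ (Form.cong (ψ j) x≈y)))
    ; linear = λ x k y → trans
        (+-cong (Form.linear φ x k y) (-‿cong (trans
          (sum-cong-≋ λ j → trans (*-congʳ (Form.linear (ψ j) x k y)) (solve 4 (λ a k b e → (a :+ k :* b) :* e := a :* e :+ k :* (b :* e)) refl _ _ _ _))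
          (trans (∑-distrib-+ (λ j → app (ψ j) x * e j) _) (+-congˡ (sym (*-distribˡ-sum k (λ j → app (ψ j) y * e j))))))))
        (solve 5 (λ a k b p q → (a :+ k :* b) :- (p :+ k :* q) := (a :- p) :+ k :* (b :- q)) refl _ _ _ _ _)
    }

  τ : ∀ {n k m} → (Fin n × Fin k → Carrier) → (Fin k × Fin m → Carrier) → (Fin n × Fin m → Carrier) → Carrier
  τ x y z = sum λ a → sum λ b → x (a , b) * sum λ c → y (b , c) * z (a , c)

  -- The matrix multiplication tensor is kept as the trilinear form
  -- trace (X Y Zᵀ), in which the roles of Y and Z can be exchanged.
  record Decomposes n k m r : Set (c ⊔ ℓ) where
    field
      u : Fin r → Form (Fin n × Fin k)
      v : Fin r → Form (Fin k × Fin m)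
      w : Fin r → Form (Fin n × Fin m)
      decomposes : ∀ x y z → τ x y z ≈ sum λ i → app (u i) x * (app (v i) y * app (w i) z)

  τ-entry : ∀ {n k m} (x : Fin n × Fin k → Carrier) (y : Fin k × Fin m → Carrier) a c →
            τ x y (λ (a′ , c′) → Δ a a′ * Δ c′ c) ≈ sum λ b → x (a , b) * y (b , c)
  τ-entry x y a c = begin
    τ x y (λ (a′ , c′) → Δ a a′ * Δ c′ c)
      ≈⟨ sum-cong-≋ (λ a′ → trans (sum-cong-≋ (λ b → trans (*-congˡ (begin
           (sum λ c′ → y (b , c′) * (Δ a a′ * Δ c′ c))   ≈⟨ sum-cong-≋ (λ c′ → sym (*-assoc (y (b , c′)) (Δ a a′) (Δ c′ c))) ⟩
           (sum λ c′ → (y (b , c′) * Δ a a′) * Δ c′ c)   ≈⟨ ∑-Δʳ c (λ c′ → y (b , c′) * Δ a a′) ⟩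
           y (b , c) * Δ a a′                            ∎))
         (solve 3 (λ x y d → x :* (y :* d) := d :* (x :* y)) refl (x (a′ , b)) (y (b , c)) (Δ a a′))))
         (sym (*-distribˡ-sum (Δ a a′) (λ b → x (a′ , b) * y (b , c))))) ⟩
    (sum λ a′ → Δ a a′ * sum λ b → x (a′ , b) * y (b , c))
      ≈⟨ ∑-Δˡ a (λ a′ → sum λ b → x (a′ , b) * y (b , c)) ⟩
    (sum λ b → x (a , b) * y (b , c)) ∎

  dot : ∀ {n m} → (Fin n × Fin m → Carrier) → Form (Fin n × Fin m)
  dot w = record
    { app    = λ z → sum λ a → sum λ c → w (a , c) * z (a , c)
    ; cong   = λ y≈z → sum-cong-≋ λ a → sum-cong-≋ λ c → *-congˡ {w (a , c)} (y≈z (a , c))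
    ; linear = λ y k z → trans
        (sum-cong-≋ λ a → trans
          (sum-cong-≋ λ c → solve 4 (λ w y k z → w :* (y :+ k :* z) := w :* y :+ k :* (w :* z)) refl (w (a , c)) (y (a , c)) k (z (a , c)))
          (trans (∑-distrib-+ (λ c → w (a , c) * y (a , c)) _) (+-congˡ (sym (*-distribˡ-sum k (λ c → w (a , c) * z (a , c)))))))
        (trans (∑-distrib-+ (λ a → sum λ c → w (a , c) * y (a , c)) _) (+-congˡ (sym (*-distribˡ-sum k (λ a → sum λ c → w (a , c) * z (a , c))))))
    }

  from-entries : ∀ {n k m r} (u : Fin r → Form (Fin n × Fin k)) (v : Fin r → Form (Fin k × Fin m)) (w : Fin r → Fin n × Fin m → Carrier) →
    (∀ x y a c → (sum λ b → x (a , b) * y (b , c)) ≈ sum λ i → (app (u i) x * app (v i) y) * w i (a , c)) →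
    Decomposes n k m r
  from-entries {n} {k} {m} {r} u v w entries = record
    { u = u
    ; v = v
    ; w = dot ∘ w
    ; decomposes = λ x y z → begin
        τ x y z
          ≈⟨ sum-cong-≋ (λ a → begin
               (sum λ b → x (a , b) * sum λ c → y (b , c) * z (a , c))
                 ≈⟨ sum-cong-≋ (λ b → trans (*-distribˡ-sum (x (a , b)) (λ c → y (b , c) * z (a , c)))
                      (sum-cong-≋ λ c → sym (*-assoc (x (a , b)) (y (b , c)) (z (a , c))))) ⟩
               (sum λ b → sum λ c → (x (a , b) * y (b , c)) * z (a , c))
                 ≈⟨ ∑-comm (λ b c → (x (a , b) * y (b , c)) * z (a , c)) ⟩
               (sum λ c → sum λ b → (x (a , b) * y (b , c)) * z (a , c))
                 ≈⟨ sum-cong-≋ (λ c → *-distribʳ-sum (z (a , c)) (λ b → x (a , b) * y (b , c))) ⟨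
               (sum λ c → (sum λ b → x (a , b) * y (b , c)) * z (a , c))
                 ≈⟨ sum-cong-≋ (λ c → trans (*-congʳ {z (a , c)} (entries x y a c)) (trans
                      (*-distribʳ-sum (z (a , c)) (λ i → (app (u i) x * app (v i) y) * w i (a , c)))
                      (sum-cong-≋ λ i → *-assoc (app (u i) x * app (v i) y) (w i (a , c)) (z (a , c))))) ⟩
               (sum λ c → sum λ i → (app (u i) x * app (v i) y) * (w i (a , c) * z (a , c)))
                 ≈⟨ ∑-comm (λ c i → (app (u i) x * app (v i) y) * (w i (a , c) * z (a , c))) ⟩
               (sum λ i → sum λ c → (app (u i) x * app (v i) y) * (w i (a , c) * z (a , c)))
                 ≈⟨ sum-cong-≋ (λ i → *-distribˡ-sum (app (u i) x * app (v i) y) (λ c → w i (a , c) * z (a , c))) ⟨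
               (sum λ i → (app (u i) x * app (v i) y) * sum λ c → w i (a , c) * z (a , c)) ∎) ⟩
        (sum λ a → sum λ i → (app (u i) x * app (v i) y) * sum λ c → w i (a , c) * z (a , c))
          ≈⟨ ∑-comm (λ a i → (app (u i) x * app (v i) y) * sum λ c → w i (a , c) * z (a , c)) ⟩
        (sum λ i → sum λ a → (app (u i) x * app (v i) y) * sum λ c → w i (a , c) * z (a , c))
          ≈⟨ sum-cong-≋ (λ i → trans
               (sym (*-distribˡ-sum (app (u i) x * app (v i) y) (λ a → sum λ c → w i (a , c) * z (a , c))))
               (*-assoc (app (u i) x) (app (v i) y) (app (dot (w i)) z))) ⟩
        (sum λ i → app (u i) x * (app (v i) y * app (dot (w i)) z)) ∎
    }

  -- This is trace (X Y Zᵀ) = trace (Xᵀ Z Yᵀ). It turns rows of X into columns, so that `reduce` can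
  -- remove either.
  transposed : ∀ {n k m r} → Decomposes n k m r → Decomposes k n m r
  transposed {n} {k} {m} D = record
    { u = λ i → pullback swap (u i)
    ; v = w
    ; w = v
    ; decomposes = λ x y z → begin
        τ x y z
          ≈⟨ ∑-comm (λ b a → x (b , a) * sum λ c → y (a , c) * z (b , c)) ⟩
        (sum λ a → sum λ b → x (b , a) * sum λ c → y (a , c) * z (b , c))
          ≈⟨ sum-cong-≋ (λ a → sum-cong-≋ λ b → *-congˡ {x (b , a)} (sum-cong-≋ λ c → *-comm (y (a , c)) (z (b , c)))) ⟩
        τ (x ∘ swap) z y
          ≈⟨ decomposes (x ∘ swap) z y ⟩
        (sum λ i → app (u i) (x ∘ swap) * (app (v i) z * app (w i) y))
          ≈⟨ sum-cong-≋ (λ i → *-congˡ {app (u i) (x ∘ swap)} (*-comm (app (v i) z) (app (w i) y))) ⟩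
        (sum λ i → app (u i) (x ∘ swap) * (app (w i) y * app (v i) z)) ∎
    }
    where open Decomposes D

  -- The forms v separate the matrices Y supported on the first row, so
  -- that row can be chosen to annihilate m of them; X with vanishing first
  -- column does not notice.
  reduce : ∀ {n k m r} → Decomposes (suc n) (suc k) m r → ¬ ¬ ∃ λ r′ → m ℕ.+ r′ ≡ r × Decomposes (suc n) k m r′
  reduce {n} {k} {m} {r} D = do
    E ← dualSystem vtop
    return (reduced E)
    where
    open Decomposes D
    top : Fin (suc k) × Fin m → Form (Fin m)
    top (zero  , c) = coordinate c
    top (suc b , c) = zeroForm
    vtop : Fin r → Form (Fin m)
    vtop i = precompose (v i) top
    separating : Separating vtop
    separating y v≈0 c = begin
      y c                                                                   ≈⟨ ∑-Δˡ zero (λ b → app (top (b , c)) y) ⟨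
      (sum λ b → Δ zero b * app (top (b , c)) y)                            ≈⟨ τ-entry {n = suc n} (λ (a , b) → Δ zero b) (λ bc → app (top bc) y) zero c ⟨
      τ (λ (a , b) → Δ zero b) (λ bc → app (top bc) y) e                    ≈⟨ decomposes _ _ _ ⟩
      (sum λ i → app (u i) (λ (a , b) → Δ zero b) * (app (vtop i) y * app (w i) e)) ≈⟨ ∑-zero (λ i → trans (*-congˡ (trans (*-congʳ (v≈0 i)) (zeroˡ _))) (zeroʳ _)) ⟩
      0#                                                                    ∎
      where
      e : Fin (suc n) × Fin m → Carrier
      e (a , c′) = Δ zero a * Δ c′ c
    padˣ : Fin (suc n) × Fin (suc k) → Form (Fin (suc n) × Fin k)
    padˣ (a , zero)  = zeroForm
    padˣ (a , suc b) = coordinate (a , b)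
    padʸ : Fin (suc k) × Fin m → Form (Fin k × Fin m)
    padʸ (zero  , c) = zeroForm
    padʸ (suc b , c) = coordinate (b , c)
    reduced : DualSystem vtop → ∃ λ r′ → m ℕ.+ r′ ≡ r × Decomposes (suc n) k m r′
    reduced E = size , ≡.trans (≡.cong (ℕ._+ size) (≡.sym (count-selected E separating (↔-id (Fin m))))) total , record
      { u = λ i → precompose (u (live i)) padˣ
      ; v = λ i → precompose (v (live i)) fill
      ; w = w ∘ live
      ; decomposes = λ x y z → begin
          τ x y z
            ≈⟨ sum-cong-≋ (λ a → trans (sum-cong-≋ λ b → *-congˡ {x (a , b)} (sum-cong-≋ λ c → *-congʳ {z (a , c)} (filled y b c)))
                 (sym (trans (+-congʳ (zeroˡ (sum λ c → app (fill (zero , c)) y * z (a , c)))) (+-identityˡ _)))) ⟩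
          τ (λ ab → app (padˣ ab) x) (λ bc → app (fill bc) y) z
            ≈⟨ decomposes _ _ _ ⟩
          (sum λ i → app (precompose (u i) padˣ) x * (app (precompose (v i) fill) y * app (w i) z))
            ≈⟨ prune _ (λ i i∈ → trans (*-congˡ (trans (*-congʳ (annihilated i y i∈)) (zeroˡ _))) (zeroʳ _)) ⟩
          (sum λ i → app (precompose (u (live i)) padˣ) x * (app (precompose (v (live i)) fill) y * app (w (live i)) z)) ∎
      }
      where
      open DualSystem E
      open Pruning (pruning selected)
      -- The zero-padded y loses its components along the dual vectors. The correction lies in the
      -- first row because `top` does, and the selected `v i` vanish on the result.
      fill : Fin (suc k) × Fin m → Form (Fin k × Fin m)
      fill bc = residualForm (padʸ bc) (λ j → precompose (v j) padʸ) (λ j → app (top bc) (e j))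
      filled : ∀ y b c → y (b , c) ≈ app (fill (suc b , c)) y
      filled y b c = sym (minus-zero (∑-zero λ j → zeroʳ (app (precompose (v j) padʸ) y)))
      annihilated : ∀ i y → selected i ≡ true → app (precompose (v i) fill) y ≈ 0#
      annihilated i y i∈ = begin
        app (v i) (λ bc → app (fill bc) y)
          ≈⟨ Form.residual-homo (v i) _ (λ j → app (precompose (v j) padʸ) y) _ ⟩
        s i - (sum λ j → s j * app (vtop i) (e j))  ≈⟨ +-congˡ (-‿cong (sum-cong-≋ λ j → *-congˡ {s j} (trans (dual i j i∈) (reflexive (Δ-sym i j))))) ⟩
        s i - (sum λ j → s j * Δ j i)               ≈⟨ +-congˡ (-‿cong (∑-Δʳ i s)) ⟩
        s i - s i                                   ≈⟨ -‿inverseʳ _ ⟩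
        0#                                          ∎
        where
        s : Fin r → Carrier
        s j = app (precompose (v j) padʸ) y

  reduce* : ∀ t {n k m r} → Decomposes (suc n) (t ℕ.+ k) m r → ¬ ¬ ∃ λ r′ → t ℕ.* m ℕ.+ r′ ≡ r × Decomposes (suc n) k m r′
  reduce* zero    D = return (_ , ≡.refl , D)
  reduce* (suc t) {m = m} D = do
    r₁ , eq₁ , D₁ ← reduce D
    r₂ , eq₂ , D₂ ← reduce* t D₁
    return (r₂ , ≡.trans (ℕ.+-assoc m (t ℕ.* m) r₂) (≡.trans (≡.cong (m ℕ.+_) eq₂) eq₁) , D₂)

  koszulForm : ∀ {r q n} → (Fin r → Fin n → Fin n → Carrier) → Sub r (suc q) × Fin n → Form (Sub r q × Fin n)
  koszulForm X (t , i) = record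
    { app    = λ ω → koszul X (curry ω) t i
    ; cong   = λ ω≈η → δ-cong (λ k s → sum-cong-≋ λ j → *-congˡ {X k i j} (ω≈η (s , j))) t
    ; linear = λ ω a η → trans (δ-cong (λ k s → begin
        (sum λ j → X k i j * (ω (s , j) + a * η (s , j)))
          ≈⟨ sum-cong-≋ (λ j → solve 4 (λ x w a y → x :* (w :+ a :* y) := x :* w :+ a :* (x :* y)) refl (X k i j) (ω (s , j)) a (η (s , j))) ⟩
        (sum λ j → X k i j * ω (s , j) + a * (X k i j * η (s , j)))
          ≈⟨ ∑-distrib-+ (λ j → X k i j * ω (s , j)) _ ⟩
        (sum λ j → X k i j * ω (s , j)) + (sum λ j → a * (X k i j * η (s , j)))
          ≈⟨ +-congˡ (*-distribˡ-sum a (λ j → X k i j * η (s , j))) ⟨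
        (sum λ j → X k i j * ω (s , j)) + a * (sum λ j → X k i j * η (s , j)) ∎) t) (δ-linear a _ _ t)
    }

  Matrices : ℕ → ℕ → Set
  Matrices r n = Fin r × (Fin n × Fin n)

  at : ∀ {r n} → (Matrices r n → Carrier) → Fin r → Fin n → Fin n → Carrier
  at x k i j = x (k , (i , j))

  koszul-additive : ∀ {r q n} (x h : Matrices r n → Carrier) ti (ω : Sub r q × Fin n → Carrier) →
                    app (koszulForm (at (x ⊞ h)) ti) ω ≈ app (koszulForm (at x) ti) ω + app (koszulForm (at h) ti) ω
  koszul-additive x h (t , i) ω = trans
    (δ-cong (λ k s → trans (sum-cong-≋ λ j → distribʳ (ω (s , j)) (at x k i j) (at h k i j)) (∑-distrib-+ (λ j → at x k i j * ω (s , j)) _)) t)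
    (δ-+ _ _ t)

  koszul-congˡ : ∀ {r q n} {x y : Matrices r n → Carrier} → (∀ v → x v ≈ y v) → ∀ ti (ω : Sub r q × Fin n → Carrier) →
                 app (koszulForm (at x) ti) ω ≈ app (koszulForm (at y) ti) ω
  koszul-congˡ x≈y (t , i) ω = δ-cong (λ k s → sum-cong-≋ λ j → *-congʳ {ω (s , j)} (x≈y (k , (i , j)))) t

  -- If the Koszul map is injective at Σ h, its determinant (normalised by a
  -- left inverse at that point) is a polynomial of degree M,
  -- hence it survives the restriction to a subsum of that length.
  injective-subsum : ∀ p {n r M M′} → (Sub (suc (2 ℕ.* p)) p × Fin n) ↔ Fin M → (Sub (suc (2 ℕ.* p)) (suc p) × Fin n) ↔ Fin M′ →
    (h : Fin r → Matrices (suc (2 ℕ.* p)) n → Carrier) → Injective p (at λ v → sum λ i → h i v) →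
    ¬ ¬ ∃ λ (S : Fin r → Bool) → count S ℕ.≤ M × Injective p (at λ v → 0# + sum λ i → if S i then h i v else 0#)
  injective-subsum p {n} {r} {M} {M′} source target h inj = do
    E ← dualSystem (f x₀)
    S , S≤ , nz ← selection M {g = determinant E} (wedges-map-cong (column E)) (degree-wedges (column E)) (λ _ → 0#) h (nonzero E)
    return (S , S≤ , injective E (λ v → 0# + sum λ i → if S i then h i v else 0#) nz)
    where
    open Inverse using (from; to)
    N = suc (2 ℕ.* p)
    Dom = Sub N p × Fin n
    x₀ : Matrices N n → Carrier
    x₀ v = sum λ i → h i v
    f : (Matrices N n → Carrier) → Fin M′ → Form Dom
    f x j = koszulForm (at x) (from target j)
    separating : Separating (f x₀)
    separating ω f≈0 (s , j) = inj (curry ω) (λ t i → ≡.subst (λ ti → app (koszulForm (at x₀) ti) ω ≈ 0#)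
      (Inverse.strictlyInverseʳ target (t , i)) (f≈0 (to target (t , i)))) s j
    module _ (E : DualSystem (f x₀)) where
      open DualSystem E
      -- The image of the l-th unit vector under the flattening of x followed by the left inverse
      -- taken at x₀. The matrix is thus square of size M, linear in x, and the identity at x₀.
      column : Fin M → LinearMap (Matrices N n) (Fin M)
      column l = record
        { ⟦_⟧      = λ x l′ → sum λ j → app (f x j) (unit source l) * e j (from source l′)
        ; cong     = λ x≈y l′ → sum-cong-≋ λ j → *-congʳ {e j (from source l′)} (koszul-congˡ x≈y (from target j) (unit source l))
        ; additive = λ x h l′ → trans
            (sum-cong-≋ λ j → trans (*-congʳ {e j (from source l′)} (koszul-additive x h (from target j) (unit source l))) (distribʳ (e j (from source l′)) (app (f x j) (unit source l)) (app (f h j) (unit source l))))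
            (∑-distrib-+ (λ j → app (f x j) (unit source l) * e j (from source l′)) _)
        }
      determinant : (Matrices N n → Carrier) → Sub M M → Carrier
      determinant x = wedges (λ l → ⟦ column l ⟧ x)
      nonzero : Nonzero (determinant (λ v → 0# + x₀ v))
      nonzero w≈0 = 1≉0 (begin
        1#                                                        ≈⟨ wedges-Δ M ⟨
        wedges Δ (full M)                                         ≈⟨ wedges-cong identity (full M) ⟩
        wedges (λ l → ⟦ column l ⟧ (λ v → 0# + x₀ v)) (full M)    ≈⟨ w≈0 (full M) ⟩
        0#                                                        ∎)
        where
        identity : ∀ l l′ → Δ l l′ ≈ ⟦ column l ⟧ (λ v → 0# + x₀ v) l′
        identity l l′ = begin
          Δ l l′                                       ≡⟨ ≡.cong (Δ l) (Inverse.strictlyInverseˡ source l′) ⟨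
          unit source l (from source l′)               ≈⟨ expansion E separating (unit source l) (from source l′) ⟩
          ⟦ column l ⟧ x₀ l′                           ≈⟨ LinearMap.cong (column l) (λ v → sym (+-identityˡ (x₀ v))) l′ ⟩
          ⟦ column l ⟧ (λ v → 0# + x₀ v) l′            ∎
      -- A kernel vector of the flattening is a linear relation among the vectors `⟦ column l ⟧ x`,
      -- which a nonzero determinant forbids.
      injective : ∀ x → Nonzero (determinant x) → Injective p (at x)
      injective x nz ω ω≈0 s j = ≡.subst (λ (s , j) → ω s j ≈ 0#) (Inverse.strictlyInverseʳ source (s , j))
        (wedges-independent (λ l → ⟦ column l ⟧ x) nz (η ∘ from source) vanishing (to source (s , j)))
        where
        η : Dom → Carrier
        η (s , j) = ω s j
        vanishing : ∀ l′ → (sum λ l → η (from source l) * ⟦ column l ⟧ x l′) ≈ 0#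
        vanishing l′ = begin
          (sum λ l → η (from source l) * sum λ j → app (f x j) (unit source l) * e j (from source l′))
            ≈⟨ sum-cong-≋ (λ l → trans (*-distribˡ-sum (η (from source l)) (λ j → app (f x j) (unit source l) * e j (from source l′)))
                 (sum-cong-≋ λ j → sym (*-assoc (η (from source l)) (app (f x j) (unit source l)) (e j (from source l′))))) ⟩
          (sum λ l → sum λ j → (η (from source l) * app (f x j) (unit source l)) * e j (from source l′))
            ≈⟨ ∑-comm (λ l j → (η (from source l) * app (f x j) (unit source l)) * e j (from source l′)) ⟩
          (sum λ j → sum λ l → (η (from source l) * app (f x j) (unit source l)) * e j (from source l′))
            ≈⟨ ∑-zero (λ j → trans (sym (*-distribʳ-sum (e j (from source l′)) (λ l → η (from source l) * app (f x j) (unit source l))))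
                 (trans (*-congʳ (trans (sym (unit-expansion source (f x j) η)) (ω≈0 (proj₁ (from target j)) (proj₂ (from target j))))) (zeroˡ _))) ⟩
          0# ∎

  -- The first inequality is a dimension count on families of n × (m+1) matrices Y indexed by
  -- p-subsets s. Each live term i contributes C(2p, p) forms: the detectors for the vector of
  -- values of `u i` on the 2p+1 matrices, applied to s ↦ v i (Y s). If all of them vanish, the
  -- flattening kills every column of Y, and injectivity gives Y = 0. The second inequality counts
  -- the dead terms.
  koszul-bound : ∀ p {n m r} → ∃ (Injective p {n}) → Decomposes n n (suc m) r →
    ¬ ¬ ∃ λ r′ → (suc (2 ℕ.* p) C p) ℕ.* (n ℕ.* suc m) ℕ.≤ r′ ℕ.* ((2 ℕ.* p) C p)
               × r′ ℕ.+ n ℕ.* n ℕ.≤ r ℕ.+ (suc (2 ℕ.* p) C p) ℕ.* n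
  koszul-bound p {n} {m} {r} (X , X-injective) D = do
    E ← dualSystem u
    S , S≤ , injective ← injective-subsum p (×↔ (Sub↔ N p) (↔-id (Fin n))) (×↔ (Sub↔ N (suc p)) (↔-id (Fin n))) (h E) (h-injective E)
    detect ← ¬¬-finite (λ i → detectors p (λ k → app (u (Pruning.live (alive E S) i)) (restricted E S k)))
    return (Pruning.size (alive E S)
      , dimension (test E S detect) (test-separating E S injective detect)
          (×↔ (Sub↔ N p) (×↔ (↔-id (Fin n)) (↔-id (Fin (suc m))))) (×↔ (↔-id (Fin (Pruning.size (alive E S)))) (Sub↔ (2 ℕ.* p) p))
      , surplus (DualSystem.selected E) S (Pruning.total (alive E S))
          (count-selected E u-separating (×↔ (↔-id (Fin n)) (↔-id (Fin n)))) S≤)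
    where
    open Decomposes D
    N = suc (2 ℕ.* p)
    flat : Fin N → Fin n × Fin n → Carrier
    flat k (a , b) = X k a b
    u-separating : Separating u
    u-separating x u≈0 (a , b) = begin
      x (a , b)                                     ≈⟨ ∑-Δʳ b (λ b′ → x (a , b′)) ⟨
      (sum λ b′ → x (a , b′) * Δ b′ b)              ≈⟨ τ-entry {m = suc m} x (λ (b′ , c) → Δ b′ b) a zero ⟨
      τ {m = suc m} x (λ (b′ , c) → Δ b′ b) e       ≈⟨ decomposes _ _ _ ⟩
      (sum λ i → app (u i) x * (app (v i) (λ (b′ , c) → Δ b′ b) * app (w i) e)) ≈⟨ ∑-zero (λ i → trans (*-congʳ (u≈0 i)) (zeroˡ _)) ⟩
      0#                                            ∎
      where
      e : Fin n × Fin (suc m) → Carrier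
      e (a′ , c) = Δ a a′ * Δ c zero
    module _ (E : DualSystem u) where
      open DualSystem E
      h : Fin r → Matrices N n → Carrier
      h i (k , ab) = app (u i) (flat k) * e i ab
      h-injective : Injective p (at λ v → sum λ i → h i v)
      h-injective ω ω≈0 = X-injective ω λ t a → trans
        (koszul-congˡ {x = λ (k , ab) → flat k ab} (λ (k , ab) → expansion E u-separating (flat k) ab) (t , a) (λ (s , j) → ω s j)) (ω≈0 t a)
      module _ (S : Fin r → Bool) where
        restricted : Fin N → Fin n × Fin n → Carrier
        restricted k ab = 0# + sum λ i → if S i then h i (k , ab) else 0#
        dead : Fin r → Bool
        dead i = selected i ∧ not (S i)
        alive : Pruning dead
        alive = pruning dead
        open Pruning alive
        -- By duality a selected `u i` reads off the coefficient of `e i`, which is absent when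
        -- `S i` is false.
        dead-vanishes : ∀ i k → dead i ≡ true → app (u i) (restricted k) ≈ 0#
        dead-vanishes i k i∈ = begin
          app (u i) (restricted k)
            ≈⟨ Form.cong (u i) (λ ab → trans (+-identityˡ _) (sum-cong-≋ λ j → choose (S j))) ⟩
          app (u i) (λ ab → sum λ j → coefficient j * e j ab)
            ≈⟨ Form.∑-homo (u i) coefficient e ⟩
          (sum λ j → coefficient j * app (u i) (e j))
            ≈⟨ sum-cong-≋ (λ j → *-congˡ {coefficient j} (trans (dual i j (proj₁ (both (selected i) (S i) i∈))) (reflexive (Δ-sym i j)))) ⟩
          (sum λ j → coefficient j * Δ j i)
            ≈⟨ ∑-Δʳ i coefficient ⟩
          coefficient i
            ≡⟨ ≡.cong (if_then app (u i) (flat k) else 0#) (proj₂ (both (selected i) (S i) i∈)) ⟩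
          0# ∎
          where
          coefficient : Fin r → Carrier
          coefficient j = if S j then app (u j) (flat k) else 0#
          choose : ∀ s {x y} → (if s then x * y else 0#) ≈ (if s then x else 0#) * y
          choose true  = refl
          choose false = sym (zeroˡ _)
          both : ∀ s t → s ∧ not t ≡ true → s ≡ true × t ≡ false
          both true false _ = ≡.refl , ≡.refl
        Detector : Fin size → Set _
        Detector i = ∃ λ (g : Sub (2 ℕ.* p) p → Form (Sub N p)) → Detects (λ k → app (u (live i)) (restricted k)) g
        module _ (detect : ∀ i → Detector i) where
          test : Fin size × Sub (2 ℕ.* p) p → Form (Sub N p × (Fin n × Fin (suc m)))
          test (i , s) = precompose (proj₁ (detect i) s) (λ s′ → pullback (s′ ,_) (v (live i)))
        test-separating : Injective p (at λ (k , ab) → restricted k ab) → ∀ detect → Separating (test detect)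
        test-separating injective detect ω test≈0 (s , (b , c)) = injective (λ s b → ω (s , (b , c))) vanishing s b
          where
          -- By the decomposition each live term contributes a scalar multiple of the wedge of its
          -- values on the matrices with its values on the components of ω, and the detectors make
          -- all these wedges zero.
          vanishing : ∀ t a → koszul (at λ (k , ab) → restricted k ab) (λ s b → ω (s , (b , c))) t a ≈ 0#
          vanishing t a = begin
            δ (λ k s → sum λ b → restricted k (a , b) * ω (s , (b , c))) t
              ≈⟨ δ-cong (λ k s → trans (sym (τ-entry (restricted k) (λ bc → ω (s , bc)) a c)) (trans (decomposes _ _ _)
                   (trans (prune _ (λ i i∈ → trans (*-congʳ (dead-vanishes i k i∈)) (zeroˡ _)))
                   (sum-cong-≋ λ i → solve 3 (λ u v w → u :* (v :* w) := w :* (u :* v)) refl (U i k) (V i s) (app (w (live i)) entry))))) t ⟩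
            δ (λ k s → sum λ i → app (w (live i)) entry * (U i k * V i s)) t
              ≈⟨ δ-∑ (λ i k s → app (w (live i)) entry * (U i k * V i s)) t ⟩
            (sum λ i → δ (λ k s → app (w (live i)) entry * (U i k * V i s)) t)
              ≈⟨ ∑-zero (λ i → trans (δ-* (app (w (live i)) entry) _ t) (trans (*-congˡ (proj₂ (detect i) (V i) (λ s → test≈0 (i , s)) t)) (zeroʳ _))) ⟩
            0# ∎
            where
            entry : Fin n × Fin (suc m) → Carrier
            entry (a′ , c′) = Δ a a′ * Δ c′ c
            U : Fin size → Fin N → Carrier
            U i k = app (u (live i)) (restricted k)
            V : Fin size → Sub N p → Carrier
            V i s = app (v (live i)) (λ bc → ω (s , bc))

-- Binomial coefficients and the arithmetic of the bound.

absorption : ∀ n k → suc k ℕ.* (suc n C suc k) ≡ suc n ℕ.* (n C k)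
absorption n zero = begin
  1 ℕ.* (suc n C 1)  ≡⟨ ℕ.*-identityˡ _ ⟩
  suc n C 1          ≡⟨ nC1≡n (suc n) ⟩
  suc n              ≡⟨ ℕ.*-identityʳ (suc n) ⟨
  suc n ℕ.* 1        ∎
  where open ≡.≡-Reasoning
absorption zero (suc k) = ℕ.*-zeroʳ (suc (suc k))
absorption (suc n) (suc k) = begin
  suc (suc k) ℕ.* (suc (suc n) C suc (suc k))
    ≡⟨ ≡.cong (suc (suc k) ℕ.*_) (nCk+nC[k+1]≡[n+1]C[k+1] (suc n) (suc k)) ⟨
  suc (suc k) ℕ.* (suc n C suc k ℕ.+ suc n C suc (suc k))
    ≡⟨ ℕ.*-distribˡ-+ (suc (suc k)) (suc n C suc k) _ ⟩
  suc n C suc k ℕ.+ suc k ℕ.* (suc n C suc k) ℕ.+ suc (suc k) ℕ.* (suc n C suc (suc k))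
    ≡⟨ ≡.cong₂ (λ x y → suc n C suc k ℕ.+ x ℕ.+ y) (absorption n k) (absorption n (suc k)) ⟩
  suc n C suc k ℕ.+ suc n ℕ.* (n C k) ℕ.+ suc n ℕ.* (n C suc k)
    ≡⟨ ℕ.+-assoc (suc n C suc k) _ _ ⟩
  suc n C suc k ℕ.+ (suc n ℕ.* (n C k) ℕ.+ suc n ℕ.* (n C suc k))
    ≡⟨ ≡.cong (suc n C suc k ℕ.+_) (ℕ.*-distribˡ-+ (suc n) (n C k) _) ⟨
  suc n C suc k ℕ.+ suc n ℕ.* (n C k ℕ.+ n C suc k)
    ≡⟨ ≡.cong (λ x → suc n C suc k ℕ.+ suc n ℕ.* x) (nCk+nC[k+1]≡[n+1]C[k+1] n k) ⟩
  suc (suc n) ℕ.* (suc n C suc k) ∎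
  where open ≡.≡-Reasoning

C>0 : ∀ {n k} → k ℕ.≤ n → 1 ℕ.≤ n C k
C>0 {n}     {zero}  _           = ℕ.≤-refl
C>0 {suc n} {suc k} (ℕ.s≤s k≤n) = ℕ.≤-trans (ℕ.≤-trans (C>0 k≤n) (ℕ.m≤m+n (n C k) (n C suc k)))
  (ℕ.≤-reflexive (nCk+nC[k+1]≡[n+1]C[k+1] n k))

C≥n : ∀ {n k} → k ℕ.< n → suc n ℕ.≤ suc n C suc k
C≥n {n}     {zero}  _           = ℕ.≤-reflexive (≡.sym (nC1≡n (suc n)))
C≥n {suc n} {suc k} (ℕ.s≤s k<n) = ℕ.≤-trans
  (ℕ.≤-trans (ℕ.≤-reflexive (ℕ.+-comm 1 (suc n))) (ℕ.+-mono-≤ (C≥n k<n) (C>0 (ℕ.s≤s k<n))))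
  (ℕ.≤-reflexive (nCk+nC[k+1]≡[n+1]C[k+1] (suc n) (suc k)))

-- The source of the factor (2p+1)/(p+1). By symmetry C(2p+1, p) = C(2p+1, p+1), and absorption
-- applies to the latter.
middle : ∀ p → suc p ℕ.* (suc (2 ℕ.* p) C p) ≡ suc (2 ℕ.* p) ℕ.* ((2 ℕ.* p) C p)
middle p = ≡.trans (≡.cong (suc p ℕ.*_) symmetric) (absorption (2 ℕ.* p) p)
  where
  open ≡.≡-Reasoning
  symmetric : suc (2 ℕ.* p) C p ≡ suc (2 ℕ.* p) C suc p
  symmetric = begin
    suc (2 ℕ.* p) C p                        ≡⟨ nCk≡nC[n∸k] (ℕ.m≤n⇒m≤1+n (ℕ.m≤m+n p _)) ⟩
    suc (2 ℕ.* p) C (suc (2 ℕ.* p) ℕ.∸ p)    ≡⟨ ≡.cong (suc (2 ℕ.* p) C_) (≡.cong (ℕ._∸ p) (double p)) ⟩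
    suc (2 ℕ.* p) C (p ℕ.+ suc p ℕ.∸ p)      ≡⟨ ≡.cong (suc (2 ℕ.* p) C_) (ℕ.m+n∸m≡n p (suc p)) ⟩
    suc (2 ℕ.* p) C suc p                    ∎
    where
    double : ∀ p → suc (2 ℕ.* p) ≡ p ℕ.+ suc p
    double = solve-∀

slope : ℕ → ℕ
slope p = 1 ℕ.+ 2 ℕ.* p ℕ.* binomial (2 ℕ.* p) (ℤ.+ p ℤ.- ℤ.+ 1)

-- With C₀ = C(2p, p) and C₁ = C(2p, p-1) the left side is C₁ + C₀ + 2p, where C₀ ≤ 2 C₁ and 2p ≤
-- C₁. The resulting 4 C₁ is at most 2p C₁ because p ≥ 2; for p = 1 the inequality would read 5 ≤ 3.
slope-bound : ∀ q → let p = suc (suc q) in (suc (2 ℕ.* p) C p) ℕ.+ 2 ℕ.* p ℕ.≤ slope p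
slope-bound q = begin
  (suc (2 ℕ.* p) C p) ℕ.+ 2 ℕ.* p                 ≡⟨ ≡.cong (ℕ._+ 2 ℕ.* p) (nCk+nC[k+1]≡[n+1]C[k+1] (2 ℕ.* p) (suc q)) ⟨
  C₁ ℕ.+ C₀ ℕ.+ 2 ℕ.* p                           ≤⟨ ℕ.+-mono-≤ (ℕ.+-monoʳ-≤ C₁ C₀≤2C₁) 2p≤C₁ ⟩
  C₁ ℕ.+ 2 ℕ.* C₁ ℕ.+ C₁                          ≤⟨ ℕ.m≤m+n _ (1 ℕ.+ 2 ℕ.* q ℕ.* C₁) ⟩
  C₁ ℕ.+ 2 ℕ.* C₁ ℕ.+ C₁ ℕ.+ (1 ℕ.+ 2 ℕ.* q ℕ.* C₁)  ≡⟨ regroup q C₁ ⟩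
  1 ℕ.+ 2 ℕ.* p ℕ.* C₁                            ∎
  where
  open ℕ.≤-Reasoning
  p  = suc (suc q)
  C₀ = (2 ℕ.* p) C p
  C₁ = (2 ℕ.* p) C suc q
  regroup : ∀ q c → c ℕ.+ 2 ℕ.* c ℕ.+ c ℕ.+ (1 ℕ.+ 2 ℕ.* q ℕ.* c) ≡ 1 ℕ.+ 2 ℕ.* suc (suc q) ℕ.* c
  regroup = solve-∀
  -- Adding p C₁ to both sides turns this into the absorption identity for C(2p+1, p).
  ratio : p ℕ.* C₀ ≡ suc p ℕ.* C₁
  ratio = ℕ.+-cancelˡ-≡ (p ℕ.* C₁) _ _ (begin-equality
    p ℕ.* C₁ ℕ.+ p ℕ.* C₀          ≡⟨ ℕ.*-distribˡ-+ p C₁ C₀ ⟨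
    p ℕ.* (C₁ ℕ.+ C₀)              ≡⟨ ≡.cong (p ℕ.*_) (nCk+nC[k+1]≡[n+1]C[k+1] (2 ℕ.* p) (suc q)) ⟩
    p ℕ.* (suc (2 ℕ.* p) C p)      ≡⟨ absorption (2 ℕ.* p) (suc q) ⟩
    suc (2 ℕ.* p) ℕ.* C₁           ≡⟨ double p C₁ ⟩
    p ℕ.* C₁ ℕ.+ suc p ℕ.* C₁      ∎)
    where
    double : ∀ p c → suc (2 ℕ.* p) ℕ.* c ≡ p ℕ.* c ℕ.+ suc p ℕ.* c
    double = solve-∀
  C₀≤2C₁ : C₀ ℕ.≤ 2 ℕ.* C₁
  C₀≤2C₁ = ℕ.*-cancelˡ-≤ p (begin
    p ℕ.* C₀                  ≡⟨ ratio ⟩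
    suc p ℕ.* C₁              ≤⟨ ℕ.*-monoˡ-≤ C₁ (ℕ.s≤s (ℕ.m≤n+m p (suc q))) ⟩
    (p ℕ.+ p) ℕ.* C₁          ≡⟨ double p C₁ ⟩
    p ℕ.* (2 ℕ.* C₁)          ∎)
    where
    double : ∀ p c → (p ℕ.+ p) ℕ.* c ≡ p ℕ.* (2 ℕ.* c)
    double = solve-∀
  2p≤C₁ : 2 ℕ.* p ℕ.≤ C₁
  2p≤C₁ = C≥n (ℕ.s≤s (ℕ.m≤m+n q _))

-- Multiplying the first hypothesis by p+1 brings out C(2p, p) on both sides through `middle`; being
-- positive, it cancels. The second hypothesis then eliminates r′.
koszul-arithmetic : ∀ p n m r r′ → (suc (2 ℕ.* p) C p) ℕ.* (n ℕ.* m) ℕ.≤ r′ ℕ.* ((2 ℕ.* p) C p) →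
  r′ ℕ.+ n ℕ.* n ℕ.≤ r ℕ.+ (suc (2 ℕ.* p) C p) ℕ.* n →
  suc (2 ℕ.* p) ℕ.* (n ℕ.* m) ℕ.+ suc p ℕ.* (n ℕ.* n) ℕ.≤ suc p ℕ.* (r ℕ.+ (suc (2 ℕ.* p) C p) ℕ.* n)
koszul-arithmetic p n m r r′ h₁ h₂ = begin
  suc (2 ℕ.* p) ℕ.* (n ℕ.* m) ℕ.+ suc p ℕ.* (n ℕ.* n)  ≤⟨ ℕ.+-monoˡ-≤ (suc p ℕ.* (n ℕ.* n)) (ℕ.*-cancelʳ-≤ (suc (2 ℕ.* p) ℕ.* (n ℕ.* m)) (suc p ℕ.* r′) B {{ℕ.>-nonZero (C>0 (ℕ.m≤m+n p _))}} scaled) ⟩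
  suc p ℕ.* r′ ℕ.+ suc p ℕ.* (n ℕ.* n)                 ≡⟨ ℕ.*-distribˡ-+ (suc p) r′ (n ℕ.* n) ⟨
  suc p ℕ.* (r′ ℕ.+ n ℕ.* n)                           ≤⟨ ℕ.*-monoʳ-≤ (suc p) h₂ ⟩
  suc p ℕ.* (r ℕ.+ A ℕ.* n)                            ∎
  where
  open ℕ.≤-Reasoning
  A = suc (2 ℕ.* p) C p
  B = (2 ℕ.* p) C p
  scaled : suc (2 ℕ.* p) ℕ.* (n ℕ.* m) ℕ.* B ℕ.≤ suc p ℕ.* r′ ℕ.* B
  scaled = begin
    suc (2 ℕ.* p) ℕ.* (n ℕ.* m) ℕ.* B   ≡⟨ exchange (suc (2 ℕ.* p)) (n ℕ.* m) B ⟩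
    suc (2 ℕ.* p) ℕ.* B ℕ.* (n ℕ.* m)   ≡⟨ ≡.cong (ℕ._* (n ℕ.* m)) (middle p) ⟨
    suc p ℕ.* A ℕ.* (n ℕ.* m)           ≡⟨ ℕ.*-assoc (suc p) A (n ℕ.* m) ⟩
    suc p ℕ.* (A ℕ.* (n ℕ.* m))         ≤⟨ ℕ.*-monoʳ-≤ (suc p) h₁ ⟩
    suc p ℕ.* (r′ ℕ.* B)                ≡⟨ ℕ.*-assoc (suc p) r′ B ⟨
    suc p ℕ.* r′ ℕ.* B                  ∎
    where
    exchange : ∀ a b c → a ℕ.* b ℕ.* c ≡ a ℕ.* c ℕ.* b
    exchange = solve-∀

-- The two eliminations yield 2tm terms, enough for the (2p+1)/(p+1) tm that the removed part
-- requires. What is missing is n² - k² = 2tk + t² ≤ 2tn for n = t + k, which the reserve of 2t in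
-- `b` pays for. The summand added in the first step is the exact slack of these estimates.
reduction-arithmetic : ∀ p t k m r A {b} → A ℕ.+ 2 ℕ.* t ℕ.≤ b →
  suc (2 ℕ.* p) ℕ.* (k ℕ.* m) ℕ.+ suc p ℕ.* (k ℕ.* k) ℕ.≤ suc p ℕ.* (r ℕ.+ A ℕ.* k) →
  suc (2 ℕ.* p) ℕ.* ((t ℕ.+ k) ℕ.* m) ℕ.+ suc p ℕ.* ((t ℕ.+ k) ℕ.* (t ℕ.+ k))
    ℕ.≤ suc p ℕ.* (t ℕ.* m ℕ.+ (t ℕ.* m ℕ.+ r) ℕ.+ b ℕ.* (t ℕ.+ k))
reduction-arithmetic p t k m r A {b} A+2t≤b h = begin
  suc (2 ℕ.* p) ℕ.* ((t ℕ.+ k) ℕ.* m) ℕ.+ suc p ℕ.* ((t ℕ.+ k) ℕ.* (t ℕ.+ k))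
    ≤⟨ ℕ.m≤m+n _ (t ℕ.* m ℕ.+ suc p ℕ.* (t ℕ.* t) ℕ.+ suc p ℕ.* (A ℕ.* t)) ⟩
  suc (2 ℕ.* p) ℕ.* ((t ℕ.+ k) ℕ.* m) ℕ.+ suc p ℕ.* ((t ℕ.+ k) ℕ.* (t ℕ.+ k)) ℕ.+ (t ℕ.* m ℕ.+ suc p ℕ.* (t ℕ.* t) ℕ.+ suc p ℕ.* (A ℕ.* t))
    ≡⟨ regroup₁ p t k m A ⟩
  suc (2 ℕ.* p) ℕ.* (k ℕ.* m) ℕ.+ suc p ℕ.* (k ℕ.* k) ℕ.+ suc p ℕ.* (2 ℕ.* (t ℕ.* m) ℕ.+ 2 ℕ.* t ℕ.* (t ℕ.+ k) ℕ.+ A ℕ.* t)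
    ≤⟨ ℕ.+-monoˡ-≤ _ h ⟩
  suc p ℕ.* (r ℕ.+ A ℕ.* k) ℕ.+ suc p ℕ.* (2 ℕ.* (t ℕ.* m) ℕ.+ 2 ℕ.* t ℕ.* (t ℕ.+ k) ℕ.+ A ℕ.* t)
    ≡⟨ regroup₂ p t k m r A ⟩
  suc p ℕ.* (t ℕ.* m ℕ.+ (t ℕ.* m ℕ.+ r) ℕ.+ (A ℕ.+ 2 ℕ.* t) ℕ.* (t ℕ.+ k))
    ≤⟨ ℕ.*-monoʳ-≤ (suc p) (ℕ.+-monoʳ-≤ (t ℕ.* m ℕ.+ (t ℕ.* m ℕ.+ r)) (ℕ.*-monoˡ-≤ (t ℕ.+ k) A+2t≤b)) ⟩
  suc p ℕ.* (t ℕ.* m ℕ.+ (t ℕ.* m ℕ.+ r) ℕ.+ b ℕ.* (t ℕ.+ k)) ∎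
  where
  open ℕ.≤-Reasoning
  regroup₁ : ∀ p t k m A →
    suc (2 ℕ.* p) ℕ.* ((t ℕ.+ k) ℕ.* m) ℕ.+ suc p ℕ.* ((t ℕ.+ k) ℕ.* (t ℕ.+ k)) ℕ.+ (t ℕ.* m ℕ.+ suc p ℕ.* (t ℕ.* t) ℕ.+ suc p ℕ.* (A ℕ.* t))
    ≡ suc (2 ℕ.* p) ℕ.* (k ℕ.* m) ℕ.+ suc p ℕ.* (k ℕ.* k) ℕ.+ suc p ℕ.* (2 ℕ.* (t ℕ.* m) ℕ.+ 2 ℕ.* t ℕ.* (t ℕ.+ k) ℕ.+ A ℕ.* t)
  regroup₁ = solve-∀
  regroup₂ : ∀ p t k m r A →
    suc p ℕ.* (r ℕ.+ A ℕ.* k) ℕ.+ suc p ℕ.* (2 ℕ.* (t ℕ.* m) ℕ.+ 2 ℕ.* t ℕ.* (t ℕ.+ k) ℕ.+ A ℕ.* t)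
    ≡ suc p ℕ.* (t ℕ.* m ℕ.+ (t ℕ.* m ℕ.+ r) ℕ.+ (A ℕ.+ 2 ℕ.* t) ℕ.* (t ℕ.+ k))
  regroup₂ = solve-∀

-- The lower bound over a classical field.

module LowerBound {c ℓ} (F : ClassicalField c ℓ) where

  open Trilinear F public

  -- The claim with the denominator p+1 cleared and the subtraction moved across, hence decidable in
  -- the natural numbers.
  record Bounded (p n m r b : ℕ) : Set where
    constructor bounded
    field
      bound : suc (2 ℕ.* p) ℕ.* (n ℕ.* m) ℕ.+ suc p ℕ.* (n ℕ.* n) ℕ.≤ suc p ℕ.* (r ℕ.+ b ℕ.* n)
  open Bounded public

  bound-stable : ∀ {p n m r b} → ¬ ¬ Bounded p n m r b → Bounded p n m r b
  bound-stable h = bounded (decidable-stable (_ ℕ.≤? _) λ k → h (k ∘ bound))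

  injective-bound : ∀ p {n m r} X → Injective p {n} X → Decomposes n n (suc m) r → ¬ ¬ Bounded p n (suc m) r (suc (2 ℕ.* p) C p)
  injective-bound p {n} {m} {r} X inj D = do
    r′ , h₁ , h₂ ← koszul-bound p (X , inj) D
    return (bounded (koszul-arithmetic p n (suc m) r r′ h₁ h₂))

  -- Columns of X are eliminated first, then, after transposition, its rows. There are `suc a`
  -- blocks because `reduce` needs at least one row to be left.
  block-bound : ∀ p t a {m r} → (suc (2 ℕ.* p) C p) ℕ.+ 2 ℕ.* t ℕ.≤ slope p → let n = t ℕ.+ suc a ℕ.* suc p in
                Decomposes n n (suc m) r → ¬ ¬ Bounded p n (suc m) r (slope p)
  block-bound p t a {m} {r} slack D = do
    r₁ , eq₁ , D₁ ← reduce* t (≡.subst (λ n → Decomposes n (t ℕ.+ k) (suc m) r) (ℕ.+-suc t (p ℕ.+ a ℕ.* suc p)) D)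
    r₂ , eq₂ , D₂ ← reduce* t (transposed (≡.subst (λ n → Decomposes n k (suc m) r₁) (≡.sym (ℕ.+-suc t (p ℕ.+ a ℕ.* suc p))) D₁))
    h ← injective-bound p (λ i → matrix (momentForm (suc a) p i)) (moments-injective (suc a) p) D₂
    return (≡.subst (λ r → Bounded p (t ℕ.+ k) (suc m) r (slope p)) (≡.trans (≡.cong (t ℕ.* suc m ℕ.+_) eq₂) eq₁)
      (bounded (reduction-arithmetic p t k (suc m) r₂ (suc (2 ℕ.* p) C p) slack (bound h))))
    where
    k = suc a ℕ.* suc p

  division-bound : ∀ p {n m r} → (∀ {t} → t ℕ.≤ p → (suc (2 ℕ.* p) C p) ℕ.+ 2 ℕ.* t ℕ.≤ slope p) → p ℕ.< n →
                   Decomposes n n (suc m) r → ¬ ¬ Bounded p n (suc m) r (slope p)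
  division-bound p {n} {m} {r} slack p<n D with n ℕ./ suc p in eq | ℕ.m≥n⇒m/n>0 {n} {suc p} p<n
  -- A zero quotient is excluded by p < n, so at least one block exists.
  ... | suc a | _ = ≡.subst (λ n → Decomposes n n (suc m) r → ¬ ¬ Bounded p n (suc m) r (slope p))
    (≡.sym (≡.trans (ℕ.m≡m%n+[m/n]*n n (suc p)) (≡.cong (λ a → n ℕ.% suc p ℕ.+ a ℕ.* suc p) eq)))
    (block-bound p (n ℕ.% suc p) a (slack (ℕ.≤-pred (ℕ.m%n<n n (suc p))))) D

  lower-bound : ∀ p {n m r} → p ℕ.< n → Decomposes n n (suc m) r → Bounded p n (suc m) r (slope p)
  -- Every n is divisible by p+1 = 1, and `slope 0` and C(1, 0) are both 1.
  lower-bound zero p<n D = bound-stable (division-bound zero (λ { ℕ.z≤n → ℕ.≤-refl }) p<n D)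
  -- Both `slope 1` and C(3, 1) are 3, so nothing can be spent on eliminations.
  lower-bound (suc zero) {suc (suc n)} _ D = bound-stable (injective-bound 1 (λ k → matrix (commutatorForm k)) (commutator-injective n) D)
  lower-bound (suc zero) {suc zero} (ℕ.s≤s ())
  lower-bound (suc (suc q)) p<n D = bound-stable (division-bound (suc (suc q))
    (λ {t} t≤p → ℕ.≤-trans (ℕ.+-monoʳ-≤ _ (ℕ.*-monoʳ-≤ 2 t≤p)) (slope-bound q)) p<n D)

-- Inverses of real and complex numbers.

module ℝ-Properties where

  open +-*-Solver
  open import Data.Rational.Base using (_+_; _*_; _-_; -_; _<_; _≤_)

  halves : ∀ ε → ε ≡ ε * ½ + ε * ½
  halves ε = ≡.trans (≡.sym (ℚ.*-identityʳ ε)) (ℚ.*-distribˡ-+ ε ½ ½)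

  half>0 : ∀ {ε} → 0ℚ < ε → 0ℚ < ε * ½
  half>0 {ε} 0<ε = ℚ.positive⁻¹ (ε * ½) {{ℚ.pos*pos⇒pos ε {{ℚ.positive 0<ε}} ½}}

  ∣∣-triangle : ∀ p q → ∣ p ∣ ≤ ∣ p - q ∣ + ∣ q ∣
  ∣∣-triangle p q = ≡.subst (_≤ ∣ p - q ∣ + ∣ q ∣) (≡.cong ∣_∣ (solve 2 (λ p q → p :- q :+ q := p) ≡.refl p q)) (ℚ.∣p+q∣≤∣p∣+∣q∣ (p - q) q)

  ∣p-0∣≡∣p∣ : ∀ p → ∣ p - 0ℚ ∣ ≡ ∣ p ∣
  ∣p-0∣≡∣p∣ p = ≡.cong ∣_∣ (ℚ.+-identityʳ p)

  ∣p∣*∣p∣≡p*p : ∀ p → ∣ p ∣ * ∣ p ∣ ≡ p * p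
  ∣p∣*∣p∣≡p*p p with ℚ.∣p∣≡p∨∣p∣≡-p p
  ... | inj₁ eq = ≡.cong₂ _*_ eq eq
  ... | inj₂ eq = ≡.trans (≡.cong₂ _*_ eq eq) (solve 1 (λ p → (:- p) :* (:- p) := p :* p) ≡.refl p)

  0≤p*p : ∀ p → 0ℚ ≤ p * p
  0≤p*p p = ≡.subst (0ℚ ≤_) (∣p∣*∣p∣≡p*p p)
    (ℚ.nonNegative⁻¹ (∣ p ∣ * ∣ p ∣) {{ℚ.nonNeg*nonNeg⇒nonNeg (∣ p ∣) {{ℚ.∣-∣-nonNeg p}} (∣ p ∣) {{ℚ.∣-∣-nonNeg p}}}})

  square-mono : ∀ {ε p} → 0ℚ < ε → ε ≤ ∣ p ∣ → ε * ε ≤ p * p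
  square-mono {ε} {p} 0<ε ε≤∣p∣ = begin
    ε * ε          ≤⟨ ℚ.*-monoˡ-≤-nonNeg ε {{ℚ.pos⇒nonNeg ε {{ℚ.positive 0<ε}}}} ε≤∣p∣ ⟩
    ε * ∣ p ∣      ≤⟨ ℚ.*-monoʳ-≤-nonNeg ∣ p ∣ {{ℚ.∣-∣-nonNeg p}} ε≤∣p∣ ⟩
    ∣ p ∣ * ∣ p ∣  ≡⟨ ∣p∣*∣p∣≡p*p p ⟩
    p * p          ∎
    where open ℚ.≤-Reasoning

  Apart : ℝ → Set
  Apart x = ∃ λ ε → 0ℚ < ε × ∃ λ N → ∀ i → N ℕ.≤ i → ε ≤ ∣ seq x i ∣

  -- Beyond the Cauchy index N for ε/4 a single rational comparison decides: if |x N| < ε/2, all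
  -- later entries stay below ε, otherwise they all stay at least ε/4 in absolute value. If the
  -- second case never occurs, x tends to 0.
  apart : ∀ x → ¬ (x ≈ᴿ fromℚ 0ℚ) → ¬ ¬ Apart x
  apart x x≉0 ¬apart = x≉0 (mk≈ᴿ small)
    where
    small : ∀ ε → 0ℚ < ε → ∃ λ N → ∀ i → N ℕ.≤ i → ∣ seq x i - 0ℚ ∣ < ε
    small ε 0<ε with isCauchy x (ε * ½ * ½) (half>0 (half>0 0<ε))
    ... | N , close with ∣ seq x N ∣ ℚ.<? ε * ½
    ... | yes xN<ε½ = N , λ i N≤i → begin-strict
      ∣ seq x i - 0ℚ ∣                     ≡⟨ ∣p-0∣≡∣p∣ (seq x i) ⟩
      ∣ seq x i ∣                          ≤⟨ ∣∣-triangle (seq x i) (seq x N) ⟩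
      ∣ seq x i - seq x N ∣ + ∣ seq x N ∣  <⟨ ℚ.+-mono-< (close i N N≤i ℕ.≤-refl) xN<ε½ ⟩
      ε * ½ * ½ + ε * ½                    ≤⟨ ℚ.+-monoˡ-≤ (ε * ½) (begin
        ε * ½ * ½               ≡⟨ ℚ.+-identityʳ _ ⟨
        ε * ½ * ½ + 0ℚ          ≤⟨ ℚ.+-monoʳ-≤ (ε * ½ * ½) (ℚ.<⇒≤ (half>0 (half>0 0<ε))) ⟩
        ε * ½ * ½ + ε * ½ * ½   ≡⟨ halves (ε * ½) ⟨
        ε * ½                   ∎) ⟩
      ε * ½ + ε * ½                        ≡⟨ halves ε ⟨
      ε                                    ∎
      where open ℚ.≤-Reasoning
    ... | no xN≮ε½ = contradiction (ε * ½ * ½ , half>0 (half>0 0<ε) , N , λ i N≤i → ℚ.≮⇒≥ λ xi< → xN≮ε½ (begin-strict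
      ∣ seq x N ∣                          ≤⟨ ∣∣-triangle (seq x N) (seq x i) ⟩
      ∣ seq x N - seq x i ∣ + ∣ seq x i ∣  <⟨ ℚ.+-mono-< (close N i ℕ.≤-refl N≤i) xi< ⟩
      ε * ½ * ½ + ε * ½ * ½                ≡⟨ halves (ε * ½) ⟨
      ε * ½                                ∎)) ¬apart
      where open ℚ.≤-Reasoning

  -- Made total by the value 0 at 0, because a nonzero real can have vanishing early entries.
  recip : ℚ → ℚ
  recip p with p ℚ.≟ 0ℚ
  ... | yes _  = 0ℚ
  ... | no p≢0 = (1/ p) {{ℚ.≢-nonZero p≢0}}

  recip-inverse : ∀ {p} → ¬ (p ≡ 0ℚ) → p * recip p ≡ 1ℚ
  recip-inverse {p} p≢0 with p ℚ.≟ 0ℚ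
  ... | yes p≡0 = contradiction p≡0 p≢0
  ... | no p≢0′ = ℚ.*-inverseʳ p {{ℚ.≢-nonZero p≢0′}}

  inverseᴿ : ∀ x → ¬ (x ≈ᴿ fromℚ 0ℚ) → ¬ ¬ ∃ λ y → x *ᴿ y ≈ᴿ fromℚ 1ℚ
  inverseᴿ x x≉0 = do
    ε , 0<ε , N , ε≤x ← apart x x≉0
    return (reciprocal ε 0<ε N ε≤x)
    where
    reciprocal : ∀ ε → 0ℚ < ε → ∀ N → (∀ i → N ℕ.≤ i → ε ≤ ∣ seq x i ∣) → ∃ λ y → x *ᴿ y ≈ᴿ fromℚ 1ℚ
    reciprocal ε 0<ε N ε≤x = mkℝ (recip ∘ seq x) cauchy , mk≈ᴿ λ η 0<η → N , λ i N≤i →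
      ≡.subst (_< η) (≡.cong (λ p → ∣ p - 1ℚ ∣) (≡.sym (recip-inverse (x≢0 i N≤i)))) 0<η
      where
      x≢0 : ∀ i → N ℕ.≤ i → ¬ (seq x i ≡ 0ℚ)
      x≢0 i N≤i eq = ℚ.<-irrefl ≡.refl (ℚ.<-≤-trans 0<ε (≡.subst (λ p → ε ≤ ∣ p ∣) eq (ε≤x i N≤i)))
      instance
        ε² : ℚ.Positive (ε * ε)
        ε² = ℚ.pos*pos⇒pos ε {{ℚ.positive 0<ε}} ε {{ℚ.positive 0<ε}}
      cauchy : IsCauchy (recip ∘ seq x)
      -- The tolerance comes from |1/p - 1/q| = |q - p| / |p q| with |p|, |q| ≥ ε.
      cauchy η 0<η with isCauchy x (η * (ε * ε)) (ℚ.positive⁻¹ _ {{ℚ.pos*pos⇒pos η {{ℚ.positive 0<η}} (ε * ε)}})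
      ... | M , close = N ℕ.⊔ M , λ i j ≤i ≤j → bound i j
        (ℕ.≤-trans (ℕ.m≤m⊔n N M) ≤i) (ℕ.≤-trans (ℕ.m≤m⊔n N M) ≤j)
        (close j i (ℕ.≤-trans (ℕ.m≤n⊔m N M) ≤j) (ℕ.≤-trans (ℕ.m≤n⊔m N M) ≤i))
        where
        open ℚ.≤-Reasoning
        bound : ∀ i j → N ℕ.≤ i → N ℕ.≤ j → ∣ seq x j - seq x i ∣ < η * (ε * ε) → ∣ recip (seq x i) - recip (seq x j) ∣ < η
        bound i j N≤i N≤j xj-xi< = ℚ.*-cancelʳ-<-nonNeg (ε * ε) {{ℚ.pos⇒nonNeg (ε * ε)}} (begin-strict
          ∣ p′ - q′ ∣ * (ε * ε)            ≤⟨ ℚ.*-monoˡ-≤-nonNeg ∣ p′ - q′ ∣ {{ℚ.∣-∣-nonNeg (p′ - q′)}} ε²≤ ⟩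
          ∣ p′ - q′ ∣ * (∣ p ∣ * ∣ q ∣)    ≡⟨ ≡.cong (∣ p′ - q′ ∣ *_) (ℚ.∣p*q∣≡∣p∣*∣q∣ p q) ⟨
          ∣ p′ - q′ ∣ * ∣ p * q ∣          ≡⟨ ℚ.∣p*q∣≡∣p∣*∣q∣ (p′ - q′) (p * q) ⟨
          ∣ (p′ - q′) * (p * q) ∣          ≡⟨ ≡.cong ∣_∣ (≡.trans (solve 4 (λ p q p′ q′ → (p′ :- q′) :* (p :* q) := (p :* p′) :* q :- (q :* q′) :* p) ≡.refl p q p′ q′)
            (≡.trans (≡.cong₂ (λ a b → a * q - b * p) (recip-inverse (x≢0 i N≤i)) (recip-inverse (x≢0 j N≤j)))
              (≡.cong₂ _-_ (ℚ.*-identityˡ q) (ℚ.*-identityˡ p)))) ⟩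
          ∣ q - p ∣                        <⟨ xj-xi< ⟩
          η * (ε * ε)                      ∎)
          where
          p  = seq x i
          q  = seq x j
          p′ = recip p
          q′ = recip q
          ε²≤ : ε * ε ≤ ∣ p ∣ * ∣ q ∣
          ε²≤ = begin
            ε * ε          ≤⟨ ℚ.*-monoˡ-≤-nonNeg ε {{ℚ.pos⇒nonNeg ε {{ℚ.positive 0<ε}}}} (ε≤x j N≤j) ⟩
            ε * ∣ q ∣      ≤⟨ ℚ.*-monoʳ-≤-nonNeg ∣ q ∣ {{ℚ.∣-∣-nonNeg q}} (ε≤x i N≤i) ⟩
            ∣ p ∣ * ∣ q ∣  ∎

  -- Positivity of squares, entry by entry. It makes the squared modulus of a nonzero complex number
  -- nonzero, so that the conjugate divided by it is an inverse.
  square-zero : ∀ x y → x *ᴿ x +ᴿ y *ᴿ y ≈ᴿ fromℚ 0ℚ → x ≈ᴿ fromℚ 0ℚ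
  square-zero x y s≈0 = mk≈ᴿ λ ε 0<ε →
    let N , small = difference→0 s≈0 (ε * ε) (ℚ.positive⁻¹ _ {{ℚ.pos*pos⇒pos ε {{ℚ.positive 0<ε}} ε {{ℚ.positive 0<ε}}}})
    in N , λ i N≤i → bound ε 0<ε (seq x i) (seq y i) (small i N≤i)
    where
    open ℚ.≤-Reasoning
    bound : ∀ ε → 0ℚ < ε → ∀ p q → ∣ p * p + q * q - 0ℚ ∣ < ε * ε → ∣ p - 0ℚ ∣ < ε
    bound ε 0<ε p q small with ∣ p ∣ ℚ.<? ε
    ... | yes p<ε = ≡.subst (_< ε) (≡.sym (∣p-0∣≡∣p∣ p)) p<ε
    ... | no  p≮ε = contradiction (begin-strict
      ε * ε                   ≤⟨ square-mono 0<ε (ℚ.≮⇒≥ p≮ε) ⟩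
      p * p                   ≡⟨ ℚ.+-identityʳ (p * p) ⟨
      p * p + 0ℚ              ≤⟨ ℚ.+-monoʳ-≤ (p * p) (0≤p*p q) ⟩
      p * p + q * q           ≡⟨ ℚ.0≤p⇒∣p∣≡p (ℚ.+-mono-≤ (0≤p*p p) (0≤p*p q)) ⟨
      ∣ p * p + q * q ∣       ≡⟨ ∣p-0∣≡∣p∣ (p * p + q * q) ⟨
      ∣ p * p + q * q - 0ℚ ∣  <⟨ small ⟩
      ε * ε                   ∎) (ℚ.<-irrefl ≡.refl)

module ℂ-Properties where

  open ℝ-Properties
  private
    module R = CommutativeRing ℝ-commutativeRing
  open IntegerCoefficients ℝ-commutativeRing

  inverseᶜ : ∀ z → ¬ (z ≈ᶜ 0ᶜ) → ¬ ¬ ∃ λ w → z *ᶜ w ≈ᶜ 1ᶜ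
  inverseᶜ (a +i b) z≉0 = do
    t , st≈1 ← inverseᴿ (a *ᴿ a +ᴿ b *ᴿ b) λ s≈0 →
      z≉0 (square-zero a b s≈0 , square-zero b a (R.trans (R.+-comm (b *ᴿ b) (a *ᴿ a)) s≈0))
    return ((a *ᴿ t) +i (-ᴿ (b *ᴿ t))
      , ( R.trans (solve 3 (λ a b t → a :* (a :* t) :- b :* (:- (b :* t)) := (a :* a :+ b :* b) :* t) R.refl a b t) st≈1
        , R.trans (solve 3 (λ a b t → a :* (:- (b :* t)) :+ b :* (a :* t) := a :- a) R.refl a b t) (R.-‿inverseʳ a)))

-- The complex numbers as a classical field.

module DoubleNegation (K : CommutativeRing 0ℓ 0ℓ) where
  open CommutativeRing K

  ¬¬-commutativeRing : CommutativeRing 0ℓ 0ℓ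
  ¬¬-commutativeRing = record
    { Carrier = Carrier
    ; _≈_ = λ x y → ¬ ¬ (x ≈ y)
    ; _+_ = _+_
    ; _*_ = _*_
    ; -_ = -_
    ; 0# = 0#
    ; 1# = 1#
    ; isCommutativeRing = record
      { isRing = record
        { +-isAbelianGroup = record
          { isGroup = record
            { isMonoid = record
              { isSemigroup = record
                { isMagma = record
                  { isEquivalence = record
                    { refl = return refl
                    ; sym = λ p → p >>= λ p → return (sym p)
                    ; trans = λ p q → p >>= λ p → q >>= λ q → return (trans p q)
                    }
                  ; ∙-cong = λ p q → p >>= λ p → q >>= λ q → return (+-cong p q)
                  }
                ; assoc = λ x y z → return (+-assoc x y z)
                }
              ; identity = (λ x → return (+-identityˡ x)) , (λ x → return (+-identityʳ x))
              }
            ; inverse = (λ x → return (-‿inverseˡ x)) , (λ x → return (-‿inverseʳ x))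
            ; ⁻¹-cong = λ p → p >>= λ p → return (-‿cong p)
            }
          ; comm = λ x y → return (+-comm x y)
          }
        ; *-cong = λ p q → p >>= λ p → q >>= λ q → return (*-cong p q)
        ; *-assoc = λ x y z → return (*-assoc x y z)
        ; *-identity = (λ x → return (*-identityˡ x)) , (λ x → return (*-identityʳ x))
        ; distrib = (λ x y z → return (distribˡ x y z)) , (λ x y z → return (distribʳ x y z))
        }
      ; *-comm = λ x y → return (*-comm x y)
      }
    }

module ℂ-Field where

  open ℂ-Properties
  open ℝ-Properties using (∣p-0∣≡∣p∣)
  open DoubleNegation ℂ-commutativeRing
  open Mult (CommutativeRing.semiring ¬¬-commutativeRing) using () renaming (_×_ to _·_)

  re·≥0 : ∀ n i → 0ℚ ℚ.≤ seq (re (n · 1ᶜ)) i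
  re·≥0 zero    i = ℚ.≤-refl
  re·≥0 (suc n) i = ℚ.+-mono-≤ (ℚ.nonNegative⁻¹ 1ℚ) (re·≥0 n i)

  -- Every entry of the real part of n+1 is at least 1, so the sequence does not tend to 0.
  char0ᶜ : ∀ n → ¬ (suc n · 1ᶜ ≈ᶜ 0ᶜ)
  char0ᶜ n (re≈ , _) with difference→0 re≈ 1ℚ (ℚ.positive⁻¹ 1ℚ)
  ... | N , small = ℚ.<-irrefl ≡.refl (begin-strict
    1ℚ               ≡⟨ ℚ.+-identityʳ 1ℚ ⟨
    1ℚ ℚ.+ 0ℚ        ≤⟨ ℚ.+-monoʳ-≤ 1ℚ (re·≥0 n N) ⟩
    v                ≡⟨ ℚ.0≤p⇒∣p∣≡p (re·≥0 (suc n) N) ⟨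
    ∣ v ∣            ≡⟨ ∣p-0∣≡∣p∣ v ⟨
    ∣ v ℚ.- 0ℚ ∣     <⟨ small N ℕ.≤-refl ⟩
    1ℚ               ∎)
    where
    open ℚ.≤-Reasoning
    v = seq (re (suc n · 1ᶜ)) N

  ℂ-field : ClassicalField 0ℓ 0ℓ
  ℂ-field = record
    { commutativeRing = ¬¬-commutativeRing
    ; stable          = negated-stable
    ; inverse         = λ z z≉0 → inverseᶜ z (λ z≈0 → z≉0 (return z≈0)) >>= λ (w , zw≈1) → return (w , return zw≈1)
    ; char0           = λ n h → h (char0ᶜ n)
    }

open ℂ-Field using (ℂ-field)

-- From rank decompositions to trilinear ones.

module Conversion {n m : ℕ} where

  open LowerBound ℂ-field
  open LeftModule

  fromMatrix : ∀ {a b} → (Fin a → Fin b → ℂ) → Fin a × Fin b → ℂ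
  fromMatrix X (i , j) = X i j

  fromLinearForm : ∀ {a b} → LinearForm (Mat a b) → Form (Fin a × Fin b)
  fromLinearForm φ = record
    { app    = λ x → LinearForm.⟦_⟧ φ (curry x)
    -- A linear form respects equality proper, while only its double negation is given at each
    -- entry. As there are finitely many entries, the double negations can be pulled out in front.
    ; cong   = λ x≈y → ¬¬-finite (λ i → ¬¬-finite λ j → x≈y (i , j)) >>= λ x≈y → return (⟦⟧-cong x≈y)
    ; linear = λ x k y → trans (return (+ᴹ-homo _ _)) (+-congˡ (return (*ₗ-homo k _)))
    }
    where
    open LeftModuleMorphisms.IsLeftModuleHomomorphism (LinearForm.isLinear φ)

  open RawMonoidDefinitions (+ᴹ-rawMonoid (Mat n m)) using () renaming (sum to sumᴹ)

  sumᴹ-entry : ∀ {r} (w : Fin r → Fin n → Fin m → ℂ) a c → sumᴹ w a c ≡ sum λ i → w i a c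
  sumᴹ-entry {zero}  w a c = ≡.refl
  sumᴹ-entry {suc r} w a c = ≡.cong (λ z → w zero a c + z) (sumᴹ-entry (w ∘ suc) a c)

  fromDecomposition : ∀ {k r} → Decomposition M⟨ n , k , m ⟩ r → Decomposes n k m r
  fromDecomposition {k} {r} D = from-entries (fromLinearForm ∘ u) (fromLinearForm ∘ v) (λ i → fromMatrix (w i)) λ x y a c →
    trans (return (decomposes (curry x) (curry y) a c)) (reflexive (sumᴹ-entry (terms x y) a c))
    where
    open Decomposition D
    terms : (Fin n × Fin k → ℂ) → (Fin k × Fin m → ℂ) → Fin r → Fin n → Fin m → ℂ
    terms x y i a c = (LinearForm.⟦_⟧ (u i) (curry x) *ᶜ LinearForm.⟦_⟧ (v i) (curry y)) *ᶜ w i a c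

-- Passage from natural to rational inequalities.

module Rational where

  open import Data.Rational.Base using (_/_; _+_; _-_; _*_; _≥_; _≤_; toℚᵘ)
  open +-*-Solver

  toℚᵘ-/ : ∀ i d → toℚᵘ (i / suc d) ℚᵘ.≃ ℚᵘ.mkℚᵘ i d
  toℚᵘ-/ i d = ℚ.toℚᵘ-fromℚᵘ (ℚᵘ.mkℚᵘ i d)

  embed : ℕ → ℚ
  embed n = + n / 1

  embed-+ : ∀ m n → embed (m ℕ.+ n) ≡ embed m + embed n
  embed-+ m n = ℚ.toℚᵘ-injective (begin
    toℚᵘ (embed (m ℕ.+ n))                    ≈⟨ toℚᵘ-/ (+ (m ℕ.+ n)) 0 ⟩
    ℚᵘ.mkℚᵘ (+ (m ℕ.+ n)) 0                   ≈⟨ ℚᵘ.*≡* (≡.cong (ℤ._* + 1) (≡.cong₂ ℤ._+_ (≡.sym (ℤ.*-identityʳ (+ m))) (≡.sym (ℤ.*-identityʳ (+ n))))) ⟩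
    ℚᵘ.mkℚᵘ (+ m) 0 ℚᵘ.+ ℚᵘ.mkℚᵘ (+ n) 0      ≈⟨ ℚᵘ.+-cong (toℚᵘ-/ (+ m) 0) (toℚᵘ-/ (+ n) 0) ⟨
    toℚᵘ (embed m) ℚᵘ.+ toℚᵘ (embed n)        ≈⟨ ℚ.toℚᵘ-homo-+ (embed m) (embed n) ⟨
    toℚᵘ (embed m + embed n)                  ∎)
    where open ℚᵘ.≃-Reasoning

  -- Cross multiplication in the unnormalised rationals. The case d = 0 makes `embed`
  -- multiplicative, and n = d+1 clears the denominator of (2p+1)/(p+1).
  /-embed : ∀ m d n k → m ℕ.* n ≡ k ℕ.* suc d → (+ m / suc d) * embed n ≡ embed k
  /-embed m d n k eq = ℚ.toℚᵘ-injective (begin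
    toℚᵘ ((+ m / suc d) * embed n)                ≈⟨ ℚ.toℚᵘ-homo-* (+ m / suc d) (embed n) ⟩
    toℚᵘ (+ m / suc d) ℚᵘ.* toℚᵘ (embed n)        ≈⟨ ℚᵘ.*-cong (toℚᵘ-/ (+ m) d) (toℚᵘ-/ (+ n) 0) ⟩
    ℚᵘ.mkℚᵘ (+ m) d ℚᵘ.* ℚᵘ.mkℚᵘ (+ n) 0          ≈⟨ ℚᵘ.*≡* (≡.trans (ℤ.*-identityʳ (+ m ℤ.* + n))
      (≡.trans (≡.sym (ℤ.pos-* m n)) (≡.trans (≡.cong +_ (≡.trans eq (≡.cong (λ e → k ℕ.* suc e) (≡.sym (ℕ.*-identityʳ d))))) (ℤ.pos-* k _)))) ⟩
    ℚᵘ.mkℚᵘ (+ k) 0                               ≈⟨ toℚᵘ-/ (+ k) 0 ⟨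
    toℚᵘ (embed k)                                ∎)
    where open ℚᵘ.≃-Reasoning

  embed-* : ∀ m n → embed (m ℕ.* n) ≡ embed m * embed n
  embed-* m n = ≡.sym (/-embed m 0 n (m ℕ.* n) (≡.sym (ℕ.*-identityʳ (m ℕ.* n))))

  embed-mono : ∀ {m n} → m ℕ.≤ n → embed m ≤ embed n
  embed-mono {m} {n} m≤n = ℚ.toℚᵘ-cancel-≤ (begin
    toℚᵘ (embed m)     ≃⟨ toℚᵘ-/ (+ m) 0 ⟩
    ℚᵘ.mkℚᵘ (+ m) 0    ≤⟨ ℚᵘ.*≤* (ℤ.*-monoʳ-≤-nonNeg (+ 1) (ℤ.+≤+ m≤n)) ⟩
    ℚᵘ.mkℚᵘ (+ n) 0    ≃⟨ toℚᵘ-/ (+ n) 0 ⟨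
    toℚᵘ (embed n)     ∎)
    where open ℚᵘ.≤-Reasoning

  clear-denominator : ∀ a d x y r b n → a ℕ.* x ℕ.+ suc d ℕ.* y ℕ.≤ suc d ℕ.* (r ℕ.+ b ℕ.* n) →
                      embed r ≥ (+ a / suc d) * embed x + embed y - embed b * embed n
  clear-denominator a d x y r b n h = begin
    q * X + Y - B * N                  ≤⟨ ℚ.+-monoˡ-≤ (ℚ.- (B * N)) (ℚ.*-cancelˡ-≤-pos D {{ℚ.normalize-pos (suc d) 1}} scaled) ⟩
    embed r + B * N - B * N            ≡⟨ solve 2 (λ r z → r :+ z :- z := r) ≡.refl (embed r) (B * N) ⟩
    embed r                            ∎
    where
    open ℚ.≤-Reasoning
    q = + a / suc d
    D = embed (suc d)
    X = embed x
    Y = embed y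
    B = embed b
    N = embed n
    scaled : D * (q * X + Y) ≤ D * (embed r + B * N)
    scaled = begin
      D * (q * X + Y)                          ≡⟨ solve 4 (λ D q X Y → D :* (q :* X :+ Y) := (q :* D) :* X :+ D :* Y) ≡.refl D q X Y ⟩
      (q * D) * X + D * Y                      ≡⟨ ≡.cong (λ z → z * X + D * Y) (/-embed a d (suc d) a ≡.refl) ⟩
      embed a * X + D * Y                      ≡⟨ ≡.cong₂ _+_ (embed-* a x) (embed-* (suc d) y) ⟨
      embed (a ℕ.* x) + embed (suc d ℕ.* y)    ≡⟨ embed-+ (a ℕ.* x) (suc d ℕ.* y) ⟨
      embed (a ℕ.* x ℕ.+ suc d ℕ.* y)          ≤⟨ embed-mono h ⟩
      embed (suc d ℕ.* (r ℕ.+ b ℕ.* n))        ≡⟨ embed-* (suc d) (r ℕ.+ b ℕ.* n) ⟩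
      D * embed (r ℕ.+ b ℕ.* n)                ≡⟨ ≡.cong (D *_) (≡.trans (embed-+ r (b ℕ.* n)) (≡.cong (λ z → embed r + z) (embed-* b n))) ⟩
      D * (embed r + B * N)                    ∎



open LowerBound ℂ-field using (lower-bound; bound)
open import Data.Rational.Base using (_/_; _+_; _-_; _*_; _≥_)

theorem1p1 : ∀ (n m p : ℕ) → n ℕ.≥ 1 → m ℕ.≥ 1 → p ℕ.≤ n ∸ 1 →
    ∀ (R : ℕ) → HasRank M⟨ n , n , m ⟩ R →
    + R / 1 ≥ (+ (2 ℕ.* p ℕ.+ 1) / suc p) * (+ (n ℕ.* m) / 1)
    + (+ (n ℕ.^ 2) / 1)
    - (+ (1 ℕ.+ 2 ℕ.* p ℕ.* binomial (2 ℕ.* p) (+ p ℤ.- + 1)) / 1) * (+ n / 1)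
theorem1p1 (suc n) (suc m) p _ _ p≤n R (D , _) =
  Rational.clear-denominator (2 ℕ.* p ℕ.+ 1) p (suc n ℕ.* suc m) (suc n ℕ.^ 2) R (slope p) (suc n)
    -- The rewriting only replaces 1 + 2p by 2p + 1 and n n by n².
    (≡.subst₂ (λ a s → a ℕ.* (suc n ℕ.* suc m) ℕ.+ suc p ℕ.* s ℕ.≤ suc p ℕ.* (R ℕ.+ slope p ℕ.* suc n))
      (ℕ.+-comm 1 (2 ℕ.* p)) (≡.cong (suc n ℕ.*_) (≡.sym (ℕ.*-identityʳ (suc n))))
      (bound (lower-bound p {suc n} {m} {R} (ℕ.s≤s p≤n) (Conversion.fromDecomposition {suc n} {suc m} {suc n} {R} D))))
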